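{- The linear maps $\mathcal{C}\colon\mathcal{Q}Sym\to\mathcal{Y}Sym$, $M_\mathsf{S}\mapsto M_{C(\mathsf{S})}$; $\Gamma\colon\mathcal{Y}Sym\to\mathfrak{S}Sym$, $M_t\mapsto M_{\gamma(t)}$; and $\mathcal{Z}\colon\mathcal{Q}Sym\to\mathfrak{S}Sym$, $M_\mathsf{S}\mapsto M_{Z(\mathsf{S})}$ are injective morphisms of coalgebras satisfying $\Gamma\circ\mathcal{C}=\mathcal{Z}$, and they split the surjections $\mathcal{L}$, $\Lambda$, $\mathcal{D}$ respectively: $\mathcal{L}\circ\mathcal{C}=\mathrm{id}_{\mathcal{Q}Sym}$, $\Lambda\circ\Gamma=\mathrm{id}_{\mathcal{Y}Sym}$, $\mathcal{D}\circ\mathcal{Z}=\mathrm{id}_{\mathcal{Q}Sym}$.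
   Context: Permutations: $\mathfrak{S}_n$ in one-line notation, weak order by inclusion of inversion sets, $\mathrm{Des}(\sigma)=\{p:\sigma(p)>\sigma(p+1)\}$, st = standardization. $\sigma\vee\tau$ has values $\sigma(1)+q,\dots,\sigma(p)+q,p+q+1,\tau(1),\dots,\tau(q)$; $\sigma\backslash\tau$ has values $\sigma(1)+q,\dots,\sigma(p)+q,\tau(1),\dots,\tau(q)$ ($\sigma\in\mathfrak{S}_p,\tau\in\mathfrak{S}_q$). Trees: $\mathcal{Y}_n$ rooted planar binary trees with $n$ internal nodes, $\mathcal{Y}_0=\{|\}$, $t=t_l\vee t_r$ uniquely; Tamari order generated by replacing a subtree $(A\vee B)\vee C$ by $A\vee(B\vee C)$; $1_0=|$, $1_n=1_{n-1}\vee|$; $|\backslash t=t$, $s\backslash t=s_l\vee(s_r\backslash t)$. $\lambda(\mathrm{id}_0)=|$, $\lambda(\sigma)=\lambda(\mathrm{st}(\sigma(1..j-1)))\vee\lambda(\mathrm{st}(\sigma(j+1..n)))$ with $j=\sigma^{ -1}(n)$; $\gamma(|)=\mathrm{id}_0$, $\gamma(t)=\gamma(t_l)\vee\gamma(t_r)$. For $\mathsf{S}=\{p_1<\dots<p_k\}\subseteq[n-1]$: $Z(\mathsf{S})=\mathrm{id}_{p_1}\backslash\mathrm{id}_{p_2-p_1}\backslash\cdots\backslash\mathrm{id}_{n-p_k}$, $C(\mathsf{S})=1_{p_1}\backslash1_{p_2-p_1}\backslash\cdots\backslash1_{n-p_k}$. $L(t)$: numbering leaves of $t\in\mathcal{Y}_n$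 as $0..n$ left to right, the set of $i\in[n-1]$ with leaf $i$ a left child. Hopf algebras over $\mathbb{Q}$: $\mathfrak{S}Sym$ (Malvenuto–Reutenauer) with basis $F_\sigma$, coproduct $\Delta F_\sigma=\sum_{i=0}^nF_{\mathrm{st}(\sigma(1..i))}\otimes F_{\mathrm{st}(\sigma(i+1..n))}$; $\mathcal{Y}Sym$ with basis $F_t$ and coproduct $\Delta F_t=\sum_{i=0}^nF_{\lambda(\mathrm{st}(\gamma(t)(1..i)))}\otimes F_{\lambda(\mathrm{st}(\gamma(t)(i+1..n)))}$; $\mathcal{Q}Sym$ (quasi-symmetric functions) with monomial basis $M_\alpha$ indexed by compositions $\alpha=(a_1,\dots,a_k)$ of $n$, identified with subsets $\mathsf{S}=\{a_1,a_1+a_2,\dots,a_1+\dots+a_{k-1}\}\subseteq[n-1]$, coproduct $\Delta M_\alpha=\sum_{i=0}^kM_{(a_1..a_i)}\otimes M_{(a_{i+1}..a_k)}$, and fundamental basis $F_\mathsf{S}=\sum_{\mathsf{T}\supseteq\mathsf{S}}M_\mathsf{T}$. Monomial bases $M_\sigma=\sum_{\tau\geq\sigma}\mu(\sigma,\tau)F_\tau$, $M_t=\sum_{s\ge t}\mu(t,s)F_s$ (Möbius functions of weak and Tamari orders). The surjective Hopf morphisms are $\Lambda\colon F_\sigma\mapsto F_{\lambda(\sigma)}$, $\mathcal{L}\colon F_t\mapsto F_{L(t)}$, $\mathcal{D}\colon F_\sigma\mapsto F_{\mathrm{Des}(\sigma)}$. -}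

module Defs where

open import Data.Bool using (Bool; true; false; _∧_; _∨_; not; if_then_else_; T)
open import Data.Nat using (ℕ; zero; suc; _+_; _*_; _∸_; _≡ᵇ_; _<ᵇ_; _≤ᵇ_)
open import Data.List using (List; []; _∷_; _++_; map; foldr; concatMap; length; take; drop; upTo; null; zip)
open import Data.Bool.ListAction using (all; any)
open import Data.List.Relation.Unary.All using (All)
open import Data.Product using (_×_; _,_; proj₁; proj₂)
open import Data.Unit using (⊤)
open import Data.Rational using (ℚ; 0ℚ; 1ℚ) renaming (_+_ to _+ℚ_; _*_ to _*ℚ_; -_ to -ℚ_)
open import Relation.Binary.PropositionalEquality using (_≡_)

filterB : {A : Set} → (A → Bool) → List A → List A
filterB p []       = []
filterB p (x ∷ xs) = if p x then x ∷ filterB p xs else filterB p xs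

sumQ : List ℚ → ℚ
sumQ = foldr _+ℚ_ 0ℚ

countB : {A : Set} → (A → Bool) → List A → ℕ
countB p xs = length (filterB p xs)

eqList : List ℕ → List ℕ → Bool
eqList []       []       = true
eqList (x ∷ xs) (y ∷ ys) = (x ≡ᵇ y) ∧ eqList xs ys
eqList _        _        = false

memB : ℕ → List ℕ → Bool
memB x = any (λ y → x ≡ᵇ y)

oneTo : ℕ → List ℕ
oneTo n = map suc (upTo n)

-- Formal linear combinations over ℚ of basis elements of type B.
-- A vector is a finite formal sum  Σ c_i · b_i ; two vectors are equal
-- when all their coefficients agree.

Lc : Set → Set
Lc B = List (ℚ × B)

coeff : {B : Set} → (B → B → Bool) → B → Lc B → ℚ
coeff eq b v = sumQ (map proj₁ (filterB (λ x → eq (proj₂ x) b) v))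

EqV : {B : Set} → (B → B → Bool) → Lc B → Lc B → Set
EqV eq v w = ∀ b → coeff eq b v ≡ coeff eq b w

scale : {B : Set} → ℚ → Lc B → Lc B
scale c = map (λ x → (c *ℚ proj₁ x , proj₂ x))

bv : {B : Set} → B → Lc B
bv b = (1ℚ , b) ∷ []

lin : {A B : Set} → (A → Lc B) → Lc A → Lc B
lin g = concatMap (λ x → scale (proj₁ x) (g (proj₂ x)))

tens : {A B : Set} → Lc A → Lc B → Lc (A × B)
tens v w = concatMap (λ x → map (λ y → (proj₁ x *ℚ proj₁ y , (proj₂ x , proj₂ y))) w) v

tmap : {A B : Set} → (Lc A → Lc B) → (Lc A → Lc B) → Lc (A × A) → Lc (B × B)
tmap f g = lin (λ p → tens (f (bv (proj₁ p))) (g (bv (proj₂ p))))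

eqPair : {B : Set} → (B → B → Bool) → (B × B) → (B × B) → Bool
eqPair eq x y = eq (proj₁ x) (proj₁ y) ∧ eq (proj₂ x) (proj₂ y)

ValidVec : {B : Set} → (B → Bool) → Lc B → Set
ValidVec p v = All (λ x → T (p (proj₂ x))) v

record IsLinear {A B : Set} (eqA : A → A → Bool) (eqB : B → B → Bool)
                (f : Lc A → Lc B) : Set where
  field
    respects : ∀ v w → EqV eqA v w → EqV eqB (f v) (f w)
    additive : ∀ v w → EqV eqB (f (v ++ w)) (f v ++ f w)
    homogeneous : ∀ c v → EqV eqB (f (scale c v)) (scale c (f v))

-- Möbius function of a finite poset given by an element list and a
-- boolean order relation, computed by the recursion
--   μ(x,x) = 1,  μ(x,y) = - Σ_{x ≤ z < y} μ(x,z)  (x < y),  μ(x,y) = 0 otherwise.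
-- The fuel argument bounds the length of chains; it is chosen large enough.

muF : {A : Set} → (A → A → Bool) → (A → A → Bool) → List A → ℕ → A → A → ℚ
muF eq leq elems fuel x y with eq x y | leq x y
... | true  | _     = 1ℚ
... | false | false = 0ℚ
... | false | true  with fuel
...   | zero  = 0ℚ
...   | suc k = -ℚ sumQ (map (muF eq leq elems k x)
                    (filterB (λ z → leq x z ∧ leq z y ∧ not (eq z y)) elems))

-- Permutations (one-line notation, as lists of ℕ)

Perm : Set
Perm = List ℕ

isPerm : List ℕ → Bool
isPerm w = all (λ i → countB (λ x → x ≡ᵇ i) w ≡ᵇ 1) (oneTo (length w))

insertions : ℕ → List ℕ → List (List ℕ)
insertions x []       = (x ∷ []) ∷ []
insertions x (y ∷ ys) = (x ∷ y ∷ ys) ∷ map (y ∷_) (insertions x ys)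

perms : ℕ → List Perm
perms zero    = [] ∷ []
perms (suc n) = concatMap (insertions (suc n)) (perms n)

-- standardization of a word with distinct letters
st : List ℕ → List ℕ
st w = map (λ x → countB (λ y → y ≤ᵇ x) w) w

idP : ℕ → Perm
idP n = oneTo n

_∨P_ : Perm → Perm → Perm
σ ∨P τ = map (_+ length τ) σ ++ (length σ + length τ + 1) ∷ τ

_∖P_ : Perm → Perm → Perm
σ ∖P τ = map (_+ length τ) σ ++ τ

indexed : List ℕ → List (ℕ × ℕ)
indexed w = zip (oneTo (length w)) w

inversions : Perm → List (ℕ × ℕ)
inversions w = concatMap (λ a → map (λ b → (proj₁ a , proj₁ b))
                   (filterB (λ b → (proj₁ a <ᵇ proj₁ b) ∧ (proj₂ b <ᵇ proj₂ a)) (indexed w)))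
               (indexed w)

memPair : ℕ × ℕ → List (ℕ × ℕ) → Bool
memPair p = any (λ q → (proj₁ p ≡ᵇ proj₁ q) ∧ (proj₂ p ≡ᵇ proj₂ q))

leqW : Perm → Perm → Bool
leqW σ τ = (length σ ≡ᵇ length τ) ∧ all (λ p → memPair p (inversions τ)) (inversions σ)

muW : Perm → Perm → ℚ
muW σ τ = muF eqList leqW (perms (length σ)) (length σ * length σ) σ τ

Des : Perm → List ℕ
Des w = map proj₁ (filterB (λ a → any (λ b → (suc (proj₁ a) ≡ᵇ proj₁ b) ∧ (proj₂ b <ᵇ proj₂ a)) (indexed w)) (indexed w))

data Tree : Set where
  leaf : Tree
  _∨T_ : Tree → Tree → Tree

eqT : Tree → Tree → Bool
eqT leaf       leaf       = true
eqT (a ∨T b)   (c ∨T d)   = eqT a c ∧ eqT b d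
eqT _          _          = false

size : Tree → ℕ
size leaf     = 0
size (l ∨T r) = suc (size l + size r)

treesDepth : ℕ → List Tree
treesDepth zero    = leaf ∷ []
treesDepth (suc j) = leaf ∷ concatMap (λ l → map (l ∨T_) (treesDepth j)) (treesDepth j)

-- 𝒴_n (a tree with n internal nodes has depth ≤ n)
trees : ℕ → List Tree
trees n = filterB (λ t → size t ≡ᵇ n) (treesDepth n)

rootRot : Tree → Tree → List Tree
rootRot leaf     c = []
rootRot (a ∨T b) c = (a ∨T (b ∨T c)) ∷ []

rots : Tree → List Tree
rots leaf     = []
rots (l ∨T r) = rootRot l r ++ map (_∨T r) (rots l) ++ map (l ∨T_) (rots r)

reachB : ℕ → Tree → Tree → Bool
reachB zero    t s = eqT t s
reachB (suc k) t s = eqT t s ∨ any (λ u → reachB k u s) (rots t)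

-- Tamari order (chains have length ≤ n(n-1)/2 ≤ n*n)
leqT : Tree → Tree → Bool
leqT t s = reachB (size t * size t) t s

muT : Tree → Tree → ℚ
muT t s = muF eqT leqT (trees (size t)) (size t * size t) t s

oneT : ℕ → Tree
oneT zero    = leaf
oneT (suc n) = oneT n ∨T leaf

_∖T_ : Tree → Tree → Tree
leaf     ∖T t = t
(l ∨T r) ∖T t = l ∨T (r ∖T t)

γ : Tree → Perm
γ leaf     = []
γ (l ∨T r) = γ l ∨P γ r

splitAt : ℕ → List ℕ → List ℕ × List ℕ
splitAt m []       = ([] , [])
splitAt m (x ∷ xs) = if x ≡ᵇ m then ([] , xs)
                     else (x ∷ proj₁ (splitAt m xs) , proj₂ (splitAt m xs))

lamF : ℕ → Perm → Tree
lamF zero    w = leaf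
lamF (suc k) [] = leaf
lamF (suc k) (x ∷ xs) =
  lamF k (st (proj₁ (splitAt (length (x ∷ xs)) (x ∷ xs))))
    ∨T lamF k (st (proj₂ (splitAt (length (x ∷ xs)) (x ∷ xs))))

λP : Perm → Tree
λP σ = lamF (length σ) σ

-- leaves numbered 0..n left to right; flag true iff the leaf is a left child
leafFlags : Tree → List Bool
leafFlags leaf     = false ∷ []
leafFlags (l ∨T r) = asChild l true ++ asChild r false
  where
  asChild : Tree → Bool → List Bool
  asChild leaf       b = b ∷ []
  asChild (a ∨T c)   b = leafFlags (a ∨T c)

Lset : Tree → List ℕ
Lset t = map proj₁ (filterB (λ p → (1 ≤ᵇ proj₁ p) ∧ (proj₁ p <ᵇ size t) ∧ proj₂ p)
                     (zip (upTo (suc (size t))) (leafFlags t)))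

-- Compositions (lists of positive parts); composition α of n ↔ subset
-- {a₁, a₁+a₂, …, a₁+…+a_{k-1}} of [n-1]

Comp : Set
Comp = List ℕ

isComp : List ℕ → Bool
isComp = all (λ a → 1 ≤ᵇ a)

compSize : Comp → ℕ
compSize = foldr _+_ 0

comps : ℕ → List Comp
comps zero          = [] ∷ []
comps (suc zero)    = (1 ∷ []) ∷ []
comps (suc (suc n)) = concatMap (λ c → (1 ∷ c) ∷ incHead c) (comps (suc n))
  where
  incHead : Comp → List Comp
  incHead []      = []
  incHead (a ∷ c) = (suc a ∷ c) ∷ []

setOf : Comp → List ℕ
setOf []            = []
setOf (a ∷ [])      = []
setOf (a ∷ b ∷ c)   = a ∷ map (a +_) (setOf (b ∷ c))

subsetB : List ℕ → List ℕ → Bool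
subsetB S T = all (λ x → memB x T) S

-- The three Hopf algebras, all written in the coordinates of a basis:
--   𝔖Sym and 𝒴Sym in the fundamental bases F_σ, F_t,
--   𝒬Sym in the monomial basis M_α.

-- monomial basis elements of 𝔖Sym and 𝒴Sym, written in the F-basis
MS : Perm → Lc Perm
MS σ = map (λ τ → (muW σ τ , τ)) (filterB (leqW σ) (perms (length σ)))

MY : Tree → Lc Tree
MY t = map (λ s → (muT t s , s)) (filterB (leqT t) (trees (size t)))

-- fundamental basis element F_S of 𝒬Sym_n (S ⊆ [n-1]), in the M-basis
FQ : ℕ → List ℕ → Lc Comp
FQ n S = map (λ β → (1ℚ , β)) (filterB (λ β → subsetB S (setOf β)) (comps n))

ΔS : Lc Perm → Lc (Perm × Perm)
ΔS = lin (λ σ → map (λ i → (1ℚ , (st (take i σ) , st (drop i σ)))) (upTo (suc (length σ))))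

ΔY : Lc Tree → Lc (Tree × Tree)
ΔY = lin (λ t → map (λ i → (1ℚ , (λP (st (take i (γ t))) , λP (st (drop i (γ t))))))
                    (upTo (suc (size t))))

ΔQ : Lc Comp → Lc (Comp × Comp)
ΔQ = lin (λ α → map (λ i → (1ℚ , (take i α , drop i α))) (upTo (suc (length α))))

εS : Lc Perm → ℚ
εS v = sumQ (map (λ x → if null (proj₂ x) then proj₁ x else 0ℚ) v)

εY : Lc Tree → ℚ
εY v = sumQ (map (λ x → if eqT (proj₂ x) leaf then proj₁ x else 0ℚ) v)

εQ : Lc Comp → ℚ
εQ v = sumQ (map (λ x → if null (proj₂ x) then proj₁ x else 0ℚ) v)

Λ : Lc Perm → Lc Tree
Λ = lin (λ σ → bv (λP σ))

𝓛 : Lc Tree → Lc Comp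
𝓛 = lin (λ t → FQ (size t) (Lset t))

𝓓 : Lc Perm → Lc Comp
𝓓 = lin (λ σ → FQ (length σ) (Des σ))

Cset : Comp → Tree
Cset = foldr (λ a t → oneT a ∖T t) leaf

Zset : Comp → Perm
Zset = foldr (λ a σ → idP a ∖P σ) []

𝒞 : Lc Comp → Lc Tree
𝒞 = lin (λ α → MY (Cset α))

𝒵 : Lc Comp → Lc Perm
𝒵 = lin (λ α → MS (Zset α))

ValidS : Lc Perm → Set
ValidS = ValidVec isPerm

ValidQ : Lc Comp → Set
ValidQ = ValidVec isComp

_≈S_ : Lc Perm → Lc Perm → Set
_≈S_ = EqV eqList
_≈Y_ : Lc Tree → Lc Tree → Set
_≈Y_ = EqV eqT
_≈Q_ : Lc Comp → Lc Comp → Set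
_≈Q_ = EqV eqList
_≈SS_ : Lc (Perm × Perm) → Lc (Perm × Perm) → Set
_≈SS_ = EqV (eqPair eqList)
_≈YY_ : Lc (Tree × Tree) → Lc (Tree × Tree) → Set
_≈YY_ = EqV (eqPair eqT)

infix 4 _≈S_ _≈Y_ _≈Q_ _≈SS_ _≈YY_

{-# OPTIONS --safe #-}
module Submission where

-- Everything is read off in monomial coordinates. The functional φ ρ : F_σ ↦ [σ ≤ ρ] satisfies
-- φ ρ (M_σ) = [σ = ρ], by the defining recursion of μ, and these functionals separate vectors, by
-- induction on the rank of ρ. So an identity between vectors may be checked by applying φ ρ, or
-- φ ρ ⊗ φ π, and on the fundamental basis this amounts to the following Galois-type equivalences:
--   σ ≤ ρ∖π      ⇔  st(σ(1..p)) ≤ ρ and st(σ(p+1..n)) ≤ π, with p = |ρ|, and likewise for trees;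
--   λ(σ) ≤ t     ⇔  σ ≤ γ(t);
--   L(t) ⊆ S     ⇔  t ≤ C(S), and Des(σ) ⊆ S ⇔ σ ≤ Z(S) = γ(C(S)).
-- Thus ΔM_σ = Σ_{σ=ρ∖π} M_ρ⊗M_π, and similarly for trees, and γ and C are compatible with ∖.
-- Both orders are handled through the recursive description of σ ≤ γ(t): σ = a m b with a ≤ γ(l),
-- b ≤ γ(r) and no letter of a exceeding m, where t = l ∨ r.

open import Defs
open import Data.Bool using (Bool; true; false; _∧_; _∨_; not; T)
open import Data.Bool.ListAction using (all; any)
open import Data.Bool.Properties using (T-≡; ∨-zeroʳ; ∧-identityʳ)
open import Data.Empty using (⊥; ⊥-elim)
open import Data.List using (List; []; _∷_; _++_; _∷ʳ_; map; concatMap; length; take; drop; upTo; applyUpTo; zip; initLast; _∷ʳ′_)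
open import Data.List.Properties using (map-++; map-∘; map-id; map-cong; map-cong-local; map-injective; map-applyUpTo; map-upTo; length-map; length-++; length-take; ++-assoc; ∷-injective; upTo-∷ʳ; take++drop≡id; concatMap-cong)
open import Data.List.Membership.Propositional using (_∈_; _∉_; find; lose)
open import Data.List.Membership.Propositional.Properties using (∈-∃++; ∈-++⁺ˡ; ∈-++⁺ʳ; ∈-++⁻; ∈-map⁺; ∈-map⁻; ∈-concatMap⁺; ∈-concatMap⁻)
open import Data.List.Relation.Binary.Permutation.Propositional using (_↭_; ↭-refl; ↭-sym; ↭-trans; ↭-reflexive; ↭-prep; ↭-swap; ↭⇒↭ₛ) renaming (refl to refl↭; prep to prep↭; swap to swap↭; trans to trans↭)
import Data.List.Relation.Binary.Permutation.Propositional.Properties as ↭ₚ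
import Data.List.Relation.Binary.Permutation.Setoid.Properties as SetoidPermutation
open import Data.List.Relation.Binary.Pointwise as Pw using (Pointwise; []; _∷_)
open import Data.List.Relation.Unary.All as All using (All; []; _∷_)
import Data.List.Relation.Unary.All.Properties as Allₚ
open import Data.List.Relation.Unary.AllPairs using (AllPairs; []; _∷_)
import Data.List.Relation.Unary.AllPairs.Properties as AllPairsₚ
open import Data.List.Relation.Unary.Any using (here; there)
open import Data.List.Relation.Unary.Unique.Propositional using (Unique)
open import Data.Nat using (ℕ; zero; suc; _≤_; _<_; z≤n; s≤s; _+_; _*_; _≡ᵇ_; _<ᵇ_; _≤ᵇ_)
open import Data.Nat.Induction using (<-wellFounded)
import Data.Nat.Properties as ℕₚ
open import Data.Nat.Tactic.RingSolver using (solve-∀)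
open import Data.Product using (∃; ∃₂; _×_; _,_; proj₁; proj₂)
open import Data.Rational using (ℚ; 0ℚ; 1ℚ) renaming (_+_ to _+ℚ_; _*_ to _*ℚ_; -_ to -ℚ_)
import Data.Rational.Properties as ℚₚ
open import Data.Rational.Solver using (module +-*-Solver)
open import Data.Sum using (_⊎_; inj₁; inj₂)
open import Data.Unit using (⊤; tt)
open import Function using (_∘_; id; Equivalence)
open import Induction.WellFounded using (Acc; acc)
open import Relation.Binary.Construct.Closure.ReflexiveTransitive using (Star; ε; _◅_; _◅◅_; gmap)
open import Relation.Binary.Definitions using (tri<; tri≈; tri>)
open import Relation.Binary.PropositionalEquality
open import Relation.Nullary using (¬_; yes; no; contradiction)
open +-*-Solver using (solve; _:+_; _:*_; :-_; _:=_; con)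

-- Vectors are lists of terms, and equality compares only total coefficients. As `Γ` is known only
-- up to `≈S`, the list `Γ v` may contain words that are not permutations, with cancelling
-- coefficients. Support conditions are therefore stated through functionals (`Conc`) rather than
-- entry by entry, and every functional must be shown to depend on coefficients alone. `Γ` is
-- prescribed on the `M_t`, while vectors are written in the `F_t`; its values are reached through
-- F_t = Σ_{s ≥ t} M_s. One argument (`Lifts`) serves both `Γ` and `𝒵`: the monomial coordinate at ρ
-- of such an image is 0 unless ρ = γ(λ(ρ)), and then it is the coordinate at λ(ρ) of a vector over
-- trees. Membership in the image of γ is multiplicative for `∖P`, so comultiplicativity descends to
-- a statement about trees: the duality for `ΔY` in the case of `Γ`, and deconcatenation under `𝒞`
-- in the case of `𝒵`. The three splittings hold because `𝓛`, `Λ` and `𝓓` read off monomial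
-- coordinates at C(S), γ(t) and Z(S), exactly where the sections place them.

private variable
  A B : Set

⟦_⟧ : Bool → ℚ
⟦ true ⟧  = 1ℚ
⟦ false ⟧ = 0ℚ

⟦∧⟧ : ∀ a b → ⟦ a ∧ b ⟧ ≡ ⟦ a ⟧ *ℚ ⟦ b ⟧
⟦∧⟧ true  b = sym (ℚₚ.*-identityˡ ⟦ b ⟧)
⟦∧⟧ false b = sym (ℚₚ.*-zeroˡ ⟦ b ⟧)

⇔⇒≡ : ∀ {a b} → (a ≡ true → b ≡ true) → (b ≡ true → a ≡ true) → a ≡ b
⇔⇒≡ {true}  {true}  _ _ = refl
⇔⇒≡ {true}  {false} f _ = sym (f refl)
⇔⇒≡ {false} {true}  _ g = g refl
⇔⇒≡ {false} {false} _ _ = refl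

≢true⇒false : ∀ {a} → (a ≢ true) → a ≡ false
≢true⇒false {true}  h = contradiction refl h
≢true⇒false {false} h = refl

bool? : ∀ b → b ≡ true ⊎ b ≡ false
bool? true  = inj₁ refl
bool? false = inj₂ refl

∧-true : ∀ {a b} → a ∧ b ≡ true → a ≡ true × b ≡ true
∧-true {true} {true} _ = refl , refl

not-true : ∀ {a} → not a ≡ true → a ≡ false
not-true {false} _ = refl

-- Finite sums and linear functionals

∑ : List A → (A → ℚ) → ℚ
∑ xs f = sumQ (map f xs)

∑-cong-All : ∀ {P : A → Set} {xs} {f g : A → ℚ} →
             All P xs → (∀ x → P x → f x ≡ g x) → ∑ xs f ≡ ∑ xs g
∑-cong-All []       h = refl
∑-cong-All (p ∷ ps) h = cong₂ _+ℚ_ (h _ p) (∑-cong-All ps h)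

∑-cong : ∀ (xs : List A) {f g : A → ℚ} → (∀ x → f x ≡ g x) → ∑ xs f ≡ ∑ xs g
∑-cong []       h = refl
∑-cong (x ∷ xs) h = cong₂ _+ℚ_ (h x) (∑-cong xs h)

∑-zero : ∀ (xs : List A) {f : A → ℚ} → (∀ x → f x ≡ 0ℚ) → ∑ xs f ≡ 0ℚ
∑-zero []       h = refl
∑-zero (x ∷ xs) h = trans (cong₂ _+ℚ_ (h x) (∑-zero xs h)) (ℚₚ.+-identityˡ 0ℚ)

∑-+ : ∀ (xs : List A) {f g : A → ℚ} → ∑ xs (λ x → f x +ℚ g x) ≡ ∑ xs f +ℚ ∑ xs g
∑-+ []       = sym (ℚₚ.+-identityˡ 0ℚ)
∑-+ (x ∷ xs) {f} {g} = trans (cong (f x +ℚ g x +ℚ_) (∑-+ xs))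
  (solve 4 (λ a b c d → (a :+ b) :+ (c :+ d) := (a :+ c) :+ (b :+ d)) refl (f x) (g x) (∑ xs f) (∑ xs g))

∑-*ˡ : ∀ (xs : List A) (c : ℚ) {f : A → ℚ} → ∑ xs (λ x → c *ℚ f x) ≡ c *ℚ ∑ xs f
∑-*ˡ []       c = sym (ℚₚ.*-zeroʳ c)
∑-*ˡ (x ∷ xs) c {f} = trans (cong (c *ℚ f x +ℚ_) (∑-*ˡ xs c)) (sym (ℚₚ.*-distribˡ-+ c (f x) (∑ xs f)))

∑-++ : ∀ (xs ys : List A) {f : A → ℚ} → ∑ (xs ++ ys) f ≡ ∑ xs f +ℚ ∑ ys f
∑-++ []       ys {f} = sym (ℚₚ.+-identityˡ (∑ ys f))
∑-++ (x ∷ xs) ys {f} = trans (cong (f x +ℚ_) (∑-++ xs ys)) (sym (ℚₚ.+-assoc (f x) (∑ xs f) (∑ ys f)))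

∑-map : ∀ (h : A → B) (xs : List A) {f : B → ℚ} → ∑ (map h xs) f ≡ ∑ xs (f ∘ h)
∑-map h xs = cong sumQ (sym (map-∘ xs))

∑-concatMap : ∀ (h : A → List B) (xs : List A) {f : B → ℚ} →
              ∑ (concatMap h xs) f ≡ ∑ xs (λ x → ∑ (h x) f)
∑-concatMap h []       = refl
∑-concatMap h (x ∷ xs) {f} = trans (∑-++ (h x) (concatMap h xs)) (cong (∑ (h x) f +ℚ_) (∑-concatMap h xs))

∑-filter : ∀ (p : A → Bool) (xs : List A) {f : A → ℚ} →
           ∑ (filterB p xs) f ≡ ∑ xs (λ x → ⟦ p x ⟧ *ℚ f x)
∑-filter p []       = refl
∑-filter p (x ∷ xs) {f} with p x
... | true  = cong₂ _+ℚ_ (sym (ℚₚ.*-identityˡ (f x))) (∑-filter p xs)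
... | false = trans (∑-filter p xs) (sym (trans (cong (_+ℚ _) (ℚₚ.*-zeroˡ (f x))) (ℚₚ.+-identityˡ _)))

ev : (B → ℚ) → Lc B → ℚ
ev f v = ∑ v (λ x → proj₁ x *ℚ f (proj₂ x))

ev-cong : ∀ (v : Lc B) {f g : B → ℚ} → (∀ b → f b ≡ g b) → ev f v ≡ ev g v
ev-cong v h = ∑-cong v (λ x → cong (proj₁ x *ℚ_) (h (proj₂ x)))

ev-zero : ∀ (v : Lc B) → ev (λ _ → 0ℚ) v ≡ 0ℚ
ev-zero v = ∑-zero v (λ x → ℚₚ.*-zeroʳ (proj₁ x))

ev-++ : ∀ (v w : Lc B) {f : B → ℚ} → ev f (v ++ w) ≡ ev f v +ℚ ev f w
ev-++ v w = ∑-++ v w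

ev-+ : ∀ (v : Lc B) {f g : B → ℚ} → ev (λ b → f b +ℚ g b) v ≡ ev f v +ℚ ev g v
ev-+ v {f} {g} = trans (∑-cong v (λ x → ℚₚ.*-distribˡ-+ (proj₁ x) (f (proj₂ x)) (g (proj₂ x)))) (∑-+ v)

ev-*ˡ : ∀ (v : Lc B) c {f : B → ℚ} → ev (λ b → c *ℚ f b) v ≡ c *ℚ ev f v
ev-*ˡ v c {f} = trans (∑-cong v (λ x → solve 3 (λ a b d → a :* (b :* d) := b :* (a :* d)) refl (proj₁ x) c (f (proj₂ x)))) (∑-*ˡ v c)

ev-*ʳ : ∀ (v : Lc B) c {f : B → ℚ} → ev (λ b → f b *ℚ c) v ≡ ev f v *ℚ c
ev-*ʳ v c {f} = trans (ev-cong v (λ b → ℚₚ.*-comm (f b) c)) (trans (ev-*ˡ v c) (ℚₚ.*-comm c (ev f v)))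

ev-scale : ∀ c (v : Lc B) {f : B → ℚ} → ev f (scale c v) ≡ c *ℚ ev f v
ev-scale c v {f} = trans (∑-map _ v)
  (trans (∑-cong v (λ x → ℚₚ.*-assoc c (proj₁ x) (f (proj₂ x)))) (∑-*ˡ v c))

ev-bv : ∀ (f : B → ℚ) (b : B) → ev f (bv b) ≡ f b
ev-bv f b = trans (ℚₚ.+-identityʳ _) (ℚₚ.*-identityˡ (f b))

ev-lin : ∀ (g : A → Lc B) (v : Lc A) {f : B → ℚ} → ev f (lin g v) ≡ ev (λ a → ev f (g a)) v
ev-lin g v = trans (∑-concatMap _ v) (∑-cong v (λ x → ev-scale (proj₁ x) (g (proj₂ x))))

ev-units : ∀ (h : A → B) (xs : List A) {f : B → ℚ} → ev f (map (λ x → (1ℚ , h x)) xs) ≡ ∑ xs (f ∘ h)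
ev-units h xs {f} = trans (∑-map _ xs) (∑-cong xs (λ x → ℚₚ.*-identityˡ (f (h x))))

ev-tens : ∀ (v : Lc A) (w : Lc B) {f : A × B → ℚ} →
          ev f (tens v w) ≡ ev (λ a → ev (λ b → f (a , b)) w) v
ev-tens v w {f} = trans (∑-concatMap _ v) (∑-cong v (λ (c , a) → trans (∑-map _ w)
  (trans (∑-cong w (λ y → ℚₚ.*-assoc c (proj₁ y) (f (a , proj₂ y)))) (∑-*ˡ w c))))

ev-tens-product : ∀ (v : Lc A) (w : Lc B) {f : A → ℚ} {g : B → ℚ} →
                  ev (λ p → f (proj₁ p) *ℚ g (proj₂ p)) (tens v w) ≡ ev f v *ℚ ev g w
ev-tens-product v w {f} {g} = trans (ev-tens v w) (trans (ev-cong v (λ a → ev-*ˡ w (f a))) (ev-*ʳ v (ev g w)))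

ev-tmap : ∀ (F : Lc A → Lc B) (u : Lc (A × A)) {f g : B → ℚ} →
          ev (λ p → f (proj₁ p) *ℚ g (proj₂ p)) (tmap F F u)
            ≡ ev (λ p → ev f (F (bv (proj₁ p))) *ℚ ev g (F (bv (proj₂ p)))) u
ev-tmap F u = trans (ev-lin _ u) (ev-cong u (λ p → ev-tens-product (F (bv (proj₁ p))) (F (bv (proj₂ p)))))

coeff≡ev : ∀ (eq : B → B → Bool) b (v : Lc B) → coeff eq b v ≡ ev (λ x → ⟦ eq x b ⟧) v
coeff≡ev eq b v = trans (∑-filter (λ x → eq (proj₂ x) b) v)
  (∑-cong v (λ x → ℚₚ.*-comm ⟦ eq (proj₂ x) b ⟧ (proj₁ x)))

∑-upTo-suc : ∀ n (f : ℕ → ℚ) → ∑ (upTo (suc n)) f ≡ f 0 +ℚ ∑ (upTo n) (f ∘ suc)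
∑-upTo-suc n f = cong (λ l → f 0 +ℚ sumQ l) (trans (map-applyUpTo suc f n) (sym (map-applyUpTo id (f ∘ suc) n)))

∑-upTo-zero : ∀ n {g : ℕ → ℚ} → (∀ i → i < n → g i ≡ 0ℚ) → ∑ (upTo n) g ≡ 0ℚ
∑-upTo-zero n h = trans (∑-cong-All (Allₚ.applyUpTo⁺₁ id n id) h) (∑-zero (upTo n) (λ _ → refl))

∑-upTo-single : ∀ n k {g : ℕ → ℚ} → k < n → (∀ i → i < n → i ≢ k → g i ≡ 0ℚ) → ∑ (upTo n) g ≡ g k
∑-upTo-single (suc n) zero    {g} _ h = trans (∑-upTo-suc n g) (trans
  (cong (g 0 +ℚ_) (∑-upTo-zero n (λ i i<n → h (suc i) (s≤s i<n) (λ ())))) (ℚₚ.+-identityʳ (g 0)))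
∑-upTo-single (suc n) (suc k) {g} (s≤s k<n) h = trans (∑-upTo-suc n g) (trans
  (cong₂ _+ℚ_ (h 0 (s≤s z≤n) (λ ())) (∑-upTo-single n k k<n (λ i i<n i≢k → h (suc i) (s≤s i<n) (i≢k ∘ ℕₚ.suc-injective))))
  (ℚₚ.+-identityˡ (g (suc k))))

-- The common shape of the coproduct computations: `p i` and `q i` say that the two pieces of the
-- cut at `i` lie below given elements, and the length of the first piece forces `i ≡ k`. Since `k`
-- may exceed `n`, the condition `b` must also guarantee that this cut exists.
∑-upTo-cut : ∀ n k b (p q : ℕ → Bool) →
  (∀ i → i ≤ n → p i ≡ true → i ≡ k) →
  (b ≡ true → k ≤ n × p k ≡ true × q k ≡ true) →
  (k ≤ n → p k ≡ true → q k ≡ true → b ≡ true) →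
  ∑ (upTo (suc n)) (λ i → ⟦ p i ⟧ *ℚ ⟦ q i ⟧) ≡ ⟦ b ⟧
∑-upTo-cut n k b p q only fwd bwd with k ℕₚ.≤? n
... | yes k≤n = trans (∑-upTo-single (suc n) k (s≤s k≤n) (λ { i (s≤s i≤n) i≢k → vanish i (i≢k ∘ only i i≤n) }))
    (trans (sym (⟦∧⟧ (p k) (q k))) (cong ⟦_⟧ (⇔⇒≡ (λ e → bwd k≤n (proj₁ (∧-true {p k} e)) (proj₂ (∧-true {p k} e)))
                                                       (λ e → cong₂ _∧_ (proj₁ (proj₂ (fwd e))) (proj₂ (proj₂ (fwd e)))))))
  where
  vanish : ∀ i → p i ≢ true → ⟦ p i ⟧ *ℚ ⟦ q i ⟧ ≡ 0ℚ
  vanish i ne = trans (cong (λ c → ⟦ c ⟧ *ℚ ⟦ q i ⟧) (≢true⇒false ne)) (ℚₚ.*-zeroˡ ⟦ q i ⟧)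
... | no k≰n = trans (∑-upTo-zero (suc n) (λ { i (s≤s i≤n) → trans
      (cong (λ c → ⟦ c ⟧ *ℚ ⟦ q i ⟧) (≢true⇒false (λ e → k≰n (subst (_≤ n) (only i i≤n e) i≤n)))) (ℚₚ.*-zeroˡ ⟦ q i ⟧) }))
    (sym (cong ⟦_⟧ (≢true⇒false (k≰n ∘ proj₁ ∘ fwd))))

-- Equality of vectors, and supports up to cancellation

record IsEq (eq : B → B → Bool) : Set where
  field
    sound : ∀ {x y} → eq x y ≡ true → x ≡ y
    reflexive : ∀ x → eq x x ≡ true

  eq-sym : ∀ x y → eq x y ≡ eq y x
  eq-sym x y = ⇔⇒≡ (λ e → subst (λ z → eq z x ≡ true) (sound e) (reflexive x))
                         (λ e → subst (λ z → eq z y ≡ true) (sound e) (reflexive y))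

  ≢⇒false : ∀ {x y} → x ≢ y → eq x y ≡ false
  ≢⇒false h = ≢true⇒false (h ∘ sound)

  false⇒≢ : ∀ {x y} → eq x y ≡ false → x ≢ y
  false⇒≢ {x} e refl with () ← trans (sym e) (reflexive x)

open IsEq

eqPair-isEq : ∀ {eq : B → B → Bool} → IsEq eq → IsEq (eqPair eq)
eqPair-isEq {eq = eq} E = record { sound = λ {x} {y} → snd {x} {y} ; reflexive = λ x → cong₂ _∧_ (reflexive E _) (reflexive E _) }
  where
  snd : ∀ {x y} → eqPair eq x y ≡ true → x ≡ y
  snd {a , b} {c , d} e with eq a c in e₁ | eq b d in e₂
  snd {a , b} {c , d} e | true | true = cong₂ _,_ (sound E e₁) (sound E e₂)

module _ {eq : B → B → Bool} (E : IsEq eq) where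

  private
    isolate : ∀ (f : B → ℚ) x b → f x ≡ ⟦ eq x b ⟧ *ℚ f b +ℚ ⟦ not (eq x b) ⟧ *ℚ f x
    isolate f x b with eq x b in e
    ... | true rewrite sound E e = solve 1 (λ a → a := con 1ℚ :* a :+ con 0ℚ :* a) refl (f b)
    ... | false = solve 2 (λ a c → a := con 0ℚ :* c :+ con 1ℚ :* a) refl (f x) (f b)

    drop-b : B → Lc B → Lc B
    drop-b b = filterB (λ x → not (eq (proj₂ x) b))

    ev-drop : ∀ b (u : Lc B) {f : B → ℚ} → ev f (drop-b b u) ≡ ev (λ x → ⟦ not (eq x b) ⟧ *ℚ f x) u
    ev-drop b u {f} = trans (∑-filter _ u)
      (∑-cong u (λ x → solve 3 (λ a c d → a :* (c :* d) := c :* (a :* d)) refl ⟦ not (eq (proj₂ x) b) ⟧ (proj₁ x) (f (proj₂ x))))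

    length-drop : ∀ b (u : Lc B) → length (drop-b b u) ≤ length u
    length-drop b [] = z≤n
    length-drop b (x ∷ u) with eq (proj₂ x) b
    ... | true  = ℕₚ.m≤n⇒m≤1+n (length-drop b u)
    ... | false = s≤s (length-drop b u)

    ev-split : ∀ b (u : Lc B) (f : B → ℚ) → ev f u ≡ ev (λ x → ⟦ eq x b ⟧) u *ℚ f b +ℚ ev f (drop-b b u)
    ev-split b u f = trans (ev-cong u (λ x → isolate f x b)) (trans (ev-+ u)
      (cong₂ _+ℚ_ (ev-*ʳ u (f b)) (sym (ev-drop b u))))

    -- All terms at the first basis element `b` are removed together, because only their total
    -- coefficient is known to vanish. The remaining vector still has zero coefficients: trivially
    -- at `b`, and by `ev-split` elsewhere. Filtering is not a structural descent, hence the length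
    -- bound `n`.
    null-ev : ∀ n (u : Lc B) → length u ≤ n → (∀ b → ev (λ x → ⟦ eq x b ⟧) u ≡ 0ℚ) → ∀ f → ev f u ≡ 0ℚ
    null-ev n       []            _       h f = refl
    null-ev (suc n) u@((c , b) ∷ u′) (s≤s le) h f = trans (ev-split b u f) (trans
      (cong₂ (λ p q → p *ℚ f b +ℚ q) (h b)
        (null-ev n (drop-b b u) (ℕₚ.≤-trans shorter le) h′ f))
      (solve 1 (λ a → con 0ℚ :* a :+ con 0ℚ := con 0ℚ) refl (f b)))
      where
      shorter : length (drop-b b u) ≤ length u′
      shorter rewrite reflexive E b = length-drop b u′
      h′ : ∀ y → ev (λ x → ⟦ eq x y ⟧) (drop-b b u) ≡ 0ℚ
      h′ y with eq b y in e
      ... | true = subst (λ z → ev (λ x → ⟦ eq x y ⟧) (drop-b z u) ≡ 0ℚ) (sym (sound E e))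
            (trans (ev-drop y u) (trans (ev-cong u (λ x → lem (eq x y))) (ev-zero u)))
        where
        lem : ∀ a → ⟦ not a ⟧ *ℚ ⟦ a ⟧ ≡ 0ℚ
        lem true  = ℚₚ.*-zeroˡ 1ℚ
        lem false = ℚₚ.*-zeroʳ 1ℚ
      ... | false = begin
        ev δ (drop-b b u)                     ≡⟨ solve 2 (λ a c → a := c :* con 0ℚ :+ a) refl (ev δ (drop-b b u)) k ⟩
        k *ℚ 0ℚ +ℚ ev δ (drop-b b u)          ≡⟨ cong (λ z → k *ℚ z +ℚ ev δ (drop-b b u)) (sym (cong ⟦_⟧ e)) ⟩
        k *ℚ ⟦ eq b y ⟧ +ℚ ev δ (drop-b b u)  ≡⟨ sym (ev-split b u δ) ⟩
        ev δ u                                ≡⟨ h y ⟩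
        0ℚ                                    ∎
        where
        open ≡-Reasoning
        δ = λ x → ⟦ eq x y ⟧
        k = ev (λ x → ⟦ eq x b ⟧) u

  -- The formal difference of `v` and `w` has only zero coefficients, so `null-ev` annihilates it
  -- under every functional.
  ev-resp : ∀ (v w : Lc B) → EqV eq v w → ∀ f → ev f v ≡ ev f w
  ev-resp v w v≈w f = begin
    ev f v                                ≡⟨ solve 2 (λ a b → a := (a :+ (:- con 1ℚ) :* b) :+ b) refl (ev f v) (ev f w) ⟩
    (ev f v +ℚ (-ℚ 1ℚ) *ℚ ev f w) +ℚ ev f w ≡⟨ cong (_+ℚ ev f w) (sym (ev-diff f)) ⟩
    ev f u +ℚ ev f w                      ≡⟨ cong (_+ℚ ev f w) (null-ev (length u) u ℕₚ.≤-refl null f) ⟩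
    0ℚ +ℚ ev f w                          ≡⟨ ℚₚ.+-identityˡ (ev f w) ⟩
    ev f w                                ∎
    where
    open ≡-Reasoning
    u : Lc B
    u = v ++ scale (-ℚ 1ℚ) w
    ev-diff : ∀ f → ev f u ≡ ev f v +ℚ (-ℚ 1ℚ) *ℚ ev f w
    ev-diff f = trans (ev-++ v _) (cong (ev f v +ℚ_) (ev-scale (-ℚ 1ℚ) w))
    null : ∀ b → ev (λ x → ⟦ eq x b ⟧) u ≡ 0ℚ
    null b = trans (ev-diff δ) (trans
      (cong (λ z → z +ℚ (-ℚ 1ℚ) *ℚ ev δ w) (trans (sym (coeff≡ev eq b v)) (trans (v≈w b) (coeff≡ev eq b w))))
      (solve 1 (λ a → a :+ (:- con 1ℚ) :* a := con 0ℚ) refl (ev δ w)))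
      where δ = λ x → ⟦ eq x b ⟧

  EqV-intro : ∀ (v w : Lc B) → (∀ b → ev (λ x → ⟦ eq x b ⟧) v ≡ ev (λ x → ⟦ eq x b ⟧) w) → EqV eq v w
  EqV-intro v w h b = trans (coeff≡ev eq b v) (trans (h b) (sym (coeff≡ev eq b w)))

-- v is supported, up to cancellation, on basis elements satisfying V.
Conc : (B → Set) → Lc B → Set
Conc V v = ∀ f g → (∀ x → V x → f x ≡ g x) → ev f v ≡ ev g v

Conc-⊤ : ∀ (v : Lc B) → Conc (λ _ → ⊤) v
Conc-⊤ v f g h = ev-cong v (λ x → h x tt)

Conc-tens : ∀ {V : A → Set} {W : B → Set} {v w} → Conc V v → Conc W w →
            Conc (λ p → V (proj₁ p) × W (proj₂ p)) (tens v w)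
Conc-tens {v = v} {w} cv cw f g h = trans (ev-tens v w) (trans
  (cv _ _ (λ a Va → cw _ _ (λ b Wb → h (a , b) (Va , Wb)))) (sym (ev-tens v w)))

All⇒Conc : ∀ {V : B → Set} {v} → All (V ∘ proj₂) v → Conc V v
All⇒Conc a f g h = ∑-cong-All a (λ x p → cong (proj₁ x *ℚ_) (h (proj₂ x) p))

Conc-lin : ∀ {V : A → Set} {W : B → Set} {F : A → Lc B} {v} →
           Conc V v → (∀ a → V a → Conc W (F a)) → Conc W (lin F v)
Conc-lin {F = F} {v} cv cF f g h =
  trans (ev-lin F v) (trans (cv _ _ (λ a Va → cF a Va f g h)) (sym (ev-lin F v)))

All-filterB : ∀ {P : A → Set} {p : A → Bool} {xs} → All P xs → All (λ x → P x × p x ≡ true) (filterB p xs)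
All-filterB [] = []
All-filterB {p = p} {x ∷ xs} (px ∷ pxs) with p x in e
... | true  = (px , e) ∷ All-filterB pxs
... | false = All-filterB pxs

-- Möbius inversion in finite posets

-- `V` singles out the genuine elements, since the carrier of the weak order consists of all words.
-- `pick` says that a valid `x` is listed exactly once in `elems (sz x)`, in the form in which sums
-- use it. `rk` is strictly increasing, so it bounds chains, and `rk-bound` matches the fuel
-- `sz x * sz x` given to the Möbius function.
record FinPoset (B : Set) : Set₁ where
  field
    eq leq    : B → B → Bool
    elems     : ℕ → List B
    sz rk     : B → ℕ
    V         : B → Set
    isEq      : IsEq eq
    leq-refl  : ∀ x → leq x x ≡ true
    leq-trans : ∀ {x y z} → leq x y ≡ true → leq y z ≡ true → leq x z ≡ true
    leq-sz    : ∀ {x y} → leq x y ≡ true → sz x ≡ sz y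
    leq-rk    : ∀ {x y} → V x → V y → leq x y ≡ true → x ≢ y → rk x < rk y
    rk-bound  : ∀ x → rk x ≤ sz x * sz x
    elems-V   : ∀ n → All V (elems n)
    pick      : ∀ {x} → V x → ∀ (f : B → ℚ) → ∑ (elems (sz x)) (λ z → ⟦ eq z x ⟧ *ℚ f z) ≡ f x

  M : B → Lc B
  M x = map (λ y → (muF eq leq (elems (sz x)) (sz x * sz x) x y , y)) (filterB (leq x) (elems (sz x)))

  φ : B → B → ℚ
  φ y x = ⟦ leq x y ⟧

  δ : B → B → ℚ
  δ y x = ⟦ eq x y ⟧

  leq-antisym : ∀ {x y} → V x → V y → leq x y ≡ true → leq y x ≡ true → x ≡ y
  leq-antisym {x} {y} Vx Vy x≤y y≤x with bool? (eq x y)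
  ... | inj₁ e = sound isEq e
  ... | inj₂ e = contradiction (ℕₚ.<-trans (leq-rk Vx Vy x≤y (false⇒≢ isEq e)) (leq-rk Vy Vx y≤x (false⇒≢ isEq e ∘ sym)))
                               (ℕₚ.<-irrefl refl)

  private
    below : B → B → B → Bool
    below x y z = leq x z ∧ leq z y ∧ not (eq z y)

    below-rk : ∀ {x y z} → V z → V y → below x y z ≡ true → rk z < rk y
    below-rk {x} {y} {z} Vz Vy h with ∧-true {leq x z} h
    ... | _ , h′ with ∧-true {leq z y} h′
    ... | z≤y , h″ = leq-rk Vz Vy z≤y (false⇒≢ isEq (not-true h″))

    μ : ℕ → ℕ → B → B → ℚ
    μ n = muF eq leq (elems n)

    μ-diag : ∀ n k x y → eq x y ≡ true → μ n k x y ≡ 1ℚ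
    μ-diag n k x y e rewrite e = refl

    μ-none : ∀ n k x y → eq x y ≡ false → leq x y ≡ false → μ n k x y ≡ 0ℚ
    μ-none n k x y e l rewrite e | l = refl

    μ-step : ∀ n k x y → eq x y ≡ false → leq x y ≡ true →
             μ n (suc k) x y ≡ -ℚ ∑ (filterB (below x y) (elems n)) (μ n k x)
    μ-step n k x y e l rewrite e | l = refl

    -- Each recursive call passes to an element of smaller rank, so fuel `rk y` minus `rk x` already
    -- suffices. This matters because the recursion evaluates its summands with one unit of fuel
    -- less than the value it defines.
    μ-fuel : ∀ n k x y → V x → V y → rk y ≤ k + rk x → μ n k x y ≡ μ n (suc k) x y
    μ-fuel n k x y Vx Vy le with bool? (eq x y) | bool? (leq x y)
    ... | inj₁ e | _      = trans (μ-diag n k x y e) (sym (μ-diag n (suc k) x y e))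
    ... | inj₂ e | inj₂ l = trans (μ-none n k x y e l) (sym (μ-none n (suc k) x y e l))
    μ-fuel n zero x y Vx Vy le | inj₂ e | inj₁ l =
      contradiction (ℕₚ.≤-trans (leq-rk Vx Vy l (false⇒≢ isEq e)) le) (ℕₚ.<-irrefl refl)
    μ-fuel n (suc k) x y Vx Vy le | inj₂ e | inj₁ l =
      trans (μ-step n k x y e l) (trans
        (cong -ℚ_ (∑-cong-All (All-filterB (elems-V n)) (λ z (Vz , z<y) →
          μ-fuel n k x z Vx Vz (ℕₚ.≤-pred (ℕₚ.≤-trans (below-rk {x} Vz Vy z<y) le)))))
        (sym (μ-step n (suc k) x y e l)))

    μ-sum : ∀ n k x y → V x → V y → eq x y ≡ false → leq x y ≡ true → rk y ≤ k + rk x →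
            μ n k x y +ℚ ∑ (filterB (below x y) (elems n)) (μ n k x) ≡ 0ℚ
    μ-sum n k x y Vx Vy e l le = trans
      (cong (_+ℚ S) (trans (μ-fuel n k x y Vx Vy le) (μ-step n k x y e l)))
      (ℚₚ.+-inverseˡ S)
      where S = ∑ (filterB (below x y) (elems n)) (μ n k x)

    -- With `a`, `b`, `c` standing for x ≤ z, z ≤ y and z = y, this detaches the term z = y from the
    -- sum over the interval, leaving the sum over x ≤ z < y that occurs in the recursion.
    term-rearrange : ∀ a b c m → (c ≡ true → a ≡ true) → (c ≡ true → b ≡ true) →
      ⟦ a ⟧ *ℚ (m *ℚ ⟦ b ⟧) ≡ ⟦ c ⟧ *ℚ m +ℚ ⟦ a ∧ b ∧ not c ⟧ *ℚ m
    term-rearrange true  true  true  m _ _ = solve 1 (λ m → con 1ℚ :* (m :* con 1ℚ) := con 1ℚ :* m :+ con 0ℚ :* m) refl m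
    term-rearrange true  true  false m _ _ = solve 1 (λ m → con 1ℚ :* (m :* con 1ℚ) := con 0ℚ :* m :+ con 1ℚ :* m) refl m
    term-rearrange true  false true  m _ h with () ← h refl
    term-rearrange true  false false m _ _ = solve 1 (λ m → con 1ℚ :* (m :* con 0ℚ) := con 0ℚ :* m :+ con 0ℚ :* m) refl m
    term-rearrange false b     true  m h _ with () ← h refl
    term-rearrange false b     false m _ _ = solve 2 (λ m b → con 0ℚ :* (m :* b) := con 0ℚ :* m :+ con 0ℚ :* m) refl m ⟦ b ⟧

  φ-M : ∀ {x y} → V x → V y → ev (φ y) (M x) ≡ ⟦ eq x y ⟧
  φ-M {x} {y} Vx Vy = trans (trans (∑-map _ (filterB (leq x) es)) (∑-filter (leq x) es)) main
    where
    open ≡-Reasoning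
    n = sz x
    k = n * n
    es = elems n
    main : ∑ es (λ z → ⟦ leq x z ⟧ *ℚ (μ n k x z *ℚ ⟦ leq z y ⟧)) ≡ ⟦ eq x y ⟧
    main with bool? (leq x y)
    ... | inj₂ l = trans (∑-zero es vanish) (sym (cong ⟦_⟧ (≢⇒false isEq x≢y)))
      where
      x≢y : x ≢ y
      x≢y refl with () ← trans (sym l) (leq-refl x)
      m : B → ℚ
      m z = μ n k x z *ℚ ⟦ leq z y ⟧
      vanish : ∀ z → ⟦ leq x z ⟧ *ℚ (μ n k x z *ℚ ⟦ leq z y ⟧) ≡ 0ℚ
      vanish z with bool? (leq x z) | bool? (leq z y)
      ... | inj₂ a | _ = trans (cong (λ b → ⟦ b ⟧ *ℚ m z) a) (ℚₚ.*-zeroˡ (m z))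
      ... | inj₁ a | inj₂ b = trans (cong (⟦ leq x z ⟧ *ℚ_) (trans (cong (λ b → μ n k x z *ℚ ⟦ b ⟧) b) (ℚₚ.*-zeroʳ (μ n k x z))))
                                  (ℚₚ.*-zeroʳ ⟦ leq x z ⟧)
      ... | inj₁ a | inj₁ b with () ← trans (sym l) (leq-trans a b)
    ... | inj₁ l = begin
      ∑ es (λ z → ⟦ leq x z ⟧ *ℚ (μ n k x z *ℚ ⟦ leq z y ⟧))
        ≡⟨ ∑-cong es (λ z → term-rearrange (leq x z) (leq z y) (eq z y) (μ n k x z) (above z) (under z)) ⟩
      ∑ es (λ z → ⟦ eq z y ⟧ *ℚ μ n k x z +ℚ ⟦ below x y z ⟧ *ℚ μ n k x z)
        ≡⟨ ∑-+ es ⟩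
      ∑ es (λ z → ⟦ eq z y ⟧ *ℚ μ n k x z) +ℚ ∑ es (λ z → ⟦ below x y z ⟧ *ℚ μ n k x z)
        ≡⟨ cong₂ _+ℚ_ (subst (λ j → ∑ (elems j) (λ z → ⟦ eq z y ⟧ *ℚ μ n k x z) ≡ μ n k x y)
                        (sym (leq-sz l)) (pick Vy (μ n k x)))
                      (sym (∑-filter (below x y) es)) ⟩
      μ n k x y +ℚ ∑ (filterB (below x y) es) (μ n k x)
        ≡⟨ finish ⟩
      ⟦ eq x y ⟧ ∎
      where
      above : ∀ z → eq z y ≡ true → leq x z ≡ true
      above z e rewrite sound isEq e = l
      under : ∀ z → eq z y ≡ true → leq z y ≡ true
      under z e rewrite sound isEq e = leq-refl y
      finish : μ n k x y +ℚ ∑ (filterB (below x y) es) (μ n k x) ≡ ⟦ eq x y ⟧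
      finish with bool? (eq x y)
      -- The fuel is large enough because comparable elements have equal size, so `rk y` is at most
      -- `k`.
      ... | inj₂ e = trans (μ-sum n k x y Vx Vy e l
                       (ℕₚ.≤-trans (ℕₚ.≤-trans (rk-bound y) (ℕₚ.≤-reflexive (cong (λ m → m * m) (sym (leq-sz l)))))
                                   (ℕₚ.m≤m+n k (rk x))))
                     (sym (cong ⟦_⟧ e))
      ... | inj₁ e = begin
        μ n k x y +ℚ ∑ (filterB (below x y) es) (μ n k x)
          ≡⟨ cong₂ _+ℚ_ (μ-diag n k x y e) (∑-cong-All (All-filterB (elems-V n)) (λ z (Vz , c) → ⊥-elim (nothing z Vz c))) ⟩
        1ℚ +ℚ ∑ (filterB (below x y) es) (λ _ → 0ℚ)
          ≡⟨ cong (1ℚ +ℚ_) (∑-zero (filterB (below x y) es) (λ _ → refl)) ⟩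
        1ℚ +ℚ 0ℚ
          ≡⟨ ℚₚ.+-identityʳ 1ℚ ⟩
        1ℚ ≡⟨ sym (cong ⟦_⟧ e) ⟩
        ⟦ eq x y ⟧ ∎
        where
        nothing : ∀ z → V z → below x y z ≡ true → ⊥
        nothing z Vz c with sound isEq e | ∧-true {leq x z} c
        ... | refl | a , c′ with ∧-true {leq z y} c′
        ... | b , d with leq-antisym Vx Vz a b
        ... | refl with () ← trans (sym (not-true d)) (reflexive isEq x)

  -- A class of functionals closed under linear combinations that contains all φ y contains all δ y,
  -- since δ y = φ y - Σ_{x<y} δ x on V.
  module _ (Φ : (B → ℚ) → Set)
           (Φ-ext : ∀ {f g} → (∀ x → V x → f x ≡ g x) → Φ f → Φ g)
           (Φ-0 : Φ (λ _ → 0ℚ))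
           (Φ-+ : ∀ {f g} → Φ f → Φ g → Φ (λ x → f x +ℚ g x))
           (Φ-neg : ∀ {f} → Φ f → Φ (λ x → -ℚ f x))
           (Φ-φ : ∀ y → V y → Φ (φ y)) where

    private
      under : B → B → Bool
      under y x = leq x y ∧ not (eq x y)

      Φ-∑ : ∀ {P : B → Set} xs → All P xs → (∀ x → P x → Φ (δ x)) → Φ (λ z → ∑ xs (λ x → δ x z))
      Φ-∑ []       []       h = Φ-0
      Φ-∑ (x ∷ xs) (p ∷ ps) h = Φ-+ (h x p) (Φ-∑ xs ps h)

      decompose : ∀ y → V y → ∀ z → V z → φ y z +ℚ -ℚ ∑ (filterB (under y) (elems (sz y))) (λ x → δ x z) ≡ δ y z
      decompose y Vy z Vz = trans (cong (λ q → φ y z +ℚ -ℚ q) strict) (arith (leq z y) (eq z y) refl-case)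
        where
        open ≡-Reasoning
        refl-case : eq z y ≡ true → leq z y ≡ true
        refl-case e rewrite sound isEq e = leq-refl y
        arith : ∀ a c → (c ≡ true → a ≡ true) → ⟦ a ⟧ +ℚ -ℚ ⟦ a ∧ not c ⟧ ≡ ⟦ c ⟧
        arith true  true  _ = refl
        arith true  false _ = refl
        arith false true  h with () ← h refl
        arith false false _ = refl
        swap : ∀ x → ⟦ under y x ⟧ *ℚ ⟦ eq z x ⟧ ≡ ⟦ eq x z ⟧ *ℚ ⟦ under y z ⟧
        swap x rewrite eq-sym isEq z x with bool? (eq x z)
        ... | inj₁ e rewrite sound isEq e = ℚₚ.*-comm ⟦ under y z ⟧ ⟦ eq z z ⟧
        ... | inj₂ e rewrite e = trans (ℚₚ.*-zeroʳ ⟦ under y x ⟧) (sym (ℚₚ.*-zeroˡ ⟦ under y z ⟧))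
        strict : ∑ (filterB (under y) (elems (sz y))) (λ x → δ x z) ≡ ⟦ under y z ⟧
        strict = trans (∑-filter (under y) (elems (sz y))) (trans (∑-cong (elems (sz y)) swap) collect)
          where
          collect : ∑ (elems (sz y)) (λ x → ⟦ eq x z ⟧ *ℚ ⟦ under y z ⟧) ≡ ⟦ under y z ⟧
          collect with bool? (leq z y)
          ... | inj₁ l rewrite sym (leq-sz l) = pick Vz (λ _ → ⟦ under y z ⟧)
          ... | inj₂ l rewrite l = ∑-zero (elems (sz y)) (λ x → ℚₚ.*-zeroʳ ⟦ eq x z ⟧)

      Φ-δ-acc : ∀ y → V y → Acc _<_ (rk y) → Φ (δ y)
      Φ-δ-acc y Vy (acc rs) = Φ-ext (decompose y Vy) (Φ-+ (Φ-φ y Vy) (Φ-neg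
        (Φ-∑ (filterB (under y) (elems (sz y))) (All-filterB (elems-V (sz y))) step)))
        where
        step : ∀ x → V x × under y x ≡ true → Φ (δ x)
        step x (Vx , u) with ∧-true {leq x y} u
        ... | l , ne = Φ-δ-acc x Vx (rs (leq-rk Vx Vy l (false⇒≢ isEq (not-true ne))))

      -- Validity is not assumed decidable. Scanning the enumeration either meets `b`, which is then
      -- valid because all listed elements are, or shows that `b` is not listed, in which case `δ b`
      -- vanishes on the valid elements.
      search : ∀ (P : B → Set) b xs → All P xs → P b ⊎ All (λ x → eq x b ≡ false) xs
      search P b []       []       = inj₂ []
      search P b (x ∷ xs) (p ∷ ps) with bool? (eq x b) | search P b xs ps
      ... | inj₁ e | _       = inj₁ (subst P (sound isEq e) p)
      ... | inj₂ e | inj₁ q  = inj₁ q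
      ... | inj₂ e | inj₂ qs = inj₂ (e ∷ qs)

    Φ-δ : ∀ y → Φ (δ y)
    Φ-δ y with search V y (elems (sz y)) (elems-V (sz y))
    ... | inj₁ Vy = Φ-δ-acc y Vy (<-wellFounded (rk y))
    ... | inj₂ no-y = Φ-ext outside Φ-0
      where
      outside : ∀ x → V x → 0ℚ ≡ δ y x
      outside x Vx = sym (cong ⟦_⟧ (≢⇒false isEq x≢y))
        where
        x≢y : x ≢ y
        -- If the valid `x` were the unlisted `y`, the sum in `pick` for the constant 1 would be
        -- both 1 and 0.
        x≢y refl with () ← trans (sym (pick Vx (λ _ → 1ℚ))) (trans
          (∑-cong-All no-y (λ z e → trans (cong (λ b → ⟦ b ⟧ *ℚ 1ℚ) e) (ℚₚ.*-zeroˡ 1ℚ)))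
          (∑-zero (elems (sz x)) (λ _ → refl)))

  private
    neg-ev : ∀ {A : Set} (v : Lc A) (f g : A → ℚ) → ev (λ p → (-ℚ f p) *ℚ g p) v ≡ -ℚ ev (λ p → f p *ℚ g p) v
    neg-ev v f g = trans (ev-cong v (λ p → solve 2 (λ a b → (:- a) :* b := (:- con 1ℚ) :* (a :* b)) refl (f p) (g p)))
      (trans (ev-*ˡ v (-ℚ 1ℚ)) (solve 1 (λ a → (:- con 1ℚ) :* a := :- a) refl (ev (λ p → f p *ℚ g p) v)))

    -- For fixed `g`, the functionals `f` whose product `(f ∘ h) * g` takes equal values on `v` and
    -- `w` satisfy the closure conditions of `Φ-δ`. The free factor `g` lets `separate²` replace `φ`
    -- by `δ` in one tensor factor at a time.
    separate-along : ∀ {A : Set} (h : A → B) {W : A → Set} → (∀ a → W a → V (h a)) →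
      ∀ (v w : Lc A) → Conc W v → Conc W w → ∀ (g : A → ℚ) →
      (∀ y → V y → ev (λ a → φ y (h a) *ℚ g a) v ≡ ev (λ a → φ y (h a) *ℚ g a) w) →
      ∀ y → ev (λ a → δ y (h a) *ℚ g a) v ≡ ev (λ a → δ y (h a) *ℚ g a) w
    separate-along {A} h {W} Wh v w cv cw g = Φ-δ Φ
      (λ {f} {f′} e p → trans (sym (cv (λ a → f (h a) *ℚ g a) _ (λ a Wa → cong (_*ℚ g a) (e (h a) (Wh a Wa)))))
                    (trans p (cw (λ a → f (h a) *ℚ g a) _ (λ a Wa → cong (_*ℚ g a) (e (h a) (Wh a Wa))))))
      (trans (zero-left v) (sym (zero-left w)))
      (λ {f} {f′} p q → trans (plus v f f′) (trans (cong₂ _+ℚ_ p q) (sym (plus w f f′))))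
      (λ {f} p → trans (neg-ev v (f ∘ h) g) (trans (cong -ℚ_ p) (sym (neg-ev w (f ∘ h) g))))
      where
      Φ : (B → ℚ) → Set
      Φ f = ev (λ a → f (h a) *ℚ g a) v ≡ ev (λ a → f (h a) *ℚ g a) w
      zero-left : ∀ v → ev (λ a → 0ℚ *ℚ g a) v ≡ 0ℚ
      zero-left v = trans (ev-cong v (λ a → ℚₚ.*-zeroˡ (g a))) (ev-zero v)
      plus : ∀ v f f′ → ev (λ a → (f (h a) +ℚ f′ (h a)) *ℚ g a) v
                        ≡ ev (λ a → f (h a) *ℚ g a) v +ℚ ev (λ a → f′ (h a) *ℚ g a) v
      plus v f f′ = trans (ev-cong v (λ a → ℚₚ.*-distribʳ-+ (g a) (f (h a)) (f′ (h a)))) (ev-+ v)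

  separate : ∀ (v w : Lc B) → Conc V v → Conc V w →
             (∀ y → V y → ev (φ y) v ≡ ev (φ y) w) → EqV eq v w
  separate v w cv cw h = EqV-intro isEq v w (λ b → trans (unit v (δ b)) (trans
      (separate-along id (λ _ Vx → Vx) v w cv cw (λ _ → 1ℚ)
        (λ y Vy → trans (sym (unit v (φ y))) (trans (h y Vy) (unit w (φ y)))) b)
      (sym (unit w (δ b)))))
    where
    unit : ∀ v f → ev f v ≡ ev (λ a → f a *ℚ 1ℚ) v
    unit v f = ev-cong v (λ a → sym (ℚₚ.*-identityʳ (f a)))

  V² : B × B → Set
  V² p = V (proj₁ p) × V (proj₂ p)

  φ² : B → B → B × B → ℚ
  φ² y z p = φ y (proj₁ p) *ℚ φ z (proj₂ p)

  separate² : ∀ (v w : Lc (B × B)) → Conc V² v → Conc V² w →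
              (∀ y z → V y → V z → ev (φ² y z) v ≡ ev (φ² y z) w) → EqV (eqPair eq) v w
  separate² v w cv cw h = EqV-intro (eqPair-isEq isEq) v w (λ (b , c) → trans (prod v b c) (trans
      (separate-along proj₂ (λ _ → proj₂) v w cv cw (λ p → δ b (proj₁ p))
        (λ z Vz → trans (flip v (φ z ∘ proj₂) (δ b ∘ proj₁)) (trans
          (separate-along proj₁ (λ _ → proj₁) v w cv cw (λ p → φ z (proj₂ p)) (λ y Vy → h y z Vy Vz) b)
          (flip w (δ b ∘ proj₁) (φ z ∘ proj₂)))) c)
      (sym (prod w b c))))
    where
    flip : ∀ v (f g : B × B → ℚ) → ev (λ p → f p *ℚ g p) v ≡ ev (λ p → g p *ℚ f p) v
    flip v f g = ev-cong v (λ p → ℚₚ.*-comm (f p) (g p))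
    prod : ∀ v b c → ev (λ p → ⟦ eqPair eq p (b , c) ⟧) v ≡ ev (λ p → δ c (proj₂ p) *ℚ δ b (proj₁ p)) v
    prod v b c = ev-cong v (λ p → trans (⟦∧⟧ (eq (proj₁ p) b) (eq (proj₂ p) c)) (ℚₚ.*-comm (δ b (proj₁ p)) (δ c (proj₂ p))))

  M-Conc : ∀ x → Conc V (M x)
  M-Conc x = All⇒Conc (All-map (All-filterB (elems-V (sz x))))
    where
    All-map : ∀ {xs} → All (λ y → V y × leq x y ≡ true) xs →
              All (V ∘ proj₂) (map (λ y → (muF eq leq (elems (sz x)) (sz x * sz x) x y , y)) xs)
    All-map []             = []
    All-map ((Vy , _) ∷ a) = Vy ∷ All-map a

  ∑-above : ∀ x {y} → V y → ∑ (filterB (leq x) (elems (sz x))) (λ z → ⟦ eq z y ⟧) ≡ ⟦ leq x y ⟧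
  ∑-above x {y} Vy = trans (∑-filter (leq x) es) (trans (∑-cong es swap) collect)
    where
    es = elems (sz x)
    swap : ∀ z → ⟦ leq x z ⟧ *ℚ ⟦ eq z y ⟧ ≡ ⟦ eq z y ⟧ *ℚ ⟦ leq x y ⟧
    swap z with bool? (eq z y)
    ... | inj₁ e rewrite sound isEq e = ℚₚ.*-comm ⟦ leq x y ⟧ ⟦ eq y y ⟧
    ... | inj₂ e rewrite e = trans (ℚₚ.*-zeroʳ ⟦ leq x z ⟧) (sym (ℚₚ.*-zeroˡ ⟦ leq x y ⟧))
    collect : ∑ es (λ z → ⟦ eq z y ⟧ *ℚ ⟦ leq x y ⟧) ≡ ⟦ leq x y ⟧
    collect with bool? (leq x y)
    ... | inj₁ l = subst (λ n → ∑ (elems n) (λ z → ⟦ eq z y ⟧ *ℚ ⟦ leq x y ⟧) ≡ ⟦ leq x y ⟧) (sym (leq-sz l)) (pick Vy (λ _ → ⟦ leq x y ⟧))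
    ... | inj₂ l rewrite l = ∑-zero es (λ z → ℚₚ.*-zeroʳ ⟦ eq z y ⟧)

  above : B → List B
  above x = filterB (leq x) (elems (sz x))

  -- Möbius inversion of the definition of `M`, obtained without manipulating μ: `φ y` takes the
  -- value [x ≤ y] on both sides. It gives access to `Γ` on fundamental basis elements.
  M-expansion : ∀ {x} → V x → EqV eq (bv x) (concatMap M (above x))
  M-expansion {x} Vx = separate (bv x) (concatMap M (above x)) (All⇒Conc {v = bv x} (Vx ∷ []))
    (λ f g h → trans (∑-concatMap M (above x)) (trans (∑-cong (above x) (λ z → M-Conc z f g h)) (sym (∑-concatMap M (above x)))))
    (λ y Vy → trans (ev-bv (φ y) x) (sym (trans (∑-concatMap M (above x)) (trans
      (∑-cong-All (All-filterB (elems-V (sz x))) (λ z (Vz , _) → φ-M Vz Vy)) (∑-above x Vy)))))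

-- Reflection of Boolean tests on numbers and lists

≡true⇒T : ∀ {b} → b ≡ true → T b
≡true⇒T refl = _

T⇒≡true : ∀ {b} → T b → b ≡ true
T⇒≡true = Equivalence.to T-≡

<ᵇ-true : ∀ {m n} → (m <ᵇ n) ≡ true → m < n
<ᵇ-true = ℕₚ.<ᵇ⇒< _ _ ∘ ≡true⇒T

true-<ᵇ : ∀ {m n} → m < n → (m <ᵇ n) ≡ true
true-<ᵇ = T⇒≡true ∘ ℕₚ.<⇒<ᵇ

≤ᵇ-true : ∀ {m n} → (m ≤ᵇ n) ≡ true → m ≤ n
≤ᵇ-true = ℕₚ.≤ᵇ⇒≤ _ _ ∘ ≡true⇒T

true-≤ᵇ : ∀ {m n} → m ≤ n → (m ≤ᵇ n) ≡ true
true-≤ᵇ = T⇒≡true ∘ ℕₚ.≤⇒≤ᵇ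

≡ᵇ-true : ∀ {m n} → (m ≡ᵇ n) ≡ true → m ≡ n
≡ᵇ-true = ℕₚ.≡ᵇ⇒≡ _ _ ∘ ≡true⇒T

true-≡ᵇ : ∀ {m n} → m ≡ n → (m ≡ᵇ n) ≡ true
true-≡ᵇ = T⇒≡true ∘ ℕₚ.≡⇒≡ᵇ _ _

true-∧ : ∀ {a b} → a ≡ true → b ≡ true → a ∧ b ≡ true
true-∧ refl refl = refl

all-true : ∀ {p : A → Bool} xs → all p xs ≡ true → ∀ {x} → x ∈ xs → p x ≡ true
all-true {p = p} (x ∷ xs) h (here refl) = proj₁ (∧-true {p x} h)
all-true {p = p} (x ∷ xs) h (there x∈)  = all-true xs (proj₂ (∧-true {p x} h)) x∈

true-all : ∀ {p : A → Bool} xs → (∀ {x} → x ∈ xs → p x ≡ true) → all p xs ≡ true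
true-all []       h = refl
true-all (x ∷ xs) h = true-∧ (h (here refl)) (true-all xs (h ∘ there))

any-true : ∀ {p : A → Bool} xs → any p xs ≡ true → ∃ λ x → x ∈ xs × p x ≡ true
any-true {p = p} (x ∷ xs) h with bool? (p x)
... | inj₁ e = x , here refl , e
... | inj₂ e rewrite e with any-true xs h
...   | y , y∈ , py = y , there y∈ , py

true-any : ∀ {p : A → Bool} xs {x} → x ∈ xs → p x ≡ true → any p xs ≡ true
true-any (x ∷ xs) (here refl) e rewrite e = refl
true-any {p = p} (x ∷ xs) (there x∈) e with p x
... | true  = refl
... | false = true-any xs x∈ e

∈-filterB⁻ : ∀ {p : A → Bool} xs {x} → x ∈ filterB p xs → x ∈ xs × p x ≡ true
∈-filterB⁻ {p = p} (y ∷ xs) x∈ with p y in e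
∈-filterB⁻ (y ∷ xs) (here refl) | true = here refl , e
∈-filterB⁻ (y ∷ xs) (there x∈)  | true with ∈-filterB⁻ xs x∈
... | a , b = there a , b
∈-filterB⁻ (y ∷ xs) x∈ | false with ∈-filterB⁻ xs x∈
... | a , b = there a , b

∈-filterB⁺ : ∀ {p : A → Bool} xs {x} → x ∈ xs → p x ≡ true → x ∈ filterB p xs
∈-filterB⁺ (y ∷ xs) (here refl) e rewrite e = here refl
∈-filterB⁺ {p = p} (y ∷ xs) (there x∈) e with p y
... | true  = there (∈-filterB⁺ xs x∈ e)
... | false = ∈-filterB⁺ xs x∈ e

-- The weak order

data At {A : Set} : List A → ℕ → A → Set where
  here  : ∀ {x xs} → At (x ∷ xs) 0 x
  there : ∀ {x y xs i} → At xs i x → At (y ∷ xs) (suc i) x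

At-func : ∀ {xs : List A} {i a b} → At xs i a → At xs i b → a ≡ b
At-func here      here      = refl
At-func (there p) (there q) = At-func p q

At-< : ∀ {xs : List A} {i a} → At xs i a → i < length xs
At-< here      = s≤s z≤n
At-< (there p) = s≤s (At-< p)

At-∈ : ∀ {xs : List A} {i a} → At xs i a → a ∈ xs
At-∈ here      = here refl
At-∈ (there p) = there (At-∈ p)

At-++ˡ : ∀ {xs ys : List A} {i a} → At xs i a → At (xs ++ ys) i a
At-++ˡ here      = here
At-++ˡ (there p) = there (At-++ˡ p)

At-++ʳ : ∀ (xs : List A) {ys i a} → At ys i a → At (xs ++ ys) (length xs + i) a
At-++ʳ []       p = p
At-++ʳ (x ∷ xs) p = there (At-++ʳ xs p)

At-++⁻ : ∀ (xs : List A) {ys i a} → At (xs ++ ys) i a → At xs i a ⊎ (∃ λ j → i ≡ length xs + j × At ys j a)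
At-++⁻ []       p         = inj₂ (_ , refl , p)
At-++⁻ (x ∷ xs) here      = inj₁ here
At-++⁻ (x ∷ xs) (there p) with At-++⁻ xs p
... | inj₁ q           = inj₁ (there q)
... | inj₂ (j , e , q) = inj₂ (j , cong suc e , q)

∈-zip⁻ : ∀ (g : ℕ → B) n (ys : List A) {i a} → (i , a) ∈ zip (applyUpTo g n) ys → ∃ λ j → i ≡ g j × At ys j a
∈-zip⁻ g (suc n) (y ∷ ys) (here refl) = 0 , refl , here
∈-zip⁻ g (suc n) (y ∷ ys) (there p) with ∈-zip⁻ (g ∘ suc) n ys p
... | j , e , q = suc j , e , there q

∈-zip⁺ : ∀ (g : ℕ → B) n {ys : List A} {j a} → j < n → At ys j a → (g j , a) ∈ zip (applyUpTo g n) ys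
∈-zip⁺ g (suc n) _         here      = here refl
∈-zip⁺ g (suc n) (s≤s j<n) (there p) = there (∈-zip⁺ (g ∘ suc) n j<n p)

indexed≡zip : ∀ w → indexed w ≡ zip (applyUpTo suc (length w)) w
indexed≡zip w = cong (λ l → zip l w) (map-upTo suc (length w))

∈-indexed⁻ : ∀ w {i a} → (i , a) ∈ indexed w → ∃ λ j → i ≡ suc j × At w j a
∈-indexed⁻ w p rewrite indexed≡zip w = ∈-zip⁻ suc (length w) w p

∈-indexed⁺ : ∀ {w j a} → At w j a → (suc j , a) ∈ indexed w
∈-indexed⁺ {w} p rewrite indexed≡zip w = ∈-zip⁺ suc (length w) (At-< p) p

Inv : List ℕ → ℕ → ℕ → Set
Inv w i j = ∃₂ λ x y → At w i x × At w j y × i < j × y < x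

∈-inversions⁻ : ∀ w {p} → p ∈ inversions w → ∃₂ λ i j → p ≡ (suc i , suc j) × Inv w i j
∈-inversions⁻ w p∈ with find (∈-concatMap⁻ _ {xs = indexed w} p∈)
... | (i , x) , a∈ , q with ∈-map⁻ _ q
... | (j , y) , b∈ , refl with ∈-filterB⁻ (indexed w) b∈
... | b∈′ , c with ∈-indexed⁻ w a∈ | ∈-indexed⁻ w b∈′ | ∧-true {i <ᵇ j} c
... | i′ , refl , ai | j′ , refl , aj | lt , gt =
  i′ , j′ , refl , x , y , ai , aj , ℕₚ.≤-pred (<ᵇ-true {i} {j} lt) , <ᵇ-true gt

∈-inversions⁺ : ∀ {w i j} → Inv w i j → (suc i , suc j) ∈ inversions w
∈-inversions⁺ {w} {i} {j} (x , y , ai , aj , lt , gt) =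
  ∈-concatMap⁺ _ (lose (∈-indexed⁺ ai) (∈-map⁺ _ (∈-filterB⁺ (indexed w) (∈-indexed⁺ aj)
    (true-∧ (true-<ᵇ (s≤s lt)) (true-<ᵇ gt)))))

memPair-true : ∀ {p} xs → memPair p xs ≡ true → p ∈ xs
memPair-true {i , j} xs h with any-true xs h
... | (k , l) , q∈ , e with ∧-true {i ≡ᵇ k} e
... | e₁ , e₂ with refl ← ≡ᵇ-true {i} e₁ | refl ← ≡ᵇ-true {j} e₂ = q∈

true-memPair : ∀ {p} xs → p ∈ xs → memPair p xs ≡ true
true-memPair {i , j} xs p∈ = true-any xs p∈ (true-∧ (true-≡ᵇ {i} refl) (true-≡ᵇ {j} refl))

-- The weak order for arbitrary words of equal length, position by position.
infix 4 _⊑_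
data _⊑_ : List ℕ → List ℕ → Set where
  []  : [] ⊑ []
  _∷_ : ∀ {x y xs ys} → Pointwise (λ a b → a < x → b < y) xs ys → xs ⊑ ys → (x ∷ xs) ⊑ (y ∷ ys)

⊑-length : ∀ {xs ys} → xs ⊑ ys → length xs ≡ length ys
⊑-length []      = refl
⊑-length (_ ∷ p) = cong suc (⊑-length p)

Pointwise-At : ∀ {R : A → B → Set} {xs ys} → length xs ≡ length ys →
               (∀ i {a b} → At xs i a → At ys i b → R a b) → Pointwise R xs ys
Pointwise-At {xs = []}     {[]}     _ h = []
Pointwise-At {xs = x ∷ xs} {y ∷ ys} e h =
  h 0 here here ∷ Pointwise-At (ℕₚ.suc-injective e) (λ i p q → h (suc i) (there p) (there q))

At-Pointwise : ∀ {R : A → B → Set} {xs ys i a} → Pointwise R xs ys → At xs i a → ∃ λ b → At ys i b × R a b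
At-Pointwise (r ∷ rs) here = _ , here , r
At-Pointwise (r ∷ rs) (there p) with At-Pointwise rs p
... | b , q , s = b , there q , s

⊑⇒Inv : ∀ {σ τ} → σ ⊑ τ → ∀ {i j} → Inv σ i j → Inv τ i j
⊑⇒Inv (pw ∷ p) (x , y , here , there aj , lt , gt) with At-Pointwise pw aj
... | b , bj , r = _ , b , here , there bj , lt , r gt
⊑⇒Inv (pw ∷ p) (x , y , there ai , there aj , s≤s lt , gt) with ⊑⇒Inv p (x , y , ai , aj , lt , gt)
... | x′ , y′ , bi , bj , _ , gt′ = x′ , y′ , there bi , there bj , s≤s lt , gt′

Inv⇒⊑ : ∀ σ τ → length σ ≡ length τ → (∀ i j → Inv σ i j → Inv τ i j) → σ ⊑ τ
Inv⇒⊑ []       []       _ _ = []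
Inv⇒⊑ (x ∷ xs) (y ∷ ys) e h =
  Pointwise-At (ℕₚ.suc-injective e) (λ j aj bj a<x → first j bj (h 0 (suc j) (x , _ , here , there aj , s≤s z≤n , a<x)))
  ∷ Inv⇒⊑ xs ys (ℕₚ.suc-injective e) (λ i j (a , b , ai , bj , lt , gt) →
      rest i j (h (suc i) (suc j) (a , b , there ai , there bj , s≤s lt , gt)))
  where
  first : ∀ j {b} → At ys j b → Inv (y ∷ ys) 0 (suc j) → b < y
  first j bj (_ , _ , here , there bj′ , _ , gt) rewrite At-func bj bj′ = gt
  rest : ∀ i j → Inv (y ∷ ys) (suc i) (suc j) → Inv ys i j
  rest i j (a , b , there ai , there bj , s≤s lt , gt) = a , b , ai , bj , lt , gt

leqW⇒⊑ : ∀ σ τ → leqW σ τ ≡ true → σ ⊑ τ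
leqW⇒⊑ σ τ h with ∧-true {length σ ≡ᵇ length τ} h
... | len , incl = Inv⇒⊑ σ τ (≡ᵇ-true len) (λ i j inv →
  conv (∈-inversions⁻ τ (memPair-true (inversions τ) (all-true (inversions σ) incl (∈-inversions⁺ inv)))))
  where
  conv : ∀ {i j} → (∃₂ λ i′ j′ → (suc i , suc j) ≡ (suc i′ , suc j′) × Inv τ i′ j′) → Inv τ i j
  conv (_ , _ , refl , inv) = inv

⊑⇒leqW : ∀ σ τ → σ ⊑ τ → leqW σ τ ≡ true
⊑⇒leqW σ τ p = true-∧ (true-≡ᵇ (⊑-length p)) (true-all (inversions σ) incl)
  where
  incl : ∀ {q} → q ∈ inversions σ → memPair q (inversions τ) ≡ true
  incl q∈ with ∈-inversions⁻ σ q∈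
  ... | i , j , refl , inv = true-memPair (inversions τ) (∈-inversions⁺ (⊑⇒Inv p inv))

⊑-refl : ∀ {xs} → xs ⊑ xs
⊑-refl {[]}     = []
⊑-refl {x ∷ xs} = Pw.refl id ∷ ⊑-refl

⊑-trans : ∀ {xs ys zs} → xs ⊑ ys → ys ⊑ zs → xs ⊑ zs
⊑-trans []      []      = []
⊑-trans (a ∷ p) (b ∷ q) = Pw.transitive (λ f g → g ∘ f) a b ∷ ⊑-trans p q

-- The part of the comparison of `a ++ b` with `c ++ d` that concerns inversions with first position
-- in the left block and second position in the right block.
Cross : List ℕ → List ℕ → List ℕ → List ℕ → Set
Cross a c b d = Pointwise (λ x y → Pointwise (λ x′ y′ → x′ < x → y′ < y) b d) a c

⊑-++⁺ : ∀ {a c b d} → a ⊑ c → b ⊑ d → Cross a c b d → a ++ b ⊑ c ++ d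
⊑-++⁺ []      q []       = q
⊑-++⁺ (r ∷ p) q (s ∷ ss) = Pw.++⁺ r s ∷ ⊑-++⁺ p q ss

Pointwise-++⁻ : ∀ {R : A → B → Set} {a b} c {d} → length a ≡ length c → Pointwise R (a ++ b) (c ++ d) →
                Pointwise R a c × Pointwise R b d
Pointwise-++⁻ {a = []}    []      _ p       = [] , p
Pointwise-++⁻ {a = _ ∷ _} (_ ∷ c) e (r ∷ p) with Pointwise-++⁻ c (ℕₚ.suc-injective e) p
... | q , s = r ∷ q , s

⊑-++⁻ : ∀ {σ} c {d} → σ ⊑ c ++ d → ∃₂ λ a b → σ ≡ a ++ b × a ⊑ c × b ⊑ d × Cross a c b d
⊑-++⁻ []      p = [] , _ , refl , [] , p , []
⊑-++⁻ (y ∷ c) (r ∷ p) with ⊑-++⁻ c p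
... | a , b , refl , q , s , cr with Pointwise-++⁻ c (⊑-length q) r
... | r₁ , r₂ = _ ∷ a , b , refl , r₁ ∷ q , s , r₂ ∷ cr

Monotone-on Reflecting-on : List ℕ → (ℕ → ℕ) → Set
Monotone-on w f = ∀ {x y} → x ∈ w → y ∈ w → x < y → f x < f y
Reflecting-on w f = ∀ {x y} → x ∈ w → y ∈ w → f x < f y → x < y

⊑-mapˡ⁺ : ∀ {f a ρ} → Reflecting-on a f → a ⊑ ρ → map f a ⊑ ρ
⊑-mapˡ⁺ m []      = []
⊑-mapˡ⁺ {f} {x ∷ a} m (r ∷ p) = go a there r ∷ ⊑-mapˡ⁺ (λ i j → m (there i) (there j)) p
  where
  go : ∀ {ys y} b → (∀ {z} → z ∈ b → z ∈ x ∷ a) → Pointwise (λ u v → u < x → v < y) b ys → Pointwise (λ u v → u < f x → v < y) (map f b) ys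
  go []      inc []       = []
  go (z ∷ b) inc (r ∷ rs) = (λ lt → r (m (inc (here refl)) (here refl) lt)) ∷ go b (inc ∘ there) rs

⊑-mapˡ⁻ : ∀ {f a ρ} → Monotone-on a f → map f a ⊑ ρ → a ⊑ ρ
⊑-mapˡ⁻ {a = []} m []      = []
⊑-mapˡ⁻ {f} {x ∷ a} m (r ∷ p) = go a there r ∷ ⊑-mapˡ⁻ (λ i j → m (there i) (there j)) p
  where
  go : ∀ {ys y} b → (∀ {z} → z ∈ b → z ∈ x ∷ a) → Pointwise (λ u v → u < f x → v < y) (map f b) ys → Pointwise (λ u v → u < x → v < y) b ys
  go []      inc []       = []
  go (z ∷ b) inc (r ∷ rs) = (λ lt → r (m (inc (here refl)) (here refl) lt)) ∷ go b (inc ∘ there) rs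

⊑-shift⁺ : ∀ k {a ρ} → a ⊑ ρ → a ⊑ map (_+ k) ρ
⊑-shift⁺ k []      = []
⊑-shift⁺ k {ρ = y ∷ ρ} (r ∷ p) = go r ∷ ⊑-shift⁺ k p
  where
  go : ∀ {x a ρ} → Pointwise (λ u v → u < x → v < y) a ρ → Pointwise (λ u v → u < x → v < y + k) a (map (_+ k) ρ)
  go []       = []
  go (r ∷ rs) = (λ lt → ℕₚ.+-monoˡ-< k (r lt)) ∷ go rs

⊑-shift⁻ : ∀ k {a ρ} → a ⊑ map (_+ k) ρ → a ⊑ ρ
⊑-shift⁻ k {ρ = []}    []      = []
⊑-shift⁻ k {ρ = y ∷ ρ} (r ∷ p) = go r ∷ ⊑-shift⁻ k p
  where
  go : ∀ {x a ρ} → Pointwise (λ u v → u < x → v < y + k) a (map (_+ k) ρ) → Pointwise (λ u v → u < x → v < y) a ρ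
  go {ρ = []}    []       = []
  go {ρ = _ ∷ _} (r ∷ rs) = (λ lt → ℕₚ.+-cancelʳ-< k _ _ (r lt)) ∷ go rs

-- Counting, and the number of inversions as rank of the weak order

countB-↭ : ∀ (p : A → Bool) {xs ys} → xs ↭ ys → countB p xs ≡ countB p ys
countB-↭ p refl↭ = refl
countB-↭ p (prep↭ x r) with p x
... | true  = cong suc (countB-↭ p r)
... | false = countB-↭ p r
countB-↭ p (swap↭ x y r) with p x | p y
... | true  | true  = cong (suc ∘ suc) (countB-↭ p r)
... | true  | false = cong suc (countB-↭ p r)
... | false | true  = cong suc (countB-↭ p r)
... | false | false = countB-↭ p r
countB-↭ p (trans↭ r s) = trans (countB-↭ p r) (countB-↭ p s)

countB-≤-length : ∀ (p : A → Bool) xs → countB p xs ≤ length xs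
countB-≤-length p [] = z≤n
countB-≤-length p (x ∷ xs) with p x
... | true  = s≤s (countB-≤-length p xs)
... | false = ℕₚ.m≤n⇒m≤1+n (countB-≤-length p xs)

countB-Pw-≤ : ∀ (p : A → Bool) (q : B → Bool) {xs ys} →
              Pointwise (λ a b → p a ≡ true → q b ≡ true) xs ys → countB p xs ≤ countB q ys
countB-Pw-≤ p q [] = z≤n
countB-Pw-≤ p q {x ∷ _} {y ∷ _} (r ∷ rs) with p x | q y
... | true  | true  = s≤s (countB-Pw-≤ p q rs)
... | true  | false with () ← r refl
... | false | true  = ℕₚ.m≤n⇒m≤1+n (countB-Pw-≤ p q rs)
... | false | false = countB-Pw-≤ p q rs

-- A pointwise implication can only raise the number of true entries, and every position where it is
-- strict raises it by one. If the number does not grow, the implication is an equivalence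
-- everywhere.
countB-Pw-rev : ∀ (p : A → Bool) (q : B → Bool) {xs ys} →
                Pointwise (λ a b → p a ≡ true → q b ≡ true) xs ys → countB q ys ≤ countB p xs →
                Pointwise (λ b a → q b ≡ true → p a ≡ true) ys xs
countB-Pw-rev p q [] le = []
countB-Pw-rev p q {x ∷ xs} {y ∷ ys} (r ∷ rs) le with p x in e₁ | q y in e₂
... | true  | true  = (λ _ → e₁) ∷ countB-Pw-rev p q rs (ℕₚ.≤-pred le)
... | true  | false with () ← r refl
... | false | true  = contradiction (ℕₚ.≤-trans le (countB-Pw-≤ p q rs)) (ℕₚ.<-irrefl refl)
... | false | false = (λ e → contradiction (trans (sym e) e₂) (λ ())) ∷ countB-Pw-rev p q rs le

Pw-diag : ∀ {R : A → A → Set} xs → (∀ {x} → x ∈ xs → R x x) → Pointwise R xs xs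
Pw-diag []       h = []
Pw-diag (x ∷ xs) h = h (here refl) ∷ Pw-diag xs (h ∘ there)

diag-Pw : ∀ {R : A → A → Set} {xs x} → Pointwise R xs xs → x ∈ xs → R x x
diag-Pw (r ∷ rs) (here refl) = r
diag-Pw (r ∷ rs) (there x∈)  = diag-Pw rs x∈

countB-mono : ∀ (p q : A → Bool) xs → (∀ {x} → x ∈ xs → p x ≡ true → q x ≡ true) → countB p xs ≤ countB q xs
countB-mono p q xs h = countB-Pw-≤ p q (Pw-diag xs h)

countB-strict : ∀ (p q : A → Bool) xs → (∀ {x} → x ∈ xs → p x ≡ true → q x ≡ true) →
                ∀ {z} → z ∈ xs → p z ≡ false → q z ≡ true → countB p xs < countB q xs
countB-strict p q xs h z∈ pz qz = ℕₚ.≰⇒> λ le →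
  contradiction (trans (sym (diag-Pw (countB-Pw-rev p q (Pw-diag xs h) le) z∈ qz)) pz) (λ ())

countB-all : ∀ (p : A → Bool) xs → (∀ {x} → x ∈ xs → p x ≡ true) → countB p xs ≡ length xs
countB-all p []       h = refl
countB-all p (x ∷ xs) h rewrite h (here refl) = cong suc (countB-all p xs (h ∘ there))

<ᵇ-irrefl : ∀ x → (x <ᵇ x) ≡ false
<ᵇ-irrefl x = ≢true⇒false (λ e → ℕₚ.<-irrefl refl (<ᵇ-true {x} e))

inversionCount : List ℕ → ℕ
inversionCount []       = 0
inversionCount (x ∷ xs) = countB (_<ᵇ x) xs + inversionCount xs

private
  to-bool : ∀ {x y xs ys} → Pointwise (λ a b → a < x → b < y) xs ys → Pointwise (λ a b → (a <ᵇ x) ≡ true → (b <ᵇ y) ≡ true) xs ys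
  to-bool = Pw.map (λ f e → true-<ᵇ (f (<ᵇ-true e)))

  from-bool : ∀ {x y xs ys} → Pointwise (λ a b → (a <ᵇ x) ≡ true → (b <ᵇ y) ≡ true) xs ys → Pointwise (λ a b → a < x → b < y) xs ys
  from-bool = Pw.map (λ f e → <ᵇ-true (f (true-<ᵇ e)))

⊑⇒count≤ : ∀ {σ τ} → σ ⊑ τ → inversionCount σ ≤ inversionCount τ
⊑⇒count≤ []      = z≤n
⊑⇒count≤ (r ∷ p) = ℕₚ.+-mono-≤ (countB-Pw-≤ _ _ (to-bool r)) (⊑⇒count≤ p)

-- The inversion count is a sum of contributions of the positions, each of which can only grow along
-- `⊑`. If the total does not grow, no contribution does, and `countB-Pw-rev` reverses the
-- comparison position by position.
⊑-reverse : ∀ {σ τ} → σ ⊑ τ → inversionCount τ ≤ inversionCount σ → τ ⊑ σ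
⊑-reverse []      _  = []
⊑-reverse {x ∷ xs} {y ∷ ys} (r ∷ p) le =
  from-bool (countB-Pw-rev _ _ (to-bool r)
    (ℕₚ.+-cancelʳ-≤ (inversionCount ys) _ _ (ℕₚ.≤-trans le (ℕₚ.+-monoʳ-≤ (countB (_<ᵇ x) xs) (⊑⇒count≤ p)))))
  ∷ ⊑-reverse p
    (ℕₚ.+-cancelˡ-≤ (countB (_<ᵇ y) ys) _ _ (ℕₚ.≤-trans le (ℕₚ.+-monoˡ-≤ (inversionCount xs) (countB-Pw-≤ _ _ (to-bool r)))))

inversionCount-bound : ∀ w → inversionCount w ≤ length w * length w
inversionCount-bound []       = z≤n
inversionCount-bound (x ∷ xs) = ℕₚ.+-mono-≤ (ℕₚ.m≤n⇒m≤1+n (countB-≤-length _ xs))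
  (ℕₚ.≤-trans (inversionCount-bound xs) (ℕₚ.*-monoʳ-≤ (length xs) (ℕₚ.n≤1+n (length xs))))

-- The inversions starting at the first position count the letters smaller than the head. Both words
-- have the same letters, so equal counts identify the heads, which can then be removed.
⊑-antisym : ∀ {xs ys} → xs ↭ ys → xs ⊑ ys → ys ⊑ xs → xs ≡ ys
⊑-antisym r [] [] = refl
⊑-antisym {x ∷ xs} {y ∷ ys} r (a ∷ p) (b ∷ q) with same-head
  where
  W = x ∷ xs
  below-head : ∀ z zs → countB (_<ᵇ z) (z ∷ zs) ≡ countB (_<ᵇ z) zs
  below-head z zs rewrite <ᵇ-irrefl z = refl
  heads : countB (_<ᵇ x) W ≡ countB (_<ᵇ y) W
  heads = trans (below-head x xs) (trans (ℕₚ.≤-antisym (countB-Pw-≤ _ _ (to-bool a)) (countB-Pw-≤ _ _ (to-bool b)))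
         (trans (sym (below-head y ys)) (sym (countB-↭ (_<ᵇ y) r))))
  increasing : ∀ {u v} → u ∈ W → u < v → countB (_<ᵇ u) W < countB (_<ᵇ v) W
  increasing {u} u∈ u<v = countB-strict _ _ W (λ _ e → true-<ᵇ (ℕₚ.<-trans (<ᵇ-true e) u<v)) u∈ (<ᵇ-irrefl u) (true-<ᵇ u<v)
  same-head : x ≡ y
  same-head with ℕₚ.<-cmp x y
  ... | tri≈ _ e _   = e
  ... | tri< x<y _ _ = contradiction heads (ℕₚ.<⇒≢ (increasing (here refl) x<y))
  ... | tri> _ _ y<x = contradiction (sym heads) (ℕₚ.<⇒≢ (increasing (↭ₚ.∈-resp-↭ (↭-sym r) (here refl)) y<x))
... | refl = cong (x ∷_) (⊑-antisym (↭ₚ.drop-∷ r) p q)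

-- Permutations

-- The reference arrangement of 1, ..., n is decreasing so that its head is the largest letter, the
-- one that `perms` inserts and that the inductions on `st` and `lamF` remove.
down : ℕ → List ℕ
down zero    = []
down (suc n) = suc n ∷ down n

length-down : ∀ n → length (down n) ≡ n
length-down zero    = refl
length-down (suc n) = cong suc (length-down n)

down-range : ∀ n → All (λ x → 0 < x × x ≤ n) (down n)
down-range zero    = []
down-range (suc n) = (s≤s z≤n , ℕₚ.≤-refl) ∷ All.map (λ (a , b) → a , ℕₚ.m≤n⇒m≤1+n b) (down-range n)

down-unique : ∀ n → Unique (down n)
down-unique zero    = []
down-unique (suc n) = All.map (λ (_ , b) → ℕₚ.<⇒≢ (s≤s b) ∘ sym) (down-range n) ∷ down-unique n

IsPermutation : List ℕ → Set
IsPermutation w = w ↭ down (length w)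

↭down⇒length : ∀ {n w} → w ↭ down n → length w ≡ n
↭down⇒length {n} r = trans (↭ₚ.↭-length r) (length-down n)

↭down⇒IsPermutation : ∀ {n w} → w ↭ down n → IsPermutation w
↭down⇒IsPermutation r rewrite ↭down⇒length r = r

perm-range : ∀ {w} → IsPermutation w → All (λ x → 0 < x × x ≤ length w) w
perm-range {w} r = ↭ₚ.All-resp-↭ (↭-sym r) (down-range (length w))

Unique-resp-↭ : ∀ {xs ys : List ℕ} → xs ↭ ys → Unique xs → Unique ys
Unique-resp-↭ r = SetoidPermutation.Unique-resp-↭ (setoid ℕ) (↭⇒↭ₛ r)

perm-unique : ∀ {w} → IsPermutation w → Unique w
perm-unique {w} r = Unique-resp-↭ (↭-sym r) (down-unique (length w))

eqList-isEq : IsEq eqList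
eqList-isEq = record { sound = snd ; reflexive = rfl }
  where
  snd : ∀ {x y} → eqList x y ≡ true → x ≡ y
  snd {[]} {[]} _ = refl
  snd {a ∷ x} {b ∷ y} e with ∧-true {a ≡ᵇ b} e
  ... | e₁ , e₂ = cong₂ _∷_ (≡ᵇ-true e₁) (snd e₂)
  rfl : ∀ x → eqList x x ≡ true
  rfl []      = refl
  rfl (a ∷ x) = true-∧ (true-≡ᵇ {a} refl) (rfl x)

insertions-↭ : ∀ m z → All (_↭ m ∷ z) (insertions m z)
insertions-↭ m []       = ↭-refl ∷ []
insertions-↭ m (y ∷ ys) = ↭-refl ∷ Allₚ.map⁺ (All.map (λ r → ↭-trans (↭-prep y r) (↭-swap y m ↭-refl)) (insertions-↭ m ys))

perms-↭ : ∀ n → All (_↭ down n) (perms n)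
perms-↭ zero    = ↭-refl ∷ []
perms-↭ (suc n) = Allₚ.concat⁺ (Allₚ.map⁺ (All.map (λ {z} r → All.map (λ s → ↭-trans s (↭-prep (suc n) r)) (insertions-↭ (suc n) z)) (perms-↭ n)))

perms-IsPermutation : ∀ n → All IsPermutation (perms n)
perms-IsPermutation n = All.map ↭down⇒IsPermutation (perms-↭ n)

private
  ≡ᵇ-false : ∀ {m n} → m ≢ n → (m ≡ᵇ n) ≡ false
  ≡ᵇ-false h = ≢true⇒false (h ∘ ≡ᵇ-true)

-- Because `m` occurs in neither `z` nor `a`, only the insertion at position `length a` can produce
-- `a ++ m ∷ b`, and it does so exactly when `z` is `a ++ b`. Hence each permutation is enumerated
-- once.
insertions-count : ∀ m z a b → m ∉ z → m ∉ a → ∀ k →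
  ∑ (insertions m z) (λ u → ⟦ eqList u (a ++ m ∷ b) ⟧ *ℚ k) ≡ ⟦ eqList z (a ++ b) ⟧ *ℚ k
insertions-count m [] [] b m∉z m∉a k rewrite true-≡ᵇ {m} refl with b
... | []    = ℚₚ.+-identityʳ _
... | _ ∷ _ = ℚₚ.+-identityʳ _
insertions-count m [] (x ∷ a) b m∉z m∉a k rewrite ≡ᵇ-false (m∉a ∘ here) = ℚₚ.+-identityʳ _
insertions-count m (y ∷ ys) [] b m∉z m∉a k rewrite true-≡ᵇ {m} refl = trans
  (cong (⟦ eqList (y ∷ ys) b ⟧ *ℚ k +ℚ_) (trans (∑-map (y ∷_) (insertions m ys)) (∑-zero (insertions m ys) λ u →
    trans (cong (λ c → ⟦ c ∧ eqList u b ⟧ *ℚ k) (≡ᵇ-false (m∉z ∘ here ∘ sym))) (ℚₚ.*-zeroˡ k))))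
  (ℚₚ.+-identityʳ _)
insertions-count m (y ∷ ys) (x ∷ a) b m∉z m∉a k rewrite ≡ᵇ-false (m∉a ∘ here) = trans
  (cong₂ _+ℚ_ (ℚₚ.*-zeroˡ k) (trans (∑-map (y ∷_) (insertions m ys)) rest))
  (ℚₚ.+-identityˡ _)
  where
  rest : ∑ (insertions m ys) (λ u → ⟦ (y ≡ᵇ x) ∧ eqList u (a ++ m ∷ b) ⟧ *ℚ k) ≡ ⟦ (y ≡ᵇ x) ∧ eqList ys (a ++ b) ⟧ *ℚ k
  rest with y ≡ᵇ x
  ... | true  = insertions-count m ys a b (m∉z ∘ there) (m∉a ∘ there) k
  ... | false = trans (∑-zero (insertions m ys) (λ _ → ℚₚ.*-zeroˡ k)) (sym (ℚₚ.*-zeroˡ k))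

perms-pick-const : ∀ n w → w ↭ down n → ∀ k → ∑ (perms n) (λ z → ⟦ eqList z w ⟧ *ℚ k) ≡ k
perms-pick-const zero w r k with ↭ₚ.↭-length r
perms-pick-const zero [] r k | _ = trans (ℚₚ.+-identityʳ _) (ℚₚ.*-identityˡ k)
perms-pick-const (suc n) w r k with ∈-∃++ (↭ₚ.∈-resp-↭ (↭-sym r) (here refl))
... | a , b , refl = trans (∑-concatMap (insertions (suc n)) (perms n)) (trans
  (∑-cong-All (perms-↭ n) (λ z s → insertions-count (suc n) z a b (not-in s) (λ m∈ → not-in r′ (∈-++⁺ˡ m∈)) k))
  (perms-pick-const n (a ++ b) r′ k))
  where
  r′ : a ++ b ↭ down n
  r′ = ↭ₚ.drop-mid a [] r
  not-in : ∀ {z} → z ↭ down n → suc n ∉ z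
  not-in s m∈ = ℕₚ.<-irrefl refl (proj₂ (All.lookup (down-range n) (↭ₚ.∈-resp-↭ s m∈)))

δ-absorb : ∀ {B : Set} {eq : B → B → Bool} → IsEq eq → ∀ (f : B → ℚ) z w → ⟦ eq z w ⟧ *ℚ f z ≡ ⟦ eq z w ⟧ *ℚ f w
δ-absorb {eq = eq} E f z w with bool? (eq z w)
... | inj₁ e rewrite IsEq.sound E e = refl
... | inj₂ e rewrite e = trans (ℚₚ.*-zeroˡ (f z)) (sym (ℚₚ.*-zeroˡ (f w)))

weakPoset : FinPoset Perm
weakPoset = record
  { eq = eqList ; leq = leqW ; elems = perms ; sz = length ; rk = inversionCount ; V = IsPermutation
  ; isEq = eqList-isEq
  ; leq-refl = λ x → ⊑⇒leqW x x ⊑-refl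
  ; leq-trans = λ {x} {y} {z} p q → ⊑⇒leqW x z (⊑-trans (leqW⇒⊑ x y p) (leqW⇒⊑ y z q))
  ; leq-sz = λ {x} {y} p → ⊑-length (leqW⇒⊑ x y p)
  ; leq-rk = λ {x} {y} Vx Vy p x≢y → ℕₚ.≰⇒> λ le →
      x≢y (⊑-antisym (same Vx Vy (⊑-length (leqW⇒⊑ x y p))) (leqW⇒⊑ x y p) (⊑-reverse (leqW⇒⊑ x y p) le))
  ; rk-bound = inversionCount-bound
  ; elems-V = perms-IsPermutation
  ; pick = λ {x} Vx f → trans (∑-cong (perms (length x)) (λ z → δ-absorb eqList-isEq f z x))
                                (perms-pick-const (length x) x Vx (f x))
  }
  where
  same : ∀ {x y} → IsPermutation x → IsPermutation y → length x ≡ length y → x ↭ y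
  same Vx Vy e = ↭-trans Vx (↭-trans (↭-reflexive (cong down e)) (↭-sym Vy))

-- Standardization, and the product of permutations in shifted blocks

MaxSplit : List ℕ → Set
MaxSplit w = ∃₂ λ a m → ∃ λ b → w ≡ a ++ m ∷ b × All (_< m) a × All (_< m) b

maxSplit : ∀ x xs → Unique (x ∷ xs) → MaxSplit (x ∷ xs)
maxSplit x []       u = [] , x , [] , refl , [] , []
maxSplit x (y ∷ ys) ((x≢y ∷ x∉) ∷ u) with maxSplit y ys u
... | a , m , b , e , p , q with ℕₚ.<-cmp x m
... | tri< x<m _ _ = x ∷ a , m , b , cong (x ∷_) e , x<m ∷ p , q
... | tri> _ _ m<x = [] , x , y ∷ ys , refl , [] , subst (All (_< x)) (sym e)
                       (Allₚ.++⁺ (All.map (λ z<m → ℕₚ.<-trans z<m m<x) p) (m<x ∷ All.map (λ z<m → ℕₚ.<-trans z<m m<x) q))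
... | tri≈ _ refl _ = contradiction refl (All.lookup (subst (All (x ≢_)) e (x≢y ∷ x∉)) (∈-++⁺ʳ a (here refl)))

-- st w is definitionally map (rankIn w) w.
rankIn : List ℕ → ℕ → ℕ
rankIn w x = countB (λ y → y ≤ᵇ x) w

rankIn-monotone : ∀ w → Monotone-on w (rankIn w)
rankIn-monotone w {x} {y} x∈ y∈ x<y = countB-strict (_≤ᵇ x) (_≤ᵇ y) w
  (λ {z} _ e → true-≤ᵇ {z} (ℕₚ.≤-trans (≤ᵇ-true {z} e) (ℕₚ.<⇒≤ x<y))) y∈
  (≢true⇒false (λ e → ℕₚ.<⇒≱ x<y (≤ᵇ-true {y} e))) (true-≤ᵇ {y} ℕₚ.≤-refl)

rankIn-reflecting : ∀ w → Reflecting-on w (rankIn w)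
rankIn-reflecting w {x} {y} x∈ y∈ lt = ℕₚ.≰⇒> λ y≤x → ℕₚ.<⇒≱ lt
  (countB-mono (_≤ᵇ y) (_≤ᵇ x) w (λ {z} _ e → true-≤ᵇ {z} (ℕₚ.≤-trans (≤ᵇ-true {z} e) y≤x)))

private
  Unique-remove : ∀ a {m : ℕ} {b} → Unique (a ++ m ∷ b) → Unique (a ++ b)
  Unique-remove []      (_ ∷ u) = u
  Unique-remove (x ∷ a) (p ∷ u) = Allₚ.++⁺ (Allₚ.++⁻ˡ a p) (All.tail (Allₚ.++⁻ʳ a p)) ∷ Unique-remove a u

  -- The largest letter `m` has rank equal to the length of the word, and removing it leaves all
  -- other ranks unchanged. The remaining word `a ++ b` is not a structural part of `w`, hence the
  -- induction on a length bound.
  st-↭-bounded : ∀ n w → length w ≤ n → Unique w → st w ↭ down (length w)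
  st-↭-bounded n       []       _  u = ↭-refl
  st-↭-bounded (suc n) (x ∷ xs) le u with maxSplit x xs u
  ... | a , m , b , e , p , q = subst (λ w → st w ↭ down (length w)) (sym e) goal
    where
    w′ = a ++ b
    perm : a ++ m ∷ b ↭ m ∷ w′
    perm = ↭ₚ.shift m a b
    len : length (a ++ m ∷ b) ≡ suc (length w′)
    len = ↭ₚ.↭-length perm
    le′ : length w′ ≤ n
    le′ = ℕₚ.≤-pred (ℕₚ.≤-trans (ℕₚ.≤-reflexive (trans (sym len) (cong length (sym e)))) le)
    below : ∀ {z} → z ∈ w′ → z < m
    below = All.lookup (Allₚ.++⁺ p q)
    top : rankIn (a ++ m ∷ b) m ≡ suc (length w′)
    top = trans (countB-all _ (a ++ m ∷ b) (λ z∈ → true-≤ᵇ (All.lookup {P = _≤ m}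
            (Allₚ.++⁺ (All.map ℕₚ.<⇒≤ p) (ℕₚ.≤-refl ∷ All.map ℕₚ.<⇒≤ q)) z∈))) len
    other : ∀ {z} → z ∈ w′ → rankIn (a ++ m ∷ b) z ≡ rankIn w′ z
    other {z} z∈ = trans (countB-↭ (_≤ᵇ z) perm) drop-m
      where
      drop-m : countB (_≤ᵇ z) (m ∷ w′) ≡ countB (_≤ᵇ z) w′
      drop-m rewrite ≢true⇒false {m ≤ᵇ z} (λ h → ℕₚ.<⇒≱ (below z∈) (≤ᵇ-true h)) = refl
    goal : st (a ++ m ∷ b) ↭ down (length (a ++ m ∷ b))
    goal = ↭-trans (↭ₚ.map⁺ (rankIn (a ++ m ∷ b)) perm) (subst (λ l → map (rankIn (a ++ m ∷ b)) (m ∷ w′) ↭ down l) (sym len)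
      (subst (λ t → t ∷ map (rankIn (a ++ m ∷ b)) w′ ↭ suc (length w′) ∷ down (length w′)) (sym top)
        (↭-prep (suc (length w′)) (subst (_↭ down (length w′)) (sym (map-cong-local (All.tabulate other)))
          (st-↭-bounded n w′ le′ (Unique-remove a (subst Unique e u)))))))

st-↭ : ∀ w → Unique w → st w ↭ down (length w)
st-↭ w = st-↭-bounded (length w) w ℕₚ.≤-refl

st-IsPermutation : ∀ {w} → Unique w → IsPermutation (st w)
st-IsPermutation {w} u = ↭down⇒IsPermutation (st-↭ w u)

st-⊑⁺ : ∀ {w ρ} → w ⊑ ρ → st w ⊑ ρ
st-⊑⁺ {w} = ⊑-mapˡ⁺ (rankIn-reflecting w)

st-⊑⁻ : ∀ {w ρ} → st w ⊑ ρ → w ⊑ ρ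
st-⊑⁻ {w} = ⊑-mapˡ⁻ (rankIn-monotone w)

map-+-down : ∀ p q → map (_+ q) (down p) ++ down q ≡ down (p + q)
map-+-down zero    q = refl
map-+-down (suc p) q = cong (suc (p + q) ∷_) (map-+-down p q)

length-∖P : ∀ ρ π → length (ρ ∖P π) ≡ length ρ + length π
length-∖P ρ π = trans (length-++ (map (_+ length π) ρ)) (cong (_+ length π) (length-map (_+ length π) ρ))

∖P-↭ : ∀ {ρ π} → IsPermutation ρ → IsPermutation π → ρ ∖P π ↭ down (length ρ + length π)
∖P-↭ {ρ} {π} r s = ↭-trans (↭ₚ.++⁺ (↭ₚ.map⁺ (_+ length π) r) s) (↭-reflexive (map-+-down (length ρ) (length π)))

∖P-IsPermutation : ∀ {ρ π} → IsPermutation ρ → IsPermutation π → IsPermutation (ρ ∖P π)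
∖P-IsPermutation r s = ↭down⇒IsPermutation (∖P-↭ r s)

∨P-IsPermutation : ∀ {ρ π} → IsPermutation ρ → IsPermutation π → IsPermutation (ρ ∨P π)
∨P-IsPermutation {ρ} {π} r s = ↭down⇒IsPermutation {suc (length ρ + length π)} (↭-trans
  (↭ₚ.shift (length ρ + length π + 1) (map (_+ length π) ρ) π)
  (subst (λ t → t ∷ ρ ∖P π ↭ suc (length ρ + length π) ∷ down (length ρ + length π)) (ℕₚ.+-comm 1 (length ρ + length π))
    (↭-prep (suc (length ρ + length π)) (∖P-↭ r s))))

-- All cross pairs of ρ ∖P π are inversions.
⊑-∖P⁺ : ∀ {ρ π a b} → IsPermutation ρ → IsPermutation π → a ⊑ ρ → b ⊑ π → a ++ b ⊑ ρ ∖P π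
⊑-∖P⁺ {ρ} {π} {a} {b} Vρ Vπ p q = ⊑-++⁺ (⊑-shift⁺ (length π) p) q (Pointwise-At (⊑-length (⊑-shift⁺ (length π) p))
  (λ i x∈ y∈ → Pointwise-At (⊑-length q) (λ j _ y′∈ _ → cross (At-∈ y∈) (At-∈ y′∈))))
  where
  cross : ∀ {y y′} → y ∈ map (_+ length π) ρ → y′ ∈ π → y′ < y
  cross y∈ y′∈ = ℕₚ.≤-<-trans (proj₂ (All.lookup (perm-range Vπ) y′∈))
    (All.lookup {P = length π <_} (Allₚ.map⁺ (All.map (λ (0<x , _) → ℕₚ.+-monoˡ-≤ (length π) 0<x) (perm-range Vρ))) y∈)

⊑-∖P⁻ : ∀ {ρ π σ} → σ ⊑ ρ ∖P π → ∃₂ λ a b → σ ≡ a ++ b × a ⊑ ρ × b ⊑ π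
⊑-∖P⁻ {ρ} {π} p with ⊑-++⁻ (map (_+ length π) ρ) p
... | a , b , e , q , s , _ = a , b , e , ⊑-shift⁻ (length π) q , s

-- The Tamari order

data Rot : Tree → Tree → Set where
  root  : ∀ {a b c} → Rot ((a ∨T b) ∨T c) (a ∨T (b ∨T c))
  left  : ∀ {l l′ r} → Rot l l′ → Rot (l ∨T r) (l′ ∨T r)
  right : ∀ {l r r′} → Rot r r′ → Rot (l ∨T r) (l ∨T r′)

∈-rots⁻ : ∀ t {u} → u ∈ rots t → Rot t u
∈-rots⁻ (l ∨T r) u∈ with ∈-++⁻ (rootRot l r) u∈
∈-rots⁻ ((a ∨T b) ∨T r) u∈ | inj₁ (here refl) = root
... | inj₂ v with ∈-++⁻ (map (_∨T r) (rots l)) v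
... | inj₁ p with ∈-map⁻ _ p
...   | l′ , l′∈ , refl = left (∈-rots⁻ l l′∈)
∈-rots⁻ (l ∨T r) u∈ | inj₂ v | inj₂ p with ∈-map⁻ _ p
...   | r′ , r′∈ , refl = right (∈-rots⁻ r r′∈)

∈-rots⁺ : ∀ {t u} → Rot t u → u ∈ rots t
∈-rots⁺ root                   = here refl
∈-rots⁺ (left {l} {l′} {r} p)  = ∈-++⁺ʳ (rootRot l r) (∈-++⁺ˡ (∈-map⁺ (_∨T r) (∈-rots⁺ p)))
∈-rots⁺ (right {l} {r} {r′} p) = ∈-++⁺ʳ (rootRot l r) (∈-++⁺ʳ (map (_∨T r) (rots l)) (∈-map⁺ (l ∨T_) (∈-rots⁺ p)))

infix 4 _⟶*_
_⟶*_ : Tree → Tree → Set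
_⟶*_ = Star Rot

∨T-⟶* : ∀ {l l′ r r′} → l ⟶* l′ → r ⟶* r′ → (l ∨T r) ⟶* (l′ ∨T r′)
∨T-⟶* {l} {l′} {r} p q = gmap (_∨T r) left p ◅◅ gmap (l′ ∨T_) right q

Rot-size : ∀ {t u} → Rot t u → size t ≡ size u
Rot-size (root {a} {b} {c}) = cong suc (trans (cong suc (ℕₚ.+-assoc (size a) (size b) (size c))) (sym (ℕₚ.+-suc (size a) (size b + size c))))
Rot-size (left {r = r} p)   = cong (λ n → suc (n + size r)) (Rot-size p)
Rot-size (right {l} p)      = cong (λ n → suc (size l + n)) (Rot-size p)

⟶*-size : ∀ {t s} → t ⟶* s → size t ≡ size s
⟶*-size ε       = refl
⟶*-size (p ◅ q) = trans (Rot-size p) (⟶*-size q)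

-- The sum of the sizes of the right subtrees over all nodes. Rotating `(a ∨T b) ∨T c` raises it by
-- `size c + 1`, so it serves as a strict rank for the Tamari order.
rightWeight : Tree → ℕ
rightWeight leaf     = 0
rightWeight (l ∨T r) = size r + (rightWeight l + rightWeight r)

Rot-weight : ∀ {t u} → Rot t u → rightWeight t < rightWeight u
Rot-weight (root {a} {b} {c}) = ℕₚ.≤-trans (ℕₚ.m≤m+n _ (size c)) (ℕₚ.≤-reflexive
  (lem (size b) (size c) (rightWeight a) (rightWeight b) (rightWeight c)))
  where
  lem : ∀ b c x y z → suc (c + ((b + (x + y)) + z)) + c ≡ suc (b + c) + (x + (c + (y + z)))
  lem = solve-∀
Rot-weight (left {r = r} p) = ℕₚ.+-monoʳ-< (size r) (ℕₚ.+-monoˡ-< (rightWeight r) (Rot-weight p))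
Rot-weight (right {l} {r} {r′} p) = ℕₚ.+-mono-≤-< (ℕₚ.≤-reflexive (Rot-size p)) (ℕₚ.+-monoʳ-< (rightWeight l) (Rot-weight p))

⟶*-weight : ∀ {t s} → t ⟶* s → t ≡ s ⊎ rightWeight t < rightWeight s
⟶*-weight ε = inj₁ refl
⟶*-weight (p ◅ q) with ⟶*-weight q
... | inj₁ refl = inj₂ (Rot-weight p)
... | inj₂ lt   = inj₂ (ℕₚ.<-trans (Rot-weight p) lt)

⟶*-weight-≤ : ∀ {t s} → t ⟶* s → rightWeight t ≤ rightWeight s
⟶*-weight-≤ p with ⟶*-weight p
... | inj₁ refl = ℕₚ.≤-refl
... | inj₂ lt   = ℕₚ.<⇒≤ lt

⟶*-antisym : ∀ {t s} → t ⟶* s → s ⟶* t → t ≡ s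
⟶*-antisym p q with ⟶*-weight p
... | inj₁ e  = e
... | inj₂ lt = contradiction (⟶*-weight-≤ q) (ℕₚ.<⇒≱ lt)

rightWeight-bound : ∀ t → rightWeight t ≤ size t * size t
rightWeight-bound leaf     = z≤n
rightWeight-bound (l ∨T r) = ℕₚ.≤-trans
  (ℕₚ.+-monoʳ-≤ (size r) (ℕₚ.+-mono-≤ (rightWeight-bound l) (rightWeight-bound r)))
  -- The added summand is what remains of (l + r + 1)² after subtracting r + l² + r².
  (ℕₚ.≤-trans (ℕₚ.m≤m+n _ (suc (size l + size l + size r + (size l * size r + size l * size r))))
    (ℕₚ.≤-reflexive (lem (size l) (size r))))
  where
  lem : ∀ l r → (r + (l * l + r * r)) + suc (l + l + r + (l * r + l * r)) ≡ suc (l + r) * suc (l + r)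
  lem = solve-∀

eqT-isEq : IsEq eqT
eqT-isEq = record { sound = snd ; reflexive = rfl }
  where
  snd : ∀ {x y} → eqT x y ≡ true → x ≡ y
  snd {leaf} {leaf} _ = refl
  snd {a ∨T b} {c ∨T d} e with ∧-true {eqT a c} e
  ... | e₁ , e₂ = cong₂ _∨T_ (snd e₁) (snd e₂)
  rfl : ∀ x → eqT x x ≡ true
  rfl leaf     = refl
  rfl (a ∨T b) = true-∧ (rfl a) (rfl b)

reachB⇒⟶* : ∀ k t s → reachB k t s ≡ true → t ⟶* s
reachB⇒⟶* zero    t s e rewrite IsEq.sound eqT-isEq {t} {s} e = ε
reachB⇒⟶* (suc k) t s e with bool? (eqT t s)
... | inj₁ e′ rewrite IsEq.sound eqT-isEq {t} {s} e′ = ε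
... | inj₂ e′ rewrite e′ with any-true (rots t) e
... | u , u∈ , h = ∈-rots⁻ t u∈ ◅ reachB⇒⟶* k u s h

-- Every rotation consumes one unit of search depth and raises the weight by at least one, so the
-- difference of the weights is a sufficient depth.
⟶*⇒reachB : ∀ k {t s} → t ⟶* s → rightWeight s ≤ k + rightWeight t → reachB k t s ≡ true
⟶*⇒reachB zero    {t} ε _ = IsEq.reflexive eqT-isEq t
⟶*⇒reachB (suc k) {t} ε _ rewrite IsEq.reflexive eqT-isEq t = refl
⟶*⇒reachB zero    (p ◅ q) le = contradiction (ℕₚ.≤-trans (Rot-weight p) (⟶*-weight-≤ q)) (ℕₚ.≤⇒≯ le)
⟶*⇒reachB (suc k) {t} {s} (_◅_ {j = u} p q) le = trans
  (cong (eqT t s ∨_) (true-any (rots t) (∈-rots⁺ p) (⟶*⇒reachB k q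
    (ℕₚ.≤-trans le (ℕₚ.≤-trans (ℕₚ.≤-reflexive (sym (ℕₚ.+-suc k (rightWeight t)))) (ℕₚ.+-monoʳ-≤ k (Rot-weight p)))))))
  (∨-zeroʳ (eqT t s))

leqT⇒⟶* : ∀ {t s} → leqT t s ≡ true → t ⟶* s
leqT⇒⟶* {t} {s} = reachB⇒⟶* (size t * size t) t s

⟶*⇒leqT : ∀ {t s} → t ⟶* s → leqT t s ≡ true
⟶*⇒leqT {t} {s} p = ⟶*⇒reachB (size t * size t) p
  (ℕₚ.≤-trans (rightWeight-bound s) (ℕₚ.≤-trans (ℕₚ.≤-reflexive (cong (λ n → n * n) (sym (⟶*-size p)))) (ℕₚ.m≤m+n _ _)))

treesDepth-pick : ∀ j x → size x ≤ j → ∀ k → ∑ (treesDepth j) (λ z → ⟦ eqT z x ⟧ *ℚ k) ≡ k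
treesDepth-pick zero    leaf _ k = trans (ℚₚ.+-identityʳ _) (ℚₚ.*-identityˡ k)
treesDepth-pick (suc j) leaf _ k = trans (cong₂ _+ℚ_ (ℚₚ.*-identityˡ k)
  (trans (∑-concatMap _ (treesDepth j)) (∑-zero (treesDepth j) (λ l →
    trans (∑-map (l ∨T_) (treesDepth j)) (∑-zero (treesDepth j) (λ _ → ℚₚ.*-zeroˡ k))))))
  (ℚₚ.+-identityʳ k)
treesDepth-pick (suc j) (l ∨T r) (s≤s le) k = trans (cong₂ _+ℚ_ (ℚₚ.*-zeroˡ k)
  (trans (∑-concatMap _ (treesDepth j)) (trans (∑-cong (treesDepth j) inner)
    (treesDepth-pick j l (ℕₚ.≤-trans (ℕₚ.m≤m+n _ _) le) k))))
  (ℚₚ.+-identityˡ k)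
  where
  inner : ∀ l′ → ∑ (map (l′ ∨T_) (treesDepth j)) (λ z → ⟦ eqT z (l ∨T r) ⟧ *ℚ k) ≡ ⟦ eqT l′ l ⟧ *ℚ k
  inner l′ = trans (∑-map (l′ ∨T_) (treesDepth j)) (trans
    (∑-cong (treesDepth j) (λ r′ → trans (cong (_*ℚ k) (⟦∧⟧ (eqT l′ l) (eqT r′ r))) (ℚₚ.*-assoc ⟦ eqT l′ l ⟧ ⟦ eqT r′ r ⟧ k)))
    (trans (∑-*ˡ (treesDepth j) ⟦ eqT l′ l ⟧) (cong (⟦ eqT l′ l ⟧ *ℚ_)
      (treesDepth-pick j r (ℕₚ.≤-trans (ℕₚ.m≤n+m _ (size l)) le) k))))

trees-pick : ∀ x k → ∑ (trees (size x)) (λ z → ⟦ eqT z x ⟧ *ℚ k) ≡ k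
trees-pick x k = trans (∑-filter (λ t → size t ≡ᵇ size x) (treesDepth (size x))) (trans
  (∑-cong (treesDepth (size x)) drop-size) (treesDepth-pick (size x) x ℕₚ.≤-refl k))
  where
  drop-size : ∀ z → ⟦ size z ≡ᵇ size x ⟧ *ℚ (⟦ eqT z x ⟧ *ℚ k) ≡ ⟦ eqT z x ⟧ *ℚ k
  drop-size z with bool? (eqT z x)
  ... | inj₁ e rewrite IsEq.sound eqT-isEq {z} {x} e | true-≡ᵇ {size x} refl = ℚₚ.*-identityˡ _
  ... | inj₂ e rewrite e | ℚₚ.*-zeroˡ k = ℚₚ.*-zeroʳ ⟦ size z ≡ᵇ size x ⟧

tamariPoset : FinPoset Tree
tamariPoset = record
  { eq = eqT ; leq = leqT ; elems = trees ; sz = size ; rk = rightWeight ; V = λ _ → ⊤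
  ; isEq = eqT-isEq
  ; leq-refl = λ x → ⟶*⇒leqT {x} ε
  ; leq-trans = λ {x} {y} {z} p q → ⟶*⇒leqT {x} (leqT⇒⟶* {x} {y} p ◅◅ leqT⇒⟶* {y} q)
  ; leq-sz = λ p → ⟶*-size (leqT⇒⟶* p)
  ; leq-rk = λ {x} {y} _ _ p x≢y → strict x≢y (⟶*-weight (leqT⇒⟶* p))
  ; rk-bound = rightWeight-bound
  ; elems-V = λ n → All.tabulate (λ _ → tt)
  ; pick = λ {x} _ f → trans (∑-cong (trees (size x)) (λ z → δ-absorb eqT-isEq f z x)) (trees-pick x (f x))
  }
  where
  strict : ∀ {x y} → x ≢ y → x ≡ y ⊎ rightWeight x < rightWeight y → rightWeight x < rightWeight y
  strict x≢y (inj₁ e)  = contradiction e x≢y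
  strict x≢y (inj₂ lt) = lt

-- Words below a tree, and decreasing trees

infix 4 _◁_ _⊳_

-- w ◁ t says w ⊑ γ t, and w ⊳ t says that t is the decreasing tree of w.
data _◁_ : List ℕ → Tree → Set where
  leaf : [] ◁ leaf
  node : ∀ {a m b l r} → All (_≤ m) a → a ◁ l → b ◁ r → a ++ m ∷ b ◁ (l ∨T r)

data _⊳_ : List ℕ → Tree → Set where
  leaf : [] ⊳ leaf
  node : ∀ {a m b l r} → All (_< m) a → All (_< m) b → a ⊳ l → b ⊳ r → a ++ m ∷ b ⊳ (l ∨T r)

⊳⇒◁ : ∀ {w t} → w ⊳ t → w ◁ t
⊳⇒◁ leaf           = leaf
⊳⇒◁ (node p _ d e) = node (All.map ℕₚ.<⇒≤ p) (⊳⇒◁ d) (⊳⇒◁ e)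

◁-length : ∀ {w t} → w ◁ t → length w ≡ size t
◁-length leaf = refl
◁-length (node {a} {m} {b} _ d e) = trans (length-++ a) (trans (ℕₚ.+-suc (length a) (length b))
  (cong suc (cong₂ _+_ (◁-length d) (◁-length e))))

-- A rotation only weakens the conditions on letters: before it, `n` bounds `a`, `m` and `b`; after
-- it, `n` has to bound `b` alone.
◁-Rot : ∀ {w t u} → Rot t u → w ◁ t → w ◁ u
◁-Rot root (node {m = n} {b = c} p (node {a} {m} {b} q d e) f) = subst (_◁ _) (sym (++-assoc a (m ∷ b) (n ∷ c)))
  (node q d (node (All.tail (Allₚ.++⁻ʳ a p)) e f))
◁-Rot (left r)  (node p d e) = node p (◁-Rot r d) e
◁-Rot (right r) (node p d e) = node p d (◁-Rot r e)

◁-⟶* : ∀ {w t s} → t ⟶* s → w ◁ t → w ◁ s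
◁-⟶* ε       d = d
◁-⟶* (p ◅ q) d = ◁-⟶* q (◁-Rot p d)

++-compare : ∀ (a′ a : List ℕ) {M m b′ b} → a′ ++ M ∷ b′ ≡ a ++ m ∷ b →
  (a′ ≡ a × M ≡ m × b′ ≡ b)
  ⊎ (∃ λ y → a′ ≡ a ++ m ∷ y × b ≡ y ++ M ∷ b′)
  ⊎ (∃ λ y → a ≡ a′ ++ M ∷ y × b′ ≡ y ++ m ∷ b)
++-compare []       []      refl = inj₁ (refl , refl , refl)
++-compare []       (x ∷ a) refl = inj₂ (inj₂ (a , refl , refl))
++-compare (x ∷ a′) []      refl = inj₂ (inj₁ (a′ , refl , refl))
++-compare (x ∷ a′) (y ∷ a) e with ∷-injective e
... | refl , e′ with ++-compare a′ a e′
... | inj₁ (refl , p , q)        = inj₁ (refl , p , q)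
... | inj₂ (inj₁ (z , refl , q)) = inj₂ (inj₁ (z , refl , q))
... | inj₂ (inj₂ (z , refl , q)) = inj₂ (inj₂ (z , refl , q))

-- A left-to-right maximum of w labels a node on the left spine of its decreasing tree,
-- which rotations move to the root.
⊳-split : ∀ {w t} → w ⊳ t → ∀ a m b → w ≡ a ++ m ∷ b → All (_≤ m) a →
          ∃₂ λ l r → a ⊳ l × b ⊳ r × t ⟶* (l ∨T r)
⊳-split leaf []      m b () _
⊳-split leaf (x ∷ a) m b () _
⊳-split (node {a′} {M} {b′} {l} {r} p q d e) a m b eq a≤m with ++-compare a′ a eq
... | inj₁ (refl , refl , refl) = l , r , d , e , ε
... | inj₂ (inj₂ (y , refl , refl)) =
  contradiction (All.lookup a≤m (∈-++⁺ʳ a′ (here refl))) (ℕₚ.<⇒≱ (All.lookup q (∈-++⁺ʳ y (here refl))))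
... | inj₂ (inj₁ (y , refl , refl)) with ⊳-split d a m y refl a≤m
... | l′ , r′ , d₁ , d₂ , s = l′ , r′ ∨T r , d₁ , node (All.tail (Allₚ.++⁻ʳ a p)) q d₂ e ,
  ∨T-⟶* s ε ◅◅ root ◅ ε

-- The root of `s` cuts `w` at a letter that is at least all letters before it; `⊳-split` rotates
-- the matching node of `t` to the root, and both sides recurse. Together with `◁-⟶*`, this makes
-- the trees `s` with `w ◁ s` the principal up-set generated by the decreasing tree of `w`.
⊳◁⇒⟶* : ∀ {w t s} → w ⊳ t → w ◁ s → t ⟶* s
⊳◁⇒⟶* {t = leaf} _ leaf = ε
⊳◁⇒⟶* {t = l ∨T r} d leaf with () ← trans (sym (◁-length (⊳⇒◁ d))) refl
⊳◁⇒⟶* d (node {a} {m} {b} p e f) with ⊳-split d a m b refl p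
... | l , r , d₁ , d₂ , s = s ◅◅ ∨T-⟶* (⊳◁⇒⟶* d₁ e) (⊳◁⇒⟶* d₂ f)

⊳-functional : ∀ {w t s} → w ⊳ t → w ⊳ s → t ≡ s
⊳-functional d e = ⟶*-antisym (⊳◁⇒⟶* d (⊳⇒◁ e)) (⊳◁⇒⟶* e (⊳⇒◁ d))

⊳-leqT⇒◁ : ∀ {w t s} → w ⊳ t → leqT t s ≡ true → w ◁ s
⊳-leqT⇒◁ d e = ◁-⟶* (leqT⇒⟶* e) (⊳⇒◁ d)

⊳-◁⇒leqT : ∀ {w t s} → w ⊳ t → w ◁ s → leqT t s ≡ true
⊳-◁⇒leqT d e = ⟶*⇒leqT (⊳◁⇒⟶* d e)

⊳-shift : ∀ k {w t} → w ⊳ t → map (_+ k) w ⊳ t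
⊳-shift k leaf = leaf
⊳-shift k (node {a} {m} {b} p q d e) = subst (_⊳ _) (sym (map-++ (_+ k) a (m ∷ b)))
  (node (Allₚ.map⁺ (All.map (ℕₚ.+-monoˡ-< k) p)) (Allₚ.map⁺ (All.map (ℕₚ.+-monoˡ-< k) q)) (⊳-shift k d) (⊳-shift k e))

γ-IsPermutation : ∀ t → IsPermutation (γ t)
γ-IsPermutation leaf     = ↭-refl
γ-IsPermutation (l ∨T r) = ∨P-IsPermutation (γ-IsPermutation l) (γ-IsPermutation r)

topLetter : List ℕ → List ℕ → ℕ
topLetter ρ π = length ρ + length π + 1

top-left : ∀ {ρ π} → IsPermutation ρ → All (_< topLetter ρ π) (map (_+ length π) ρ)
top-left {ρ} {π} Vρ = Allₚ.map⁺ (All.map (λ (_ , x≤) → ℕₚ.≤-trans (s≤s (ℕₚ.+-monoˡ-≤ (length π) x≤)) (ℕₚ.≤-reflexive (ℕₚ.+-comm 1 _))) (perm-range Vρ))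

top-right : ∀ {ρ π} → IsPermutation π → All (_< topLetter ρ π) π
top-right {ρ} {π} Vπ = All.map (λ (_ , x≤) → ℕₚ.≤-trans (s≤s (ℕₚ.≤-trans x≤ (ℕₚ.m≤n+m _ (length ρ)))) (ℕₚ.≤-reflexive (ℕₚ.+-comm 1 _))) (perm-range Vπ)

shifted-above : ∀ {ρ} (π : List ℕ) → IsPermutation ρ → All (length π <_) (map (_+ length π) ρ)
shifted-above {ρ} π Vρ = Allₚ.map⁺ (All.map (λ (0<x , _) → ℕₚ.+-monoˡ-≤ (length π) 0<x) (perm-range {ρ} Vρ))

γ-⊳ : ∀ t → γ t ⊳ t
γ-⊳ leaf     = leaf
γ-⊳ (l ∨T r) = node (top-left {π = γ r} (γ-IsPermutation l)) (top-right {ρ = γ l} (γ-IsPermutation r)) (⊳-shift (length (γ r)) (γ-⊳ l)) (γ-⊳ r)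

length-γ : ∀ t → length (γ t) ≡ size t
length-γ t = ◁-length (⊳⇒◁ (γ-⊳ t))

-- In `γ (l ∨T r)` all letters of the left block exceed those of `γ r`, and the top letter exceeds
-- those to its right, so these pairs are inversions and impose nothing on `w`. The left letters
-- form no inversion with the top letter, which is the condition `All (_≤ m) a`.
◁⇒⊑γ : ∀ {w t} → w ◁ t → w ⊑ γ t
◁⇒⊑γ leaf = []
◁⇒⊑γ {t = l ∨T r} (node {a} {m} {b} p d e) = ⊑-++⁺ left-part (right-Pw ∷ ◁⇒⊑γ e) (cross left-part p (shifted-above {γ l} (γ r) (γ-IsPermutation l)))
  where
  left-part : a ⊑ map (_+ length (γ r)) (γ l)
  left-part = ⊑-shift⁺ (length (γ r)) (◁⇒⊑γ d)
  right-Pw : Pointwise (λ x y → x < m → y < topLetter (γ l) (γ r)) b (γ r)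
  right-Pw = Pointwise-At (⊑-length (◁⇒⊑γ e)) (λ i _ y∈ _ → All.lookup (top-right {ρ = γ l} (γ-IsPermutation r)) (At-∈ y∈))
  cross : ∀ {a c N} → a ⊑ c → All (_≤ m) a → All (length (γ r) <_) c → Cross a c (m ∷ b) (N ∷ γ r)
  cross [] [] [] = []
  cross (_ ∷ s) (x≤m ∷ ps) (y> ∷ qs) =
    ((λ m<x → contradiction x≤m (ℕₚ.<⇒≱ m<x))
      ∷ Pointwise-At (⊑-length (◁⇒⊑γ e)) (λ i _ z∈ _ → ℕₚ.≤-<-trans (proj₂ (All.lookup (perm-range (γ-IsPermutation r)) (At-∈ z∈))) y>))
    ∷ cross s ps qs

⊑γ⇒◁ : ∀ t {w} → w ⊑ γ t → w ◁ t
⊑γ⇒◁ leaf     [] = leaf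
⊑γ⇒◁ (l ∨T r) p with ⊑-++⁻ (map (_+ length (γ r)) (γ l)) p
... | a , m ∷ b , refl , q , (_ ∷ s) , c =
  node (a≤m c (top-left {π = γ r} (γ-IsPermutation l))) (⊑γ⇒◁ l (⊑-shift⁻ (length (γ r)) q)) (⊑γ⇒◁ r s)
  where
  a≤m : ∀ {a c N} → Cross a c (m ∷ b) (N ∷ γ r) → All (_< N) c → All (_≤ m) a
  a≤m [] [] = []
  a≤m ((h ∷ _) ∷ cs) (y<N ∷ ps) = ℕₚ.≮⇒≥ (λ m<x → ℕₚ.<-asym y<N (h m<x)) ∷ a≤m cs ps

splitAt-found : ∀ N a b → N ∉ a → splitAt N (a ++ N ∷ b) ≡ (a , b)
splitAt-found N []      b h rewrite true-≡ᵇ {N} refl = refl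
splitAt-found N (x ∷ a) b h rewrite ≢true⇒false {x ≡ᵇ N} (λ e → h (here (sym (≡ᵇ-true e)))) | splitAt-found N a b (h ∘ there) = refl

lamF-step : ∀ k N a b → length (a ++ N ∷ b) ≡ N → N ∉ a → lamF (suc k) (a ++ N ∷ b) ≡ lamF k (st a) ∨T lamF k (st b)
lamF-step k N a b len h = trans (unfold (a ++ N ∷ b) (nonempty a)) (trans
  (cong (λ n → node-at (splitAt n (a ++ N ∷ b))) len) (cong node-at (splitAt-found N a b h)))
  where
  node-at : List ℕ × List ℕ → Tree
  node-at p = lamF k (st (proj₁ p)) ∨T lamF k (st (proj₂ p))
  nonempty : ∀ a → a ++ N ∷ b ≢ []
  nonempty []      ()
  nonempty (x ∷ a) ()
  unfold : ∀ w → w ≢ [] → lamF (suc k) w ≡ node-at (splitAt (length w) w)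
  unfold []      ne = contradiction refl ne
  unfold (x ∷ w) ne = refl

-- Generalised over a relabelling f of w so that the standardizations performed by lamF can be absorbed into f.
⊳-lamF : ∀ k w f → Reflecting-on w f → map f w ↭ down (length w) → length w ≤ k → w ⊳ lamF k (map f w)
⊳-lamF zero    []       f mono perm le = leaf
⊳-lamF (suc k) []       f mono perm le = leaf
-- The relabelled word contains its length as a letter, and `lamF` splits there. The preimage `m` of
-- that letter is the maximum of the original word because `f` reflects the order.
⊳-lamF (suc k) (x ∷ xs) f mono perm (s≤s le) with ∈-map⁻ f {xs = x ∷ xs} (↭ₚ.∈-resp-↭ (↭-sym perm) (here refl))
... | m , m∈ , N≡fm with ∈-∃++ m∈
... | a , b , e = goal
  where
  n = length xs
  N = suc n
  map-f : map f (x ∷ xs) ≡ map f a ++ N ∷ map f b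
  map-f = trans (cong (map f) e) (trans (map-++ f a (m ∷ b)) (cong (λ z → map f a ++ z ∷ map f b) (sym N≡fm)))
  rest : map f a ++ map f b ↭ down n
  rest = ↭ₚ.drop-mid (map f a) [] (subst (_↭ down N) map-f perm)
  small : All (_< N) (map f a ++ map f b)
  small = All.map s≤s (All.map proj₂ (↭ₚ.All-resp-↭ (↭-sym rest) (down-range n)))
  N∉ : N ∉ map f a
  N∉ N∈ = ℕₚ.<-irrefl refl (All.lookup small (∈-++⁺ˡ N∈))
  ∈a : ∀ {z} → z ∈ a → z ∈ x ∷ xs
  ∈a z∈ = subst (_ ∈_) (sym e) (∈-++⁺ˡ z∈)
  ∈b : ∀ {z} → z ∈ b → z ∈ x ∷ xs
  ∈b z∈ = subst (_ ∈_) (sym e) (∈-++⁺ʳ a (there z∈))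
  below : ∀ {c} → (∀ {z} → z ∈ c → z ∈ x ∷ xs) → All (_< N) (map f c) → All (_< m) c
  below inc s = All.tabulate (λ z∈ → mono (inc z∈) m∈ (subst (f _ <_) N≡fm (All.lookup s (∈-map⁺ f z∈))))
  unique : Unique (map f a ++ map f b)
  unique = Unique-resp-↭ (↭-sym rest) (down-unique n)
  lens : length a + length b ≡ n
  lens = ℕₚ.suc-injective (trans (sym (ℕₚ.+-suc (length a) (length b))) (trans (sym (length-++ a)) (sym (cong length e))))
  -- Standardizing the relabelled piece relabels `c` by `rankIn (map f c) ∘ f`, which again reflects
  -- the order, so the induction applies to `c` itself.
  sub : ∀ c → (∀ {z} → z ∈ c → z ∈ x ∷ xs) → Unique (map f c) → length c ≤ k → c ⊳ lamF k (st (map f c))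
  sub c inc u lc = subst (λ v → c ⊳ lamF k v) (map-∘ c)
    (⊳-lamF k c (rankIn (map f c) ∘ f)
      (λ y∈ z∈ lt → mono (inc y∈) (inc z∈) (rankIn-reflecting (map f c) (∈-map⁺ f y∈) (∈-map⁺ f z∈) lt))
      (subst (_↭ down (length c)) (sym (map-∘ c)) (subst (λ j → st (map f c) ↭ down j) (length-map f c) (st-↭ (map f c) u)))
      lc)
  Unique-++ˡ : ∀ (u : List ℕ) {v} → Unique (u ++ v) → Unique u
  Unique-++ˡ []      _       = []
  Unique-++ˡ (y ∷ u) (p ∷ q) = Allₚ.++⁻ˡ u p ∷ Unique-++ˡ u q
  Unique-++ʳ : ∀ (u : List ℕ) {v} → Unique (u ++ v) → Unique v
  Unique-++ʳ []      q       = q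
  Unique-++ʳ (y ∷ u) (p ∷ q) = Unique-++ʳ u q
  goal : x ∷ xs ⊳ lamF (suc k) (map f (x ∷ xs))
  goal = subst₂ _⊳_ (sym e)
    (sym (trans (cong (lamF (suc k)) map-f) (lamF-step k N (map f a) (map f b) (trans (cong length (sym map-f)) (cong suc (length-map f xs))) N∉)))
    (node (below ∈a (Allₚ.++⁻ˡ (map f a) small)) (below ∈b (Allₚ.++⁻ʳ (map f a) small))
      (sub a ∈a (Unique-++ˡ (map f a) unique) (ℕₚ.≤-trans (ℕₚ.≤-trans (ℕₚ.m≤m+n _ _) (ℕₚ.≤-reflexive lens)) le))
      (sub b ∈b (Unique-++ʳ (map f a) unique) (ℕₚ.≤-trans (ℕₚ.≤-trans (ℕₚ.m≤n+m _ (length a)) (ℕₚ.≤-reflexive lens)) le)))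

⊳-λP-st : ∀ {w} → Unique w → w ⊳ λP (st w)
⊳-λP-st {w} u = ⊳-lamF (length (st w)) w (rankIn w) (rankIn-reflecting w) (st-↭ w u) (ℕₚ.≤-reflexive (sym (length-map (rankIn w) w)))

⊳-λP : ∀ {σ} → IsPermutation σ → σ ⊳ λP σ
⊳-λP {σ} Vσ = subst (λ v → σ ⊳ lamF (length σ) v) (map-id σ)
  (⊳-lamF (length σ) σ id (λ _ _ lt → lt) (subst (_↭ down (length σ)) (sym (map-id σ)) Vσ) ℕₚ.≤-refl)

λP-γ : ∀ t → λP (γ t) ≡ t
λP-γ t = ⊳-functional (⊳-λP (γ-IsPermutation t)) (γ-⊳ t)

◁-∖T⁻ : ∀ r {s w} → w ◁ (r ∖T s) → ∃₂ λ a b → w ≡ a ++ b × a ◁ r × b ◁ s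
◁-∖T⁻ leaf      d = [] , _ , refl , leaf , d
◁-∖T⁻ (l ∨T r) (node {a} {m} p d e) with ◁-∖T⁻ r e
... | b , c , refl , f , g = a ++ m ∷ b , c , sym (++-assoc a (m ∷ b) c) , node p d f , g

◁-∖T⁺ : ∀ {r s a b} → a ◁ r → b ◁ s → a ++ b ◁ (r ∖T s)
◁-∖T⁺ leaf e = e
◁-∖T⁺ (node {a} {m} {b} p d f) e = subst (_◁ _) (sym (++-assoc a (m ∷ b) _)) (node p d (◁-∖T⁺ f e))

⊳-∖T : ∀ {r s a b} → a ⊳ r → b ⊳ s → All (λ x → All (_< x) b) a → a ++ b ⊳ (r ∖T s)
⊳-∖T leaf e h = e
⊳-∖T (node {a} {m} {b} p q d f) e h with Allₚ.++⁻ʳ a h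
... | hm ∷ hb = subst (_⊳ _) (sym (++-assoc a (m ∷ b) _)) (node p (Allₚ.++⁺ q hm) d (⊳-∖T f e hb))

λP-∖P : ∀ {ρ π} → IsPermutation ρ → IsPermutation π → λP (ρ ∖P π) ≡ λP ρ ∖T λP π
λP-∖P {ρ} {π} Vρ Vπ = ⊳-functional (⊳-λP (∖P-IsPermutation Vρ Vπ))
  (⊳-∖T (⊳-shift (length π) (⊳-λP Vρ)) (⊳-λP Vπ)
    (All.map (λ lt → All.map (λ (_ , y≤) → ℕₚ.≤-<-trans y≤ lt) (perm-range Vπ)) (shifted-above {ρ} π Vρ)))

γ-∖T : ∀ r s → γ (r ∖T s) ≡ γ r ∖P γ s
γ-∖T leaf     s = refl
γ-∖T (l ∨T r) s = trans (cong (γ l ∨P_) (γ-∖T r s)) (assoc (γ l) (γ r) (γ s))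
  where
  assoc : ∀ u v w → u ∨P (v ∖P w) ≡ (u ∨P v) ∖P w
  assoc u v w = sym (trans
    (cong (_++ w) (trans (map-++ (_+ length w) (map (_+ length v) u) _) (cong₂ _++_
      (trans (sym (map-∘ u)) (map-cong (λ x → trans (ℕₚ.+-assoc x (length v) (length w)) (cong (x +_) (sym (length-∖P v w)))) u))
      (cong (_∷ map (_+ length w) v) (trans (lem (length u) (length v) (length w))
        (cong (λ z → length u + z + 1) (sym (length-∖P v w))))))))
    (++-assoc (map (_+ length (v ∖P w)) u) _ w))
    where
    lem : ∀ a b c → a + b + 1 + c ≡ a + (b + c) + 1
    lem = solve-∀

-- Descents and compositions

Desc : List ℕ → ℕ → Set
Desc w i = ∃₂ λ x y → At w i x × At w (suc i) y × y < x

∈-Des⁻ : ∀ w {i} → i ∈ Des w → ∃ λ j → i ≡ suc j × Desc w j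
∈-Des⁻ w i∈ with ∈-map⁻ proj₁ i∈
... | (i , x) , a∈ , refl with ∈-filterB⁻ (indexed w) a∈
... | a∈′ , h with any-true (indexed w) h
... | (j , y) , b∈ , c with ∧-true {suc i ≡ᵇ j} c
... | e , gt with ∈-indexed⁻ w a∈′ | ∈-indexed⁻ w b∈
... | i′ , refl , ai | j′ , refl , aj with refl ← ≡ᵇ-true {i} {j′} e = i′ , refl , x , y , ai , aj , <ᵇ-true gt

∈-Des⁺ : ∀ w {j} → Desc w j → suc j ∈ Des w
∈-Des⁺ w {j} (x , y , ai , aj , gt) = ∈-map⁺ proj₁ (∈-filterB⁺ (indexed w) (∈-indexed⁺ ai)
  (true-any (indexed w) (∈-indexed⁺ aj) (true-∧ (true-≡ᵇ {j} refl) (true-<ᵇ gt))))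

-- The trailing `false` at the last letter makes the list as long as the word, so that it lines up
-- with the leaves of a tree, whose last leaf is a right child.
descentFlags : List ℕ → List Bool
descentFlags []          = []
descentFlags (x ∷ [])    = false ∷ []
descentFlags (x ∷ y ∷ w) = (y <ᵇ x) ∷ descentFlags (y ∷ w)

At-descentFlags⁻ : ∀ w {i b} → At (descentFlags w) i b → b ≡ true → Desc w i
At-descentFlags⁻ (x ∷ y ∷ w) here      e = x , y , here , there here , <ᵇ-true e
At-descentFlags⁻ (x ∷ y ∷ w) (there p) e with At-descentFlags⁻ (y ∷ w) p e
... | a , b , ai , bi , lt = a , b , there ai , there bi , lt
At-descentFlags⁻ (x ∷ []) here ()

At-descentFlags⁺ : ∀ w {i} → Desc w i → At (descentFlags w) i true
At-descentFlags⁺ (x ∷ y ∷ w) (_ , _ , here , there here , lt) =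
  subst (λ b → At (b ∷ descentFlags (y ∷ w)) 0 true) (sym (true-<ᵇ lt)) here
At-descentFlags⁺ (x ∷ y ∷ w) (a , b , there ai , there bi , lt) = there (At-descentFlags⁺ (y ∷ w) (a , b , ai , bi , lt))

descentFlags-++ : ∀ {N} u v → All (_< N) u → descentFlags (u ++ N ∷ v) ≡ descentFlags u ++ descentFlags (N ∷ v)
descentFlags-++ []          v []       = refl
descentFlags-++ {N} (x ∷ []) v (p ∷ []) = cong (_∷ descentFlags (N ∷ v)) (≢true⇒false (λ e → ℕₚ.<-asym p (<ᵇ-true e)))
descentFlags-++ (x ∷ y ∷ u) v (p ∷ ps) = cong ((y <ᵇ x) ∷_) (descentFlags-++ (y ∷ u) v ps)

descentFlags-shift : ∀ k u → descentFlags (map (_+ k) u) ≡ descentFlags u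
descentFlags-shift k []          = refl
descentFlags-shift k (x ∷ [])    = refl
descentFlags-shift k (x ∷ y ∷ u) = cong₂ _∷_
  (⇔⇒≡ (λ e → true-<ᵇ (ℕₚ.+-cancelʳ-< k y x (<ᵇ-true e))) (λ e → true-<ᵇ (ℕₚ.+-monoˡ-< k (<ᵇ-true {y} {x} e))))
  (descentFlags-shift k (y ∷ u))

isNode : Tree → Bool
isNode leaf     = false
isNode (_ ∨T _) = true

private
  childFlags : Tree → Bool → List Bool
  childFlags leaf     b = b ∷ []
  childFlags (l ∨T r) b = leafFlags (l ∨T r)

  leafFlags-unfold : ∀ l r → leafFlags (l ∨T r) ≡ childFlags l true ++ childFlags r false
  leafFlags-unfold leaf     leaf     = refl
  leafFlags-unfold leaf     (_ ∨T _) = refl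
  leafFlags-unfold (_ ∨T _) leaf     = refl
  leafFlags-unfold (_ ∨T _) (_ ∨T _) = refl

-- The top letter is never the lower end of a descent, and it starts one exactly when a letter
-- follows it, that is, when `r` is not a leaf.
descentFlags-γ : ∀ l r → descentFlags (γ (l ∨T r)) ≡ descentFlags (γ l) ++ isNode r ∷ descentFlags (γ r)
descentFlags-γ l r = trans (descentFlags-++ (map (_+ length (γ r)) (γ l)) (γ r) (top-left {π = γ r} (γ-IsPermutation l)))
  (cong₂ _++_ (descentFlags-shift (length (γ r)) (γ l)) (head-flag r (γ r) (length-γ r) (top-right {ρ = γ l} (γ-IsPermutation r))))
  where
  head-flag : ∀ {N} r v → length v ≡ size r → All (_< N) v → descentFlags (N ∷ v) ≡ isNode r ∷ descentFlags v
  head-flag leaf     []      _ _       = refl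
  head-flag (_ ∨T _) (y ∷ v) _ (p ∷ _) = cong (_∷ descentFlags (y ∷ v)) (true-<ᵇ p)

-- Both lists satisfy the same recursion: the last leaf of the left subtree and the first leaf of
-- the right subtree are governed by whether these subtrees are leaves. Consequently `Lset t` is the
-- descent set of `γ t`; the leading `true` belongs to leaf 0, which `Lset` discards.
leafFlags-node : ∀ l r → leafFlags (l ∨T r) ≡ true ∷ descentFlags (γ (l ∨T r))
leafFlags-node l r = trans (leafFlags-unfold l r) (trans (cong₂ _++_ (left-flags l) (right-flags r))
  (cong (true ∷_) (sym (descentFlags-γ l r))))
  where
  left-flags : ∀ l → childFlags l true ≡ true ∷ descentFlags (γ l)
  left-flags leaf     = refl
  left-flags (a ∨T b) = leafFlags-node a b
  right-flags : ∀ r → childFlags r false ≡ isNode r ∷ descentFlags (γ r)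
  right-flags leaf     = refl
  right-flags (a ∨T b) = leafFlags-node a b

∈-Lset⁻ : ∀ t {i} → i ∈ Lset t → ∃ λ j → i ≡ suc j × Desc (γ t) j
∈-Lset⁻ (l ∨T r) i∈ with ∈-map⁻ proj₁ i∈
... | (i , b) , a∈ , refl with ∈-filterB⁻ (zip (upTo (suc (size (l ∨T r)))) (leafFlags (l ∨T r))) a∈
... | a∈′ , h with ∧-true {1 ≤ᵇ i} h
... | i≥1 , h′ with ∧-true {i <ᵇ size (l ∨T r)} h′ | ∈-zip⁻ id (suc (size (l ∨T r))) (leafFlags (l ∨T r)) a∈′
... | _ , b≡true | i′ , refl , at with i | subst (λ fs → At fs i b) (leafFlags-node l r) at
... | suc j | there at′ = j , refl , At-descentFlags⁻ (γ (l ∨T r)) at′ b≡true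
∈-Lset⁻ (l ∨T r) i∈ | _ | _ | () , h′ | _ | _ | zero | _

∈-Lset⁺ : ∀ t {j} → Desc (γ t) j → suc j ∈ Lset t
∈-Lset⁺ (l ∨T r) {j} d@(_ , _ , _ , at , _) = ∈-map⁺ proj₁ (∈-filterB⁺ (zip (upTo (suc (size (l ∨T r)))) (leafFlags (l ∨T r)))
  (∈-zip⁺ id (suc (size (l ∨T r))) (ℕₚ.m≤n⇒m≤1+n bound)
    (subst (λ fs → At fs (suc j) true) (sym (leafFlags-node l r)) (there (At-descentFlags⁺ (γ (l ∨T r)) d))))
  (true-∧ {1 ≤ᵇ suc j} refl (true-∧ (true-<ᵇ bound) refl)))
  where
  bound : suc j < size (l ∨T r)
  bound = subst (suc j <_) (length-γ (l ∨T r)) (At-< at)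

Sorted : List ℕ → Set
Sorted = AllPairs _≤_

Sorted⇒¬Desc : ∀ {w i} → Sorted w → ¬ Desc w i
Sorted⇒¬Desc (p ∷ _) (_ , _ , here , there at , lt) = ℕₚ.<⇒≱ lt (All.lookup p (At-∈ at))
Sorted⇒¬Desc (_ ∷ s) (a , b , there ai , there bi , lt) = Sorted⇒¬Desc s (a , b , ai , bi , lt)

¬Desc⇒Sorted : ∀ w → (∀ i → ¬ Desc w i) → Sorted w
¬Desc⇒Sorted []          h = []
¬Desc⇒Sorted (x ∷ [])    h = [] ∷ []
¬Desc⇒Sorted (x ∷ y ∷ w) h with ¬Desc⇒Sorted (y ∷ w) (λ i (a , b , ai , bi , lt) → h (suc i) (a , b , there ai , there bi , lt))
... | p ∷ s = (x≤y ∷ All.map (ℕₚ.≤-trans x≤y) p) ∷ p ∷ s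
  where
  x≤y : x ≤ y
  x≤y = ℕₚ.≮⇒≥ (λ lt → h 0 (x , y , here , there here , lt))

Sorted-∷ʳ⁻ : ∀ u {m} → Sorted (u ∷ʳ m) → Sorted u × All (_≤ m) u
Sorted-∷ʳ⁻ []      _       = [] , []
Sorted-∷ʳ⁻ (x ∷ u) (p ∷ s) with Sorted-∷ʳ⁻ u s
... | s′ , q = Allₚ.++⁻ˡ u p ∷ s′ , All.head (Allₚ.++⁻ʳ u p) ∷ q

Sorted-∷ʳ⁺ : ∀ {u m} → Sorted u → All (_≤ m) u → Sorted (u ∷ʳ m)
Sorted-∷ʳ⁺ s p = AllPairsₚ.++⁺ s ([] ∷ []) (All.map (_∷ []) p)

size-oneT : ∀ k → size (oneT k) ≡ k
size-oneT zero    = refl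
size-oneT (suc k) = cong suc (trans (ℕₚ.+-identityʳ _) (size-oneT k))

-- All right subtrees of `oneT k` are leaves, so the conditions peel off the last letter again and
-- again, each time requiring it to bound all letters before it.
◁-oneT⁻ : ∀ k {w} → w ◁ oneT k → Sorted w
◁-oneT⁻ zero    leaf            = []
◁-oneT⁻ (suc k) (node p d leaf) = Sorted-∷ʳ⁺ (◁-oneT⁻ k d) p

length-∷ʳ : ∀ (u : List ℕ) m → length (u ∷ʳ m) ≡ suc (length u)
length-∷ʳ u m = trans (length-++ u) (ℕₚ.+-comm (length u) 1)

◁-oneT⁺ : ∀ k {w} → length w ≡ k → Sorted w → w ◁ oneT k
◁-oneT⁺ zero    {[]} _ _ = leaf
◁-oneT⁺ (suc k) {w} e s with initLast w
... | u ∷ʳ′ m with Sorted-∷ʳ⁻ u s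
... | s′ , p = node p (◁-oneT⁺ k (ℕₚ.suc-injective (trans (sym (length-∷ʳ u m)) e)) s′) leaf

Desc-++ˡ : ∀ {v w i} → Desc v i → Desc (v ++ w) i
Desc-++ˡ (x , y , ai , bi , lt) = x , y , At-++ˡ ai , At-++ˡ bi , lt

Desc-++ʳ : ∀ v {w i} → Desc w i → Desc (v ++ w) (length v + i)
Desc-++ʳ v {w} {i} (x , y , ai , bi , lt) = x , y , At-++ʳ v ai ,
  subst (λ j → At (v ++ w) j y) (ℕₚ.+-suc (length v) i) (At-++ʳ v bi) , lt

Desc-++⁻ : ∀ v {w i} → Desc (v ++ w) i →
  Desc v i ⊎ (suc i ≡ length v × w ≢ []) ⊎ (∃ λ j → i ≡ length v + j × Desc w j)
Desc-++⁻ v {w} {i} (x , y , ai , bi , lt) with At-++⁻ v ai | At-++⁻ v bi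
... | inj₁ p | inj₁ q = inj₁ (x , y , p , q , lt)
... | inj₁ p | inj₂ (j , e , q) = inj₂ (inj₁ (ℕₚ.≤-antisym (At-< p) (ℕₚ.≤-trans (ℕₚ.m≤m+n _ j) (ℕₚ.≤-reflexive (sym e))) ,
                                    λ { refl → ℕₚ.n≮0 (At-< q) }))
... | inj₂ (j , refl , p) | inj₁ q = contradiction (ℕₚ.<-trans (ℕₚ.n<1+n _) (At-< q)) (ℕₚ.≤⇒≯ (ℕₚ.m≤m+n (length v) j))
... | inj₂ (j , refl , p) | inj₂ (j′ , e , q) with refl ← ℕₚ.+-cancelˡ-≡ (length v) (suc j) j′ (trans (ℕₚ.+-suc (length v) j) e)
  = inj₂ (inj₂ (j , refl , x , y , p , q , lt))

DescentsIn : List ℕ → List ℕ → Set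
DescentsIn w S = ∀ i → Desc w i → suc i ∈ S

setOf-≥ : ∀ a β {i} → i ∈ setOf (a ∷ β) → a ≤ i
setOf-≥ a (b ∷ β) (here refl) = ℕₚ.≤-refl
setOf-≥ a (b ∷ β) (there i∈) with ∈-map⁻ (a +_) i∈
... | k , _ , refl = ℕₚ.m≤m+n a k

-- `Cset (suc a ∷ β)` unfolds to `oneT a ∨T Cset β`. A word below it is thus a weakly increasing
-- block of length `suc a` followed by a word below `Cset β`, and a new descent can occur only at
-- the block boundary.
◁-Cset⇒ : ∀ β → T (isComp β) → ∀ {w} → w ◁ Cset β → length w ≡ compSize β × DescentsIn w (setOf β)
◁-Cset⇒ []          Vβ leaf = refl , λ { i (_ , _ , () , _) }
◁-Cset⇒ (suc a ∷ β) Vβ (node {u} {m} {w} p d e) with ◁-Cset⇒ β Vβ e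
... | len , sub = trans (length-++ u) (trans (ℕₚ.+-suc (length u) (length w)) (cong suc (cong₂ _+_ len-u len))) , desc
  where
  len-u : length u ≡ a
  len-u = trans (◁-length d) (size-oneT a)
  len-v : length (u ∷ʳ m) ≡ suc a
  len-v = trans (length-∷ʳ u m) (cong suc len-u)
  desc : DescentsIn (u ++ m ∷ w) (setOf (suc a ∷ β))
  desc i D with Desc-++⁻ (u ∷ʳ m) (subst (λ z → Desc z i) (sym (++-assoc u (m ∷ []) w)) D)
  ... | inj₁ D′ = contradiction D′ (Sorted⇒¬Desc (Sorted-∷ʳ⁺ (◁-oneT⁻ a d) p))
  -- A descent across the boundary needs a letter after the block, so `β` is nonempty and `suc a` is
  -- an element of the set.
  ... | inj₂ (inj₁ (i≡ , w≢[])) = boundary β len (trans i≡ len-v)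
    where
    boundary : ∀ β → length w ≡ compSize β → suc i ≡ suc a → suc i ∈ setOf (suc a ∷ β)
    boundary []      l0 e = contradiction (empty w l0) w≢[]
      where
      empty : ∀ (w : List ℕ) → length w ≡ 0 → w ≡ []
      empty [] _ = refl
    boundary (b ∷ β) _  e = here e
  ... | inj₂ (inj₂ (j , refl , D′)) = later β (sub j D′)
    where
    later : ∀ β → suc j ∈ setOf β → suc (length (u ∷ʳ m) + j) ∈ setOf (suc a ∷ β)
    later (b ∷ β) j∈ = there (subst (_∈ map (suc a +_) (setOf (b ∷ β)))
      (trans (ℕₚ.+-suc (suc a) j) (cong (λ n → suc (n + j)) (sym len-v))) (∈-map⁺ (suc a +_) j∈))

⇒◁-Cset : ∀ β → T (isComp β) → ∀ w → length w ≡ compSize β → DescentsIn w (setOf β) → w ◁ Cset β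
⇒◁-Cset []          Vβ []  _   _   = leaf
⇒◁-Cset (suc a ∷ β) Vβ w₀ len₀ sub₀ = subst (_◁ Cset (suc a ∷ β)) (take++drop≡id (suc a) w₀)
    (build (take (suc a) w₀) len-v (subst (λ z → length z ≡ suc a + compSize β) (sym (take++drop≡id (suc a) w₀)) len₀)
           (subst (λ z → DescentsIn z (setOf (suc a ∷ β))) (sym (take++drop≡id (suc a) w₀)) sub₀))
  where
  len-v : length (take (suc a) w₀) ≡ suc a
  len-v = trans (length-take (suc a) w₀) (ℕₚ.m≤n⇒m⊓n≡m (ℕₚ.≤-trans (ℕₚ.m≤m+n (suc a) (compSize β)) (ℕₚ.≤-reflexive (sym len₀))))
  build : ∀ v {w} → length v ≡ suc a → length (v ++ w) ≡ suc a + compSize β → DescentsIn (v ++ w) (setOf (suc a ∷ β)) →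
          v ++ w ◁ Cset (suc a ∷ β)
  build v {w} lv len sub with initLast v
  -- The block has no descent: one inside it would give an element of the set smaller than `suc a`,
  -- against `setOf-≥`.
  ... | u ∷ʳ′ m with Sorted-∷ʳ⁻ u (¬Desc⇒Sorted (u ∷ʳ m) (λ { i D@(_ , _ , _ , at , _) →
          ℕₚ.<⇒≱ (subst (suc i <_) lv (At-< at)) (setOf-≥ (suc a) β (sub i (Desc-++ˡ D))) }))
  ... | s , p = subst (_◁ Cset (suc a ∷ β)) (sym (++-assoc u (m ∷ []) w))
    (node p (◁-oneT⁺ a (ℕₚ.suc-injective (trans (sym (length-∷ʳ u m)) lv)) s)
      (⇒◁-Cset β Vβ w (ℕₚ.+-cancelˡ-≡ (suc a) _ _ (trans (cong (_+ length w) (sym lv)) (trans (sym (length-++ (u ∷ʳ m))) len)))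
        (λ j D → later β (subst (λ n → suc (n + j) ∈ setOf (suc a ∷ β)) lv (sub _ (Desc-++ʳ (u ∷ʳ m) D))))))
    where
    later : ∀ β {j} → suc (suc a + j) ∈ setOf (suc a ∷ β) → suc j ∈ setOf β
    later (b ∷ β) {j} (here e) = contradiction e (λ e → ℕₚ.<-irrefl (sym e) (s≤s (ℕₚ.m≤m+n (suc a) j)))
    later (b ∷ β) {j} (there j∈) with ∈-map⁻ (suc a +_) j∈
    ... | k , k∈ , e with refl ← ℕₚ.+-cancelˡ-≡ (suc a) (suc j) k (trans (ℕₚ.+-suc (suc a) j) e) = k∈

subsetB⇒ : ∀ S S′ → subsetB S S′ ≡ true → ∀ {x} → x ∈ S → x ∈ S′
subsetB⇒ S S′ h {x} x∈ with any-true S′ (all-true S h x∈)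
... | y , y∈ , e with refl ← ≡ᵇ-true {x} {y} e = y∈

⇒subsetB : ∀ S S′ → (∀ {x} → x ∈ S → x ∈ S′) → subsetB S S′ ≡ true
⇒subsetB S S′ h = true-all S (λ {x} x∈ → true-any S′ (h x∈) (true-≡ᵇ {x} refl))

-- `γ t` represents `t`: both sides say that `γ t` has the right length and descends only at
-- elements of `setOf β`. The size is tested separately because `setOf` forgets the sum of a
-- composition.
Lset-leqT : ∀ t β → T (isComp β) → subsetB (Lset t) (setOf β) ∧ (compSize β ≡ᵇ size t) ≡ leqT t (Cset β)
Lset-leqT t β Vβ = ⇔⇒≡ fwd bwd
  where
  fwd : subsetB (Lset t) (setOf β) ∧ (compSize β ≡ᵇ size t) ≡ true → leqT t (Cset β) ≡ true
  fwd h with ∧-true {subsetB (Lset t) (setOf β)} h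
  ... | sub , len = ⊳-◁⇒leqT (γ-⊳ t) (⇒◁-Cset β Vβ (γ t) (trans (length-γ t) (sym (≡ᵇ-true len)))
                      (λ i D → subsetB⇒ (Lset t) (setOf β) sub (∈-Lset⁺ t D)))
  bwd : leqT t (Cset β) ≡ true → subsetB (Lset t) (setOf β) ∧ (compSize β ≡ᵇ size t) ≡ true
  bwd h with ◁-Cset⇒ β Vβ (⊳-leqT⇒◁ (γ-⊳ t) h)
  ... | len , sub = true-∧ (⇒subsetB (Lset t) (setOf β) λ x∈ → conv (∈-Lset⁻ t x∈)) (true-≡ᵇ (trans (sym len) (length-γ t)))
    where
    conv : ∀ {x} → (∃ λ j → x ≡ suc j × Desc (γ t) j) → x ∈ setOf β
    conv (j , refl , D) = sub j D

Des-leqW : ∀ σ β → T (isComp β) → subsetB (Des σ) (setOf β) ∧ (compSize β ≡ᵇ length σ) ≡ leqW σ (γ (Cset β))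
Des-leqW σ β Vβ = ⇔⇒≡ fwd bwd
  where
  fwd : subsetB (Des σ) (setOf β) ∧ (compSize β ≡ᵇ length σ) ≡ true → leqW σ (γ (Cset β)) ≡ true
  fwd h with ∧-true {subsetB (Des σ) (setOf β)} h
  ... | sub , len = ⊑⇒leqW σ _ (◁⇒⊑γ (⇒◁-Cset β Vβ σ (sym (≡ᵇ-true len))
                      (λ i D → subsetB⇒ (Des σ) (setOf β) sub (∈-Des⁺ σ D))))
  bwd : leqW σ (γ (Cset β)) ≡ true → subsetB (Des σ) (setOf β) ∧ (compSize β ≡ᵇ length σ) ≡ true
  bwd h with ◁-Cset⇒ β Vβ (⊑γ⇒◁ (Cset β) (leqW⇒⊑ σ _ h))
  ... | len , sub = true-∧ (⇒subsetB (Des σ) (setOf β) λ x∈ → conv (∈-Des⁻ σ x∈)) (true-≡ᵇ (sym len))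
    where
    conv : ∀ {x} → (∃ λ j → x ≡ suc j × Desc σ j) → x ∈ setOf β
    conv (j , refl , D) = sub j D

-- The enumeration of compositions, and fundamental quasi-symmetric functions

succHead : Comp → List Comp
succHead []      = []
succHead (a ∷ c) = (suc a ∷ c) ∷ []

comps-suc : ∀ n → comps (suc (suc n)) ≡ concatMap (λ c → (1 ∷ c) ∷ succHead c) (comps (suc n))
comps-suc n = concatMap-cong (λ { [] → refl ; (_ ∷ _) → refl }) (comps (suc n))

comps-valid : ∀ n → All (T ∘ isComp) (comps n)
comps-valid zero          = _ ∷ []
comps-valid (suc zero)    = _ ∷ []
comps-valid (suc (suc n)) = subst (All (T ∘ isComp)) (sym (comps-suc n)) (Allₚ.concat⁺ (Allₚ.map⁺ (All.map (λ {c} → step c) (comps-valid (suc n)))))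
  where
  step : ∀ c → T (isComp c) → All (T ∘ isComp) ((1 ∷ c) ∷ succHead c)
  step []          Vc = _ ∷ []
  step (suc a ∷ c) Vc = Vc ∷ Vc ∷ []

-- A composition of n + 2 comes from exactly one composition of n + 1: by deleting a first part
-- equal to 1, or by lowering a larger first part by one.
comps-pick : ∀ n β → T (isComp β) → ∀ k → ∑ (comps n) (λ c → ⟦ eqList c β ⟧ *ℚ k) ≡ ⟦ compSize β ≡ᵇ n ⟧ *ℚ k
comps-pick zero          []                  Vβ k = ℚₚ.+-identityʳ _
comps-pick zero          (suc a ∷ β)         Vβ k = ℚₚ.+-identityʳ _
comps-pick (suc zero)    []                  Vβ k = ℚₚ.+-identityʳ _
comps-pick (suc zero)    (suc zero ∷ [])     Vβ k = ℚₚ.+-identityʳ _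
comps-pick (suc zero)    (suc (suc a) ∷ [])  Vβ k = ℚₚ.+-identityʳ _
comps-pick (suc zero)    (suc zero ∷ suc b ∷ β)    Vβ k = ℚₚ.+-identityʳ _
comps-pick (suc zero)    (suc (suc a) ∷ suc b ∷ β) Vβ k = ℚₚ.+-identityʳ _
comps-pick (suc (suc n)) β Vβ k = trans (cong (λ l → ∑ l (λ c → ⟦ eqList c β ⟧ *ℚ k)) (comps-suc n))
  (trans (∑-concatMap _ (comps (suc n))) (by-head β Vβ))
  where
  weight : Comp → Comp → ℚ
  weight β c = ∑ ((1 ∷ c) ∷ succHead c) (λ c′ → ⟦ eqList c′ β ⟧ *ℚ k)
  by-head : ∀ β → T (isComp β) → ∑ (comps (suc n)) (weight β) ≡ ⟦ compSize β ≡ᵇ suc (suc n) ⟧ *ℚ k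
  by-head [] _ = trans (∑-zero (comps (suc n)) each) (sym (ℚₚ.*-zeroˡ k))
    where
    each : ∀ c → weight [] c ≡ 0ℚ
    each []      = trans (ℚₚ.+-identityʳ (0ℚ *ℚ k)) (ℚₚ.*-zeroˡ k)
    each (a ∷ c) = solve 1 (λ k → con 0ℚ :* k :+ (con 0ℚ :* k :+ con 0ℚ) := con 0ℚ) refl k
  by-head (suc zero ∷ β) Vβ = trans (∑-cong-All (comps-valid (suc n)) each) (comps-pick (suc n) β Vβ k)
    where
    each : ∀ c → T (isComp c) → weight (1 ∷ β) c ≡ ⟦ eqList c β ⟧ *ℚ k
    each []          _ = ℚₚ.+-identityʳ _
    each (suc a ∷ c) _ = solve 2 (λ x k → x :* k :+ (con 0ℚ :* k :+ con 0ℚ) := x :* k) refl ⟦ eqList (suc a ∷ c) β ⟧ k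
  by-head (suc (suc a) ∷ β) Vβ = trans (∑-cong (comps (suc n)) each) (comps-pick (suc n) (suc a ∷ β) Vβ k)
    where
    each : ∀ c → weight (suc (suc a) ∷ β) c ≡ ⟦ eqList c (suc a ∷ β) ⟧ *ℚ k
    each []      = ℚₚ.+-identityʳ _
    each (b ∷ c) = solve 2 (λ x k → con 0ℚ :* k :+ (x :* k :+ con 0ℚ) := x :* k) refl ⟦ eqList (b ∷ c) (suc a ∷ β) ⟧ k

FQ-coeff : ∀ n S β → T (isComp β) → ev (λ x → ⟦ eqList x β ⟧) (FQ n S) ≡ ⟦ subsetB S (setOf β) ∧ (compSize β ≡ᵇ n) ⟧
FQ-coeff n S β Vβ = trans (ev-units id (filterB (λ c → subsetB S (setOf c)) (comps n))) (trans (∑-filter _ (comps n)) (trans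
  (∑-cong (comps n) (λ c → trans (ℚₚ.*-comm ⟦ subsetB S (setOf c) ⟧ ⟦ eqList c β ⟧) (δ-absorb eqList-isEq (λ c → ⟦ subsetB S (setOf c) ⟧) c β)))
  (trans (comps-pick n β Vβ ⟦ subsetB S (setOf β) ⟧) (trans (ℚₚ.*-comm ⟦ compSize β ≡ᵇ n ⟧ ⟦ subsetB S (setOf β) ⟧) (sym (⟦∧⟧ (subsetB S (setOf β)) (compSize β ≡ᵇ n)))))))

FQ-valid : ∀ n S → All (T ∘ isComp ∘ proj₂) (FQ n S)
FQ-valid n S = Allₚ.map⁺ (All.map proj₁ (All-filterB (comps-valid n)))

-- Deconcatenation on trees, and the identity Z = γ ∘ C

deconcatenation : Comp → Tree → Tree → ℕ → ℚ
deconcatenation α r s i = ⟦ eqT (Cset (take i α)) r ⟧ *ℚ ⟦ eqT (Cset (drop i α)) s ⟧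

-- Induction on `α` and `r` together. The cut at 0 contributes only when `r` is a leaf; every later
-- cut has first part `suc a`, so it requires `oneT a` as the left subtree of `r` and leaves a
-- deconcatenation of the remaining parts.
Cset-deconcatenate : ∀ α → T (isComp α) → ∀ r s →
  ∑ (upTo (suc (length α))) (deconcatenation α r s) ≡ ⟦ eqT (Cset α) (r ∖T s) ⟧
Cset-deconcatenate [] Vα leaf     s = trans (ℚₚ.+-identityʳ _) (ℚₚ.*-identityˡ _)
Cset-deconcatenate [] Vα (_ ∨T _) s = trans (ℚₚ.+-identityʳ _) (ℚₚ.*-zeroˡ ⟦ eqT leaf s ⟧)
Cset-deconcatenate (suc a ∷ α) Vα leaf s = trans (∑-upTo-suc (suc (length α)) (deconcatenation (suc a ∷ α) leaf s)) (trans
  (cong₂ _+ℚ_ (ℚₚ.*-identityˡ ⟦ eqT (Cset (suc a ∷ α)) s ⟧) (∑-zero (upTo (suc (length α))) (λ i → ℚₚ.*-zeroˡ ⟦ eqT (Cset (drop i α)) s ⟧)))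
  (ℚₚ.+-identityʳ _))
Cset-deconcatenate (suc a ∷ α) Vα (l ∨T r) s = trans (∑-upTo-suc (suc (length α)) (deconcatenation (suc a ∷ α) (l ∨T r) s)) (trans
  (cong₂ _+ℚ_ (ℚₚ.*-zeroˡ ⟦ eqT (Cset (suc a ∷ α)) s ⟧)
    (trans (∑-cong (upTo (suc (length α))) (λ i → trans
      (cong (_*ℚ ⟦ eqT (Cset (drop i α)) s ⟧) (⟦∧⟧ (eqT (oneT a) l) (eqT (Cset (take i α)) r)))
      (ℚₚ.*-assoc ⟦ eqT (oneT a) l ⟧ _ _)))
    (trans (∑-*ˡ (upTo (suc (length α))) ⟦ eqT (oneT a) l ⟧)
      (trans (cong (⟦ eqT (oneT a) l ⟧ *ℚ_) (Cset-deconcatenate α Vα r s)) (sym (⟦∧⟧ (eqT (oneT a) l) _))))))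
  (ℚₚ.+-identityˡ _))

eqT-oneT : ∀ a b → eqT (oneT a) (oneT b) ≡ (a ≡ᵇ b)
eqT-oneT zero    zero    = refl
eqT-oneT zero    (suc b) = refl
eqT-oneT (suc a) zero    = refl
eqT-oneT (suc a) (suc b) = trans (∧-identityʳ _) (eqT-oneT a b)

eqT-Cset : ∀ α β → T (isComp α) → T (isComp β) → eqT (Cset α) (Cset β) ≡ eqList α β
eqT-Cset []          []          _  _  = refl
eqT-Cset []          (suc b ∷ β) _  _  = refl
eqT-Cset (suc a ∷ α) []          _  _  = refl
eqT-Cset (suc a ∷ α) (suc b ∷ β) Vα Vβ = cong₂ _∧_ (eqT-oneT a b) (eqT-Cset α β Vα Vβ)

γ-oneT : ∀ n → γ (oneT n) ≡ idP n
γ-oneT zero    = refl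
γ-oneT (suc n) = trans (cong₂ (λ u k → u ++ k ∷ []) (trans (map-cong (λ x → ℕₚ.+-identityʳ x) (γ (oneT n))) (trans (map-id _) (γ-oneT n)))
    (trans (cong (_+ 1) (trans (ℕₚ.+-identityʳ _) (trans (length-γ (oneT n)) (size-oneT n)))) (ℕₚ.+-comm n 1)))
  (trans (sym (map-++ suc (upTo n) (n ∷ []))) (cong (map suc) (upTo-∷ʳ n)))

Zset≡γCset : ∀ α → Zset α ≡ γ (Cset α)
Zset≡γCset []      = refl
Zset≡γCset (a ∷ α) = trans (cong₂ _∖P_ (sym (γ-oneT a)) (Zset≡γCset α)) (sym (γ-∖T (oneT a) (Cset α)))

-- The coalgebra maps

module W = FinPoset weakPoset
module Y = FinPoset tamariPoset

split-++ : ∀ {k} (a : List ℕ) {b} → length a ≡ k → take k (a ++ b) ≡ a × drop k (a ++ b) ≡ b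
split-++ []      refl = refl , refl
split-++ (x ∷ a) refl with split-++ a refl
... | e , f = cong (x ∷_) e , f

length-take-≤ : ∀ {i} (w : List ℕ) → i ≤ length w → length (take i w) ≡ i
length-take-≤ {i} w le = trans (length-take i w) (ℕₚ.m≤n⇒m⊓n≡m le)

split-≤ : ∀ {σ} (a b : List ℕ) {k} → σ ≡ a ++ b → length a ≡ k → k ≤ length σ
split-≤ a b refl refl = ℕₚ.≤-trans (ℕₚ.m≤m+n _ (length b)) (ℕₚ.≤-reflexive (sym (length-++ a)))

cutS : Perm → ℕ → Perm × Perm
cutS σ i = st (take i σ) , st (drop i σ)

cutY : Tree → ℕ → Tree × Tree
cutY t i = λP (st (take i (γ t))) , λP (st (drop i (γ t)))

cutQ : Comp → ℕ → Comp × Comp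
cutQ α i = take i α , drop i α

cuts : ∀ {A : Set} → (ℕ → A) → ℕ → Lc A
cuts h n = map (λ i → (1ℚ , h i)) (upTo (suc n))

ΔS-φ : ∀ v {ρ π} → IsPermutation ρ → IsPermutation π →
       ev (W.φ² ρ π) (ΔS v) ≡ ev (W.φ (ρ ∖P π)) v
ΔS-φ v {ρ} {π} Vρ Vπ = trans (ev-lin (λ σ → cuts (cutS σ) (length σ)) v) (ev-cong v (λ σ → trans (ev-units (cutS σ) (upTo (suc (length σ))) {W.φ² ρ π})
  (∑-upTo-cut (length σ) (length ρ) (leqW σ (ρ ∖P π)) (λ i → leqW (st (take i σ)) ρ) (λ i → leqW (st (drop i σ)) π)
    (only σ) (fwd σ) (bwd σ))))
  where
  only : ∀ σ i → i ≤ length σ → leqW (st (take i σ)) ρ ≡ true → i ≡ length ρ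
  only σ i le h = trans (sym (length-take-≤ σ le)) (⊑-length (st-⊑⁻ {take i σ} (leqW⇒⊑ (st (take i σ)) ρ h)))
  fwd : ∀ σ → leqW σ (ρ ∖P π) ≡ true →
        length ρ ≤ length σ × leqW (st (take (length ρ) σ)) ρ ≡ true × leqW (st (drop (length ρ) σ)) π ≡ true
  fwd σ h with ⊑-∖P⁻ {ρ} {π} (leqW⇒⊑ σ (ρ ∖P π) h)
  ... | a , b , e , p , q = split-≤ a b e (⊑-length p) ,
    ⊑⇒leqW _ ρ (st-⊑⁺ (subst (_⊑ ρ) (sym (trans (cong (take (length ρ)) e) (proj₁ (split-++ a (⊑-length p))))) p)) ,
    ⊑⇒leqW _ π (st-⊑⁺ (subst (_⊑ π) (sym (trans (cong (drop (length ρ)) e) (proj₂ (split-++ a (⊑-length p))))) q))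
  bwd : ∀ σ → length ρ ≤ length σ → leqW (st (take (length ρ) σ)) ρ ≡ true → leqW (st (drop (length ρ) σ)) π ≡ true →
        leqW σ (ρ ∖P π) ≡ true
  bwd σ _ h h′ = ⊑⇒leqW σ (ρ ∖P π) (subst (_⊑ ρ ∖P π) (take++drop≡id (length ρ) σ)
    (⊑-∖P⁺ Vρ Vπ (st-⊑⁻ {take (length ρ) σ} (leqW⇒⊑ _ ρ h)) (st-⊑⁻ {drop (length ρ) σ} (leqW⇒⊑ _ π h′))))

γ-unique : ∀ t → Unique (γ t)
γ-unique t = perm-unique (γ-IsPermutation t)

ΔY-φ : ∀ v r s → ev (Y.φ² r s) (ΔY v) ≡ ev (Y.φ (r ∖T s)) v
ΔY-φ v r s = trans (ev-lin (λ t → cuts (cutY t) (size t)) v) (ev-cong v (λ t → trans (ev-units (cutY t) (upTo (suc (size t))) {Y.φ² r s})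
  (∑-upTo-cut (size t) (size r) (leqT t (r ∖T s)) (λ i → leqT (λP (st (take i (γ t)))) r) (λ i → leqT (λP (st (drop i (γ t)))) s)
    (only t) (fwd t) (bwd t))))
  where
  take-⊳ : ∀ t i → take i (γ t) ⊳ λP (st (take i (γ t)))
  take-⊳ t i = ⊳-λP-st (AllPairsₚ.take⁺ i (γ-unique t))
  drop-⊳ : ∀ t i → drop i (γ t) ⊳ λP (st (drop i (γ t)))
  drop-⊳ t i = ⊳-λP-st (AllPairsₚ.drop⁺ i (γ-unique t))
  only : ∀ t i → i ≤ size t → leqT (λP (st (take i (γ t)))) r ≡ true → i ≡ size r
  only t i le h = trans (sym (length-take-≤ (γ t) (subst (i ≤_) (sym (length-γ t)) le))) (◁-length (⊳-leqT⇒◁ (take-⊳ t i) h))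
  fwd : ∀ t → leqT t (r ∖T s) ≡ true →
        size r ≤ size t × leqT (λP (st (take (size r) (γ t)))) r ≡ true × leqT (λP (st (drop (size r) (γ t)))) s ≡ true
  fwd t h with ◁-∖T⁻ r (⊳-leqT⇒◁ (γ-⊳ t) h)
  ... | a , b , e , p , q = subst (size r ≤_) (length-γ t) (split-≤ a b e (◁-length p)) ,
    ⊳-◁⇒leqT (take-⊳ t (size r)) (subst (_◁ r) (sym (trans (cong (take (size r)) e) (proj₁ (split-++ a (◁-length p))))) p) ,
    ⊳-◁⇒leqT (drop-⊳ t (size r)) (subst (_◁ s) (sym (trans (cong (drop (size r)) e) (proj₂ (split-++ a (◁-length p))))) q)
  bwd : ∀ t → size r ≤ size t → leqT (λP (st (take (size r) (γ t)))) r ≡ true → leqT (λP (st (drop (size r) (γ t)))) s ≡ true →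
        leqT t (r ∖T s) ≡ true
  bwd t _ h h′ = ⊳-◁⇒leqT (γ-⊳ t) (subst (_◁ (r ∖T s)) (take++drop≡id (size r) (γ t))
    (◁-∖T⁺ (⊳-leqT⇒◁ (take-⊳ t (size r)) h) (⊳-leqT⇒◁ (drop-⊳ t (size r)) h′)))

ΔS-Conc : ∀ {v} → Conc IsPermutation v → Conc W.V² (ΔS v)
ΔS-Conc {v} cv = Conc-lin {F = λ σ → cuts (cutS σ) (length σ)} {v} cv (λ σ Vσ → All⇒Conc {v = cuts (cutS σ) (length σ)} (Allₚ.map⁺ (All.universal
  (λ i → st-IsPermutation (AllPairsₚ.take⁺ i (perm-unique Vσ)) , st-IsPermutation (AllPairsₚ.drop⁺ i (perm-unique Vσ))) (upTo (suc (length σ))))))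

-- The image of γ, and transfer of coordinates from trees to permutations

isγ : Perm → Bool
isγ ρ = eqList (γ (λP ρ)) ρ

isγ-γ : ∀ t → isγ (γ t) ≡ true
isγ-γ t = trans (cong (λ s → eqList (γ s) (γ t)) (λP-γ t)) (IsEq.reflexive eqList-isEq (γ t))

length-γλP : ∀ {ρ} → IsPermutation ρ → length (γ (λP ρ)) ≡ length ρ
length-γλP {ρ} Vρ = trans (length-γ (λP ρ)) (sym (◁-length (⊳⇒◁ (⊳-λP Vρ))))

∖P-injective : ∀ a {b} c {d} → length a ≡ length c → length b ≡ length d → a ∖P b ≡ c ∖P d → a ≡ c × b ≡ d
∖P-injective a {b} c {d} la lb e = map-injective (λ {x} {y} → ℕₚ.+-cancelʳ-≡ (length b) x y) (proj₁ parts) , proj₂ parts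
  where
  cancel : ∀ (u v : List ℕ) {x y} → length u ≡ length v → u ++ x ≡ v ++ y → u ≡ v × x ≡ y
  cancel []      []      _ e = refl , e
  cancel (m ∷ u) (n ∷ v) l e with ∷-injective e
  ... | refl , e′ with cancel u v (ℕₚ.suc-injective l) e′
  ... | refl , f = refl , f
  parts : map (_+ length b) a ≡ map (_+ length b) c × b ≡ d
  parts = cancel (map (_+ length b) a) (map (_+ length b) c)
    (trans (length-map _ a) (trans la (sym (length-map _ c)))) (trans e (cong (λ n → map (_+ n) c ++ d) (sym lb)))

-- Both γ and λ respect the product and γ ∘ λ preserves length, so the two blocks of γ(λ(ρ∖π)) can
-- be compared with ρ and π separately.
isγ-∖P : ∀ {ρ π} → IsPermutation ρ → IsPermutation π → isγ (ρ ∖P π) ≡ isγ ρ ∧ isγ π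
isγ-∖P {ρ} {π} Vρ Vπ = trans (cong (λ u → eqList u (ρ ∖P π)) (trans (cong γ (λP-∖P Vρ Vπ)) (γ-∖T (λP ρ) (λP π)))) (⇔⇒≡ fwd bwd)
  where
  fwd : eqList (γ (λP ρ) ∖P γ (λP π)) (ρ ∖P π) ≡ true → isγ ρ ∧ isγ π ≡ true
  fwd h with ∖P-injective (γ (λP ρ)) ρ (length-γλP Vρ) (length-γλP Vπ) (IsEq.sound eqList-isEq h)
  ... | e , f = true-∧ (trans (cong (λ u → eqList u ρ) e) (IsEq.reflexive eqList-isEq ρ))
                       (trans (cong (λ u → eqList u π) f) (IsEq.reflexive eqList-isEq π))
  bwd : isγ ρ ∧ isγ π ≡ true → eqList (γ (λP ρ) ∖P γ (λP π)) (ρ ∖P π) ≡ true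
  bwd h with ∧-true {isγ ρ} h
  ... | e , f = trans (cong (λ u → eqList u (ρ ∖P π)) (cong₂ _∖P_ (IsEq.sound eqList-isEq {γ (λP ρ)} {ρ} e) (IsEq.sound eqList-isEq {γ (λP π)} {π} f)))
                      (IsEq.reflexive eqList-isEq (ρ ∖P π))

eqList-γ : ∀ s ρ → ⟦ eqList (γ s) ρ ⟧ ≡ ⟦ isγ ρ ⟧ *ℚ ⟦ eqT s (λP ρ) ⟧
eqList-γ s ρ = trans (cong ⟦_⟧ (⇔⇒≡ fwd bwd)) (⟦∧⟧ (isγ ρ) (eqT s (λP ρ)))
  where
  fwd : eqList (γ s) ρ ≡ true → isγ ρ ∧ eqT s (λP ρ) ≡ true
  fwd h with refl ← IsEq.sound eqList-isEq {γ s} {ρ} h = true-∧ (isγ-γ s)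
    (trans (cong (eqT s) (λP-γ s)) (IsEq.reflexive eqT-isEq s))
  bwd : isγ ρ ∧ eqT s (λP ρ) ≡ true → eqList (γ s) ρ ≡ true
  bwd h with ∧-true {isγ ρ} h
  ... | e , f = trans (cong (λ t → eqList (γ t) ρ) (IsEq.sound eqT-isEq {s} {λP ρ} f)) e

-- G : X → 𝔖Sym factors through H : X → 𝒴Sym in monomial coordinates.
Lifts : ∀ {A : Set} → (Lc A → Lc Perm) → (Lc A → Lc Tree) → Set
Lifts G H = ∀ u ρ → IsPermutation ρ → ev (W.φ ρ) (G u) ≡ ⟦ isγ ρ ⟧ *ℚ ev (Y.φ (λP ρ)) (H u)

module _ {A : Set} (G : Lc A → Lc Perm) (H : Lc A → Lc Tree) (lifts : Lifts G H) where

  lifts-γ : ∀ u t → ev (W.φ (γ t)) (G u) ≡ ev (Y.φ t) (H u)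
  lifts-γ u t = trans (lifts u (γ t) (γ-IsPermutation t)) (trans
    (cong₂ (λ b s → ⟦ b ⟧ *ℚ ev (Y.φ s) (H u)) (isγ-γ t) (λP-γ t)) (ℚₚ.*-identityˡ _))

  -- `isγ` is multiplicative for `∖P`, so its indicator factors over the two tensor legs, and what
  -- remains is the hypothesis on coordinates of `H`. It is used with `H = id` for `Γ` and with
  -- `H = 𝒞` for `𝒵`.
  lifts-comultiplicative : (D : Lc A → Lc (A × A)) → (∀ u → Conc IsPermutation (G u)) → ∀ v →
    (∀ r s → ev (Y.φ (r ∖T s)) (H v) ≡ ev (λ p → ev (Y.φ r) (H (bv (proj₁ p))) *ℚ ev (Y.φ s) (H (bv (proj₂ p)))) (D v)) →
    ΔS (G v) ≈SS tmap G G (D v)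
  lifts-comultiplicative D cG v hyp = W.separate² (ΔS (G v)) (tmap G G (D v)) (ΔS-Conc {G v} (cG v))
    (Conc-lin {v = D v} (Conc-⊤ (D v)) (λ (a , b) _ → Conc-tens {v = G (bv a)} {G (bv b)} (cG (bv a)) (cG (bv b))))
    coordinates
    where
    open ≡-Reasoning
    coordinates : ∀ ρ π → IsPermutation ρ → IsPermutation π → ev (W.φ² ρ π) (ΔS (G v)) ≡ ev (W.φ² ρ π) (tmap G G (D v))
    coordinates ρ π Vρ Vπ = begin
      ev (W.φ² ρ π) (ΔS (G v))                                    ≡⟨ ΔS-φ (G v) Vρ Vπ ⟩
      ev (W.φ (ρ ∖P π)) (G v)                                     ≡⟨ lifts v (ρ ∖P π) (∖P-IsPermutation Vρ Vπ) ⟩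
      ⟦ isγ (ρ ∖P π) ⟧ *ℚ ev (Y.φ (λP (ρ ∖P π))) (H v)            ≡⟨ cong₂ _*ℚ_ (trans (cong ⟦_⟧ (isγ-∖P Vρ Vπ)) (⟦∧⟧ (isγ ρ) (isγ π)))
                                                                      (trans (cong (λ t → ev (Y.φ t) (H v)) (λP-∖P Vρ Vπ)) (hyp (λP ρ) (λP π))) ⟩
      (⟦ isγ ρ ⟧ *ℚ ⟦ isγ π ⟧) *ℚ ev h (D v)                      ≡⟨ sym (ev-*ˡ (D v) (⟦ isγ ρ ⟧ *ℚ ⟦ isγ π ⟧)) ⟩
      ev (λ p → (⟦ isγ ρ ⟧ *ℚ ⟦ isγ π ⟧) *ℚ h p) (D v)            ≡⟨ ev-cong (D v) regroup ⟩
      ev (λ p → ev (W.φ ρ) (G (bv (proj₁ p))) *ℚ ev (W.φ π) (G (bv (proj₂ p)))) (D v) ≡⟨ sym (ev-tmap G (D v)) ⟩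
      ev (W.φ² ρ π) (tmap G G (D v))                              ∎
      where
      h : A × A → ℚ
      h p = ev (Y.φ (λP ρ)) (H (bv (proj₁ p))) *ℚ ev (Y.φ (λP π)) (H (bv (proj₂ p)))
      regroup : ∀ p → (⟦ isγ ρ ⟧ *ℚ ⟦ isγ π ⟧) *ℚ h p ≡ ev (W.φ ρ) (G (bv (proj₁ p))) *ℚ ev (W.φ π) (G (bv (proj₂ p)))
      regroup (a , b) = trans
        (solve 4 (λ i j x y → (i :* j) :* (x :* y) := (i :* x) :* (j :* y)) refl ⟦ isγ ρ ⟧ ⟦ isγ π ⟧
          (ev (Y.φ (λP ρ)) (H (bv a))) (ev (Y.φ (λP π)) (H (bv b))))
        (sym (cong₂ _*ℚ_ (lifts (bv a) ρ Vρ) (lifts (bv b) π Vπ)))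

εS≡φ : ∀ v → εS v ≡ ev (W.φ (γ leaf)) v
εS≡φ v = ∑-cong v (λ { (c , []) → sym (ℚₚ.*-identityʳ c) ; (c , x ∷ w) → sym (ℚₚ.*-zeroʳ c) })

εY≡φ : ∀ v → εY v ≡ ev (Y.φ leaf) v
εY≡φ v = ∑-cong v (λ { (c , leaf) → sym (ℚₚ.*-identityʳ c) ; (c , l ∨T r) → sym (trans
  (cong (λ b → c *ℚ ⟦ b ⟧) (≢true⇒false {leqT (l ∨T r) leaf} (λ h → ℕₚ.1+n≢0 (⟶*-size (leqT⇒⟶* {l ∨T r} h))))) (ℚₚ.*-zeroʳ c)) })

φ-𝒞 : ∀ v s → ev (Y.φ s) (𝒞 v) ≡ ev (λ α → ⟦ eqT (Cset α) s ⟧) v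
φ-𝒞 v s = trans (ev-lin _ v) (ev-cong v (λ α → Y.φ-M {Cset α} {s} tt tt))

IsComp : Comp → Set
IsComp α = T (isComp α)

𝒞-deconcatenate : ∀ {v} → Conc IsComp v → ∀ r s →
  ev (Y.φ (r ∖T s)) (𝒞 v) ≡ ev (λ p → ev (Y.φ r) (𝒞 (bv (proj₁ p))) *ℚ ev (Y.φ s) (𝒞 (bv (proj₂ p)))) (ΔQ v)
𝒞-deconcatenate {v} cv r s = trans (φ-𝒞 v (r ∖T s)) (sym (trans (ev-lin (λ α → cuts (cutQ α) (length α)) v) (cv _ _ (λ α Vα →
  trans (ev-units (cutQ α) (upTo (suc (length α))) {λ p → ev (Y.φ r) (𝒞 (bv (proj₁ p))) *ℚ ev (Y.φ s) (𝒞 (bv (proj₂ p)))}) (trans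
    (∑-cong (upTo (suc (length α))) (λ i → cong₂ _*ℚ_ (φ-𝒞-bv (take i α) r) (φ-𝒞-bv (drop i α) s)))
    (Cset-deconcatenate α Vα r s))))))
  where
  φ-𝒞-bv : ∀ α s → ev (Y.φ s) (𝒞 (bv α)) ≡ ⟦ eqT (Cset α) s ⟧
  φ-𝒞-bv α s = trans (φ-𝒞 (bv α) s) (ev-bv (λ α → ⟦ eqT (Cset α) s ⟧) α)

𝒞-comultiplicative : ∀ {v} → Conc IsComp v → ΔY (𝒞 v) ≈YY tmap 𝒞 𝒞 (ΔQ v)
𝒞-comultiplicative {v} cv = Y.separate² (ΔY (𝒞 v)) (tmap 𝒞 𝒞 (ΔQ v))
  (λ f g h → ev-cong (ΔY (𝒞 v)) (λ p → h p (tt , tt))) (λ f g h → ev-cong (tmap 𝒞 𝒞 (ΔQ v)) (λ p → h p (tt , tt)))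
  (λ r s _ _ → trans (ΔY-φ (𝒞 v) r s) (trans (𝒞-deconcatenate {v} cv r s) (sym (ev-tmap 𝒞 (ΔQ v)))))

𝒵-lifts-𝒞 : Lifts 𝒵 𝒞
𝒵-lifts-𝒞 u ρ Vρ = trans (ev-lin _ u) (trans (ev-cong u each) (trans (ev-*ˡ u ⟦ isγ ρ ⟧) (cong (⟦ isγ ρ ⟧ *ℚ_) (sym (φ-𝒞 u (λP ρ))))))
  where
  each : ∀ α → ev (W.φ ρ) (MS (Zset α)) ≡ ⟦ isγ ρ ⟧ *ℚ ⟦ eqT (Cset α) (λP ρ) ⟧
  each α rewrite Zset≡γCset α = trans (W.φ-M (γ-IsPermutation (Cset α)) Vρ) (eqList-γ (Cset α) ρ)

𝒵-Conc : ∀ v → Conc IsPermutation (𝒵 v)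
𝒵-Conc v = Conc-lin {v = v} (Conc-⊤ v) (λ α _ → W.M-Conc (Zset α))

coeff-𝒞 : ∀ {v} → Conc IsComp v → ∀ β → IsComp β → ev (λ α → ⟦ eqList α β ⟧) v ≡ ev (Y.φ (Cset β)) (𝒞 v)
coeff-𝒞 {v} cv β Vβ = trans (cv _ _ (λ α Vα → cong ⟦_⟧ (sym (eqT-Cset α β Vα Vβ)))) (sym (φ-𝒞 v (Cset β)))

-- Labels that are not compositions have coefficient 0 in both vectors, by concentration, so
-- agreement on compositions suffices.
≈Q-intro : ∀ v w → Conc IsComp v → Conc IsComp w →
           (∀ β → IsComp β → ev (λ α → ⟦ eqList α β ⟧) v ≡ ev (λ α → ⟦ eqList α β ⟧) w) → v ≈Q w
≈Q-intro v w cv cw h = EqV-intro eqList-isEq v w go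
  where
  outside : ∀ β → isComp β ≡ false → ∀ u → Conc IsComp u → ev (λ α → ⟦ eqList α β ⟧) u ≡ 0ℚ
  outside β e u cu = trans (cu _ _ (λ α Vα → cong ⟦_⟧ (IsEq.≢⇒false eqList-isEq {α} {β} (λ { refl → subst T e Vα })))) (ev-zero u)
  go : ∀ β → ev (λ α → ⟦ eqList α β ⟧) v ≡ ev (λ α → ⟦ eqList α β ⟧) w
  go β with bool? (isComp β)
  ... | inj₁ e = h β (≡true⇒T e)
  ... | inj₂ e = trans (outside β e v cv) (sym (outside β e w cw))

-- M_β occurs in F_{L(t)} exactly when L(t) is contained in the set of β, that is, when t ≤ C(β). So
-- `𝓛` reads off the monomial coordinates at the trees C(β), where `𝒞` stores the coefficients.
coeff-𝓛 : ∀ u β → IsComp β → ev (λ α → ⟦ eqList α β ⟧) (𝓛 u) ≡ ev (Y.φ (Cset β)) u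
coeff-𝓛 u β Vβ = trans (ev-lin _ u) (ev-cong u (λ t → trans (FQ-coeff (size t) (Lset t) β Vβ) (cong ⟦_⟧ (Lset-leqT t β Vβ))))

coeff-𝓓 : ∀ u β → IsComp β → ev (λ α → ⟦ eqList α β ⟧) (𝓓 u) ≡ ev (W.φ (γ (Cset β))) u
coeff-𝓓 u β Vβ = trans (ev-lin _ u) (ev-cong u (λ σ → trans (FQ-coeff (length σ) (Des σ) β Vβ) (cong ⟦_⟧ (Des-leqW σ β Vβ))))

φ-Λ : ∀ {u} → Conc IsPermutation u → ∀ s → ev (Y.φ s) (Λ u) ≡ ev (W.φ (γ s)) u
φ-Λ {u} cu s = trans (ev-lin _ u) (cu _ _ (λ σ Vσ → trans (ev-bv (Y.φ s) (λP σ)) (cong ⟦_⟧ (⇔⇒≡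
  (λ h → ⊑⇒leqW σ (γ s) (◁⇒⊑γ (⊳-leqT⇒◁ (⊳-λP Vσ) h)))
  (λ h → ⊳-◁⇒leqT (⊳-λP Vσ) (⊑γ⇒◁ s (leqW⇒⊑ σ (γ s) h)))))))

-- The map Γ, determined by its values on the monomial basis

module _ (Γ : Lc Tree → Lc Perm) (linear : IsLinear eqT eqList Γ) (Γ-M : ∀ t → Γ (MY t) ≈S MS (γ t)) where
  open IsLinear linear

  private
    ev-≈S : ∀ v w → v ≈S w → ∀ f → ev f v ≡ ev f w
    ev-≈S v w = ev-resp eqList-isEq v w

  -- The list `Γ []` may be nonempty; homogeneity with scalar 0 shows that it represents the zero
  -- vector.
  Γ-[] : ∀ f → ev f (Γ []) ≡ 0ℚ
  Γ-[] f = trans (ev-≈S (Γ []) (scale 0ℚ (Γ [])) (homogeneous 0ℚ []) f) (trans (ev-scale 0ℚ (Γ [])) (ℚₚ.*-zeroˡ (ev f (Γ []))))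

  Γ-++ : ∀ f v w → ev f (Γ (v ++ w)) ≡ ev f (Γ v) +ℚ ev f (Γ w)
  Γ-++ f v w = trans (ev-≈S (Γ (v ++ w)) (Γ v ++ Γ w) (additive v w) f) (ev-++ (Γ v) (Γ w))

  Γ-concatMap-M : ∀ f ts → ev f (Γ (concatMap MY ts)) ≡ ∑ ts (λ t → ev f (MS (γ t)))
  Γ-concatMap-M f []       = Γ-[] f
  Γ-concatMap-M f (t ∷ ts) = trans (Γ-++ f (MY t) (concatMap MY ts))
    (cong₂ _+ℚ_ (ev-≈S (Γ (MY t)) (MS (γ t)) (Γ-M t) f) (Γ-concatMap-M f ts))

  Γ-F : ∀ f t → ev f (Γ (bv t)) ≡ ∑ (Y.above t) (λ s → ev f (MS (γ s)))
  Γ-F f t = trans (ev-≈S (Γ (bv t)) (Γ (concatMap MY (Y.above t))) (respects (bv t) (concatMap MY (Y.above t)) (Y.M-expansion {t} tt)) f)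
    (Γ-concatMap-M f (Y.above t))

  ev-Γ : ∀ f v → ev f (Γ v) ≡ ev (λ t → ev f (Γ (bv t))) v
  ev-Γ f []            = Γ-[] f
  ev-Γ f ((c , t) ∷ v) = trans (Γ-++ f ((c , t) ∷ []) v) (cong₂ _+ℚ_
    -- Writing `c` as `c *ℚ 1ℚ` exhibits the single term as `scale c (bv t)`, to which homogeneity
    -- applies.
    (trans (cong (λ d → ev f (Γ ((d , t) ∷ []))) (sym (ℚₚ.*-identityʳ c)))
      (trans (ev-≈S (Γ (scale c (bv t))) (scale c (Γ (bv t))) (homogeneous c (bv t)) f) (ev-scale c (Γ (bv t)))))
    (ev-Γ f v))

  -- On functionals, `Γ v` agrees with a combination of the `MS (γ s)`, which are concentrated on
  -- permutations; any other words in the list `Γ v` cancel.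
  Γ-Conc : ∀ v → Conc IsPermutation (Γ v)
  Γ-Conc v f g h = trans (ev-Γ f v) (trans (ev-cong v (λ t → trans (Γ-F f t) (trans
    (∑-cong (Y.above t) (λ s → W.M-Conc (γ s) f g h)) (sym (Γ-F g t))))) (sym (ev-Γ g v)))

  -- For F_t, the functional `φ ρ` counts the trees s ≥ t with γ(s) = ρ. There is one only if ρ lies
  -- in the image of γ, and it can only be λ(ρ), so the count is 1 exactly when moreover t ≤ λ(ρ).
  Γ-lifts-id : Lifts Γ id
  Γ-lifts-id u ρ Vρ = trans (ev-Γ (W.φ ρ) u) (trans (ev-cong u each) (ev-*ˡ u ⟦ isγ ρ ⟧))
    where
    each : ∀ t → ev (W.φ ρ) (Γ (bv t)) ≡ ⟦ isγ ρ ⟧ *ℚ Y.φ (λP ρ) t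
    each t = trans (Γ-F (W.φ ρ) t) (trans
      (∑-cong (Y.above t) (λ s → trans (W.φ-M (γ-IsPermutation s) Vρ) (eqList-γ s ρ)))
      (trans (∑-*ˡ (Y.above t) ⟦ isγ ρ ⟧) (cong (⟦ isγ ρ ⟧ *ℚ_) (Y.∑-above t tt))))

  Γ𝒞≈𝒵 : ∀ v → Γ (𝒞 v) ≈S 𝒵 v
  Γ𝒞≈𝒵 v = W.separate (Γ (𝒞 v)) (𝒵 v) (Γ-Conc (𝒞 v)) (𝒵-Conc v)
    (λ ρ Vρ → trans (Γ-lifts-id (𝒞 v) ρ Vρ) (sym (𝒵-lifts-𝒞 v ρ Vρ)))

theorem7p1 : (Γ : Lc Tree → Lc Perm) →
    IsLinear eqT eqList Γ →
    (∀ t → Γ (MY t) ≈S MS (γ t)) →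
    ((∀ v w → ValidQ v → ValidQ w → 𝒞 v ≈Y 𝒞 w → v ≈Q w)
    × (∀ v → ValidQ v → ΔY (𝒞 v) ≈YY tmap 𝒞 𝒞 (ΔQ v))
    × (∀ v → ValidQ v → εY (𝒞 v) ≡ εQ v))
    × ((∀ v w → Γ v ≈S Γ w → v ≈Y w)
    × (∀ v → ΔS (Γ v) ≈SS tmap Γ Γ (ΔY v))
    × (∀ v → εS (Γ v) ≡ εY v))
    × ((∀ v w → ValidQ v → ValidQ w → 𝒵 v ≈S 𝒵 w → v ≈Q w)
    × (∀ v → ValidQ v → ΔS (𝒵 v) ≈SS tmap 𝒵 𝒵 (ΔQ v))
    × (∀ v → ValidQ v → εS (𝒵 v) ≡ εQ v))
    × (∀ v → ValidQ v → Γ (𝒞 v) ≈S 𝒵 v)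
    × (∀ v → ValidQ v → 𝓛 (𝒞 v) ≈Q v)
    × (∀ v → Λ (Γ v) ≈Y v)
    × (∀ v → ValidQ v → 𝓓 (𝒵 v) ≈Q v)
theorem7p1 Γ linear Γ-M =
    (𝒞-injective , (λ v Vv → 𝒞-comultiplicative {v} (All⇒Conc Vv)) , εY-𝒞)
  , (Γ-injective , Γ-comultiplicative , εS-Γ)
  , (𝒵-injective , 𝒵-comultiplicative , εS-𝒵)
  , (λ v _ → Γ𝒞≈𝒵 Γ linear Γ-M v)
  , 𝓛𝒞 , ΛΓ , 𝓓𝒵
  where
  lifts : Lifts Γ id
  lifts = Γ-lifts-id Γ linear Γ-M
  concΓ : ∀ v → Conc IsPermutation (Γ v)
  concΓ = Γ-Conc Γ linear Γ-M

  coeff-𝒵 : ∀ v → ValidQ v → ∀ β → IsComp β → ev (λ α → ⟦ eqList α β ⟧) v ≡ ev (W.φ (γ (Cset β))) (𝒵 v)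
  coeff-𝒵 v Vv β Vβ = trans (coeff-𝒞 {v} (All⇒Conc Vv) β Vβ) (sym (lifts-γ 𝒵 𝒞 𝒵-lifts-𝒞 v (Cset β)))

  𝒞-injective : ∀ v w → ValidQ v → ValidQ w → 𝒞 v ≈Y 𝒞 w → v ≈Q w
  𝒞-injective v w Vv Vw e = ≈Q-intro v w (All⇒Conc Vv) (All⇒Conc Vw) (λ β Vβ →
    trans (coeff-𝒞 {v} (All⇒Conc Vv) β Vβ) (trans (ev-resp eqT-isEq (𝒞 v) (𝒞 w) e (Y.φ (Cset β))) (sym (coeff-𝒞 {w} (All⇒Conc Vw) β Vβ))))

  𝒵-injective : ∀ v w → ValidQ v → ValidQ w → 𝒵 v ≈S 𝒵 w → v ≈Q w
  𝒵-injective v w Vv Vw e = ≈Q-intro v w (All⇒Conc Vv) (All⇒Conc Vw) (λ β Vβ →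
    trans (coeff-𝒵 v Vv β Vβ) (trans (ev-resp eqList-isEq (𝒵 v) (𝒵 w) e (W.φ (γ (Cset β)))) (sym (coeff-𝒵 w Vw β Vβ))))

  Γ-injective : ∀ v w → Γ v ≈S Γ w → v ≈Y w
  Γ-injective v w e = Y.separate v w (Conc-⊤ v) (Conc-⊤ w) (λ s _ → trans (sym (lifts-γ Γ id lifts v s))
    (trans (ev-resp eqList-isEq (Γ v) (Γ w) e (W.φ (γ s))) (lifts-γ Γ id lifts w s)))

  Γ-comultiplicative : ∀ v → ΔS (Γ v) ≈SS tmap Γ Γ (ΔY v)
  Γ-comultiplicative v = lifts-comultiplicative Γ id lifts ΔY concΓ v (λ r s → trans (sym (ΔY-φ v r s))
    (ev-cong (ΔY v) (λ (a , b) → sym (cong₂ _*ℚ_ (ev-bv (Y.φ r) a) (ev-bv (Y.φ s) b)))))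

  𝒵-comultiplicative : ∀ v → ValidQ v → ΔS (𝒵 v) ≈SS tmap 𝒵 𝒵 (ΔQ v)
  𝒵-comultiplicative v Vv = lifts-comultiplicative 𝒵 𝒞 𝒵-lifts-𝒞 ΔQ 𝒵-Conc v (𝒞-deconcatenate {v} (All⇒Conc Vv))

  εY-𝒞 : ∀ v → ValidQ v → εY (𝒞 v) ≡ εQ v
  εY-𝒞 v Vv = trans (εY≡φ (𝒞 v)) (trans (φ-𝒞 v leaf) (sym (∑-cong-All Vv λ
    { (c , []) _ → sym (ℚₚ.*-identityʳ c) ; (c , suc a ∷ α) _ → sym (ℚₚ.*-zeroʳ c) })))

  εS-Γ : ∀ v → εS (Γ v) ≡ εY v
  εS-Γ v = trans (εS≡φ (Γ v)) (trans (lifts-γ Γ id lifts v leaf) (sym (εY≡φ v)))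

  εS-𝒵 : ∀ v → ValidQ v → εS (𝒵 v) ≡ εQ v
  εS-𝒵 v Vv = trans (εS≡φ (𝒵 v)) (trans (lifts-γ 𝒵 𝒞 𝒵-lifts-𝒞 v leaf) (trans (sym (εY≡φ (𝒞 v))) (εY-𝒞 v Vv)))

  𝓛𝒞 : ∀ v → ValidQ v → 𝓛 (𝒞 v) ≈Q v
  𝓛𝒞 v Vv = ≈Q-intro (𝓛 (𝒞 v)) v (Conc-lin {v = 𝒞 v} (Conc-⊤ (𝒞 v)) (λ t _ → All⇒Conc (FQ-valid (size t) (Lset t)))) (All⇒Conc Vv)
    (λ β Vβ → trans (coeff-𝓛 (𝒞 v) β Vβ) (sym (coeff-𝒞 {v} (All⇒Conc Vv) β Vβ)))

  𝓓𝒵 : ∀ v → ValidQ v → 𝓓 (𝒵 v) ≈Q v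
  𝓓𝒵 v Vv = ≈Q-intro (𝓓 (𝒵 v)) v (Conc-lin {v = 𝒵 v} (Conc-⊤ (𝒵 v)) (λ σ _ → All⇒Conc (FQ-valid (length σ) (Des σ)))) (All⇒Conc Vv)
    (λ β Vβ → trans (coeff-𝓓 (𝒵 v) β Vβ) (sym (coeff-𝒵 v Vv β Vβ)))

  ΛΓ : ∀ v → Λ (Γ v) ≈Y v
  ΛΓ v = Y.separate (Λ (Γ v)) v (Conc-⊤ (Λ (Γ v))) (Conc-⊤ v)
    (λ s _ → trans (φ-Λ {Γ v} (concΓ v) s) (lifts-γ Γ id lifts v s))
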